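{- Let $r\geq 1$ be an integer and let $H$ be a fixed graph with chromatic number $\chi(H)=r+1$. Then there is a constant $C=C(H)$ such that for every $\varepsilon>0$ there exists $n_0$ with the following property. Whenever $n\geq n_0$ and $G$ is an $n$-vertex graph with minimum degree \[\delta(G)>\left(1-\frac{3}{3r-1}+\varepsilon\right)n\] which does not contain $H$ as a subgraph, one can delete at most $C\,\mathrm{biex}(n,H)$ edges from $G$ to obtain an $r$-partite graph.
   Context: For a graph $H$ with chromatic number $\chi(H)$, consider every proper colouring $c:V(H)\to\{1,\dots,\chi(H)\}$ of $H$ with $\chi(H)$ colours, and let $S_c=c^{ -1}(\{1,2\})$ be the set of vertices receiving colours $1$ or $2$. Let $\mathcal{F}$ be the family of all graphs $H[S_c]$ (the subgraph of $H$ induced by $S_c$) over all such colourings $c$. Then $\mathrm{biex}(n,H)$ is defined to be $\mathrm{ex}(n,\mathcal{F})$, the maximum number of edges in an $n$-vertex graph containing no subgraph isomorphic to any member of $\mathcal{F}$. A graph is $r$-partite if its vertex set can be partitioned into $r$ independent sets. -}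

module Defs where

open import Data.Bool using (Bool; true; false)
open import Data.Nat as ℕ using (ℕ; zero; suc; _∸_)
open import Data.Fin using (Fin; toℕ)
open import Data.List using (List; length; filter; allFin; cartesianProduct)
open import Data.Product using (Σ; _×_; _,_; ∃; proj₁; proj₂)
open import Data.Integer using (+_)
open import Data.Rational using (ℚ; _/_; _-_; _+_; _*_; _<_; _≤_)
import Data.Rational as Q
open import Relation.Binary.PropositionalEquality using (_≡_; _≢_)
open import Relation.Nullary using (¬_)
import Relation.Nullary.Decidable as Dec
open import Data.Bool using (_≟_)
open import Data.Product.Properties using ()

record Graph (n : ℕ) : Set where
  field
    adj    : Fin n → Fin n → Bool
    sym    : ∀ u v → adj u v ≡ adj v u
    irrefl : ∀ v → adj v v ≡ false
open Graph public

edgeCount : ∀ {n} → Graph n → ℕ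
edgeCount {n} G =
  length (filter (λ p → Dec.T? (Data.Bool._∧_ (Dec.⌊ toℕ (proj₁ p) ℕ.<? toℕ (proj₂ p) ⌋) (adj G (proj₁ p) (proj₂ p))))
                 (cartesianProduct (allFin n) (allFin n)))

degree : ∀ {n} → Graph n → Fin n → ℕ
degree {n} G v = length (filter (λ u → Dec.T? (adj G v u)) (allFin n))

Contains : ∀ {h n} → Graph n → Graph h → Set
Contains {h} {n} G H =
  Σ (Fin h → Fin n) λ f →
    (∀ u v → f u ≡ f v → u ≡ v) ×
    (∀ u v → adj H u v ≡ true → adj G (f u) (f v) ≡ true)

ContainsInduced : ∀ {h n} → Graph n → Graph h → (Fin h → Bool) → Set
ContainsInduced {h} {n} G H S =
  Σ (Fin h → Fin n) λ f →
    (∀ u v → S u ≡ true → S v ≡ true → f u ≡ f v → u ≡ v) ×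
    (∀ u v → S u ≡ true → S v ≡ true → adj H u v ≡ true → adj G (f u) (f v) ≡ true)

ProperColouring : ∀ {h} → Graph h → (k : ℕ) → (Fin h → Fin k) → Set
ProperColouring H k c = ∀ u v → adj H u v ≡ true → c u ≢ c v

ChromaticNumber : ∀ {h} → Graph h → ℕ → Set
ChromaticNumber H k =
  (Σ _ λ c → ProperColouring H k c) ×
  (∀ m (c : _) → ProperColouring H m c → k ℕ.≤ m)

inFirstTwo : ∀ {h k} → (Fin h → Fin k) → Fin h → Bool
inFirstTwo c u = Dec.⌊ toℕ (c u) ℕ.<? 2 ⌋

-- G contains some member of the family F = { H[S_c] : c proper colouring with k = χ(H) colours }
ContainsFamily : ∀ {h n} → Graph n → Graph h → ℕ → Set
ContainsFamily G H k =
  Σ _ λ c → ProperColouring H k c × ContainsInduced G H (inFirstTwo c)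

IsBiex : ∀ {h} → (n : ℕ) → Graph h → (k : ℕ) → ℕ → Set
IsBiex n H k b =
  (Σ (Graph n) λ G → ¬ ContainsFamily G H k × edgeCount G ≡ b) ×
  (∀ (G : Graph n) → ¬ ContainsFamily G H k → edgeCount G ℕ.≤ b)

SpanningSub : ∀ {n} → Graph n → Graph n → Set
SpanningSub G' G = ∀ u v → adj G' u v ≡ true → adj G u v ≡ true

Partite : ∀ {n} → ℕ → Graph n → Set
Partite {n} r G = Σ (Fin n → Fin r) λ p → ∀ u v → adj G u v ≡ true → p u ≢ p v

-- the coefficient 3/(3r-1), for r ≥ 1 (written r = suc s, 3r-1 = suc (suc (3s)))
threeOver : ℕ → ℚ
threeOver zero    = Q.0ℚ   -- unused (r ≥ 1 in the theorem)
threeOver (suc s) = (+ 3) / suc (suc (3 ℕ.* s))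

MinDegreeAbove : ∀ {n} → Graph n → ℕ → ℚ → Set
MinDegreeAbove {n} G r ε =
  ∀ v → ((Q.1ℚ - threeOver r) + ε) * ((+ n) / 1) < (+ degree G v) / 1

{-# OPTIONS --safe #-}
module Submission where

-- Write r = s + 1 and D = 3r - 1 = 3s + 2. Call a pair of vertices rich if a fixed positive proportion (depending on r only)
-- of the s-tuples are cliques in its joint neighbourhood.
--
-- By supersaturation a positive proportion of the rich edges lies in the joint neighbourhood of one blow-up of K_s, and these
-- edges contain no member of the family, since otherwise G would contain H. Hence there are O(biex(n,H)) rich edges. Similarly
-- only boundedly many vertices are heavy, i.e. incident with linearly many rich edges.
--
-- By an exchange argument every K_{r+1} contains a rich edge. So deleting the rich edges and the heavy vertices leaves a
-- K_{r+1}-free graph, whose minimum degree still exceeds (1 - 3/D)n, and the Andrásfai–Erdős–Sós theorem (via Brandt's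
-- weighting argument) makes it r-partite. Put each heavy vertex into the part where it misses most vertices. A greedy count
-- then shows that an edge inside a part is rich unless both its ends are heavy with respect to a linear bound not depending on
-- ε. The number of such ends is bounded in terms of H alone, and if there is one then there is a rich edge; so these
-- exceptional edges are also O(biex(n,H)).

-- The obstacle is that `C` must not depend on ε, while the bound on the number of heavy vertices
-- does. So edges among heavy vertices cannot simply be counted, and richness itself is defined
-- without ε. This is possible because the exchange argument only needs every vertex to miss at most
-- 3n / D vertices; ε is spent on the deletion and on the rich edges at light vertices. What makes
-- the greedy count succeed at this threshold is a trade-off. A part has at most 3n / D light
-- vertices, because a light vertex is nonadjacent to nearly all of its own part. The amounts by
-- which the parts fall short of 3n / D, scaled by D and called `slack`, add up to at most 9n / 8. A
-- light vertex can miss vertices of another part only as far as its own part falls short, so each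
-- shortfall is paid for once, and n / 4D choices are left at every step.

open import Defs renaming (sym to adj-sym; irrefl to adj-irrefl)
open import Data.Bool using (Bool; true; false; _∧_; _∨_; not; if_then_else_)
import Data.Bool.Properties as Bool
open import Data.Empty using (⊥)
open import Data.Fin using (Fin; toℕ; punchIn; inject≤) renaming (zero to fzero; suc to fsuc)
open import Data.Fin.Properties using (all?; any?; punchInᵢ≢i; punchIn-injective; inject≤-injective; toℕ<n; toℕ-injective) renaming (_≟_ to _≟ᶠ_)
import Data.Integer as ℤ
import Data.Integer.Properties as ℤ
import Data.Integer.Tactic.RingSolver as ℤ
open import Data.List using (List; []; _∷_; _++_; length; lookup; map; concatMap; filterᵇ; allFin; cartesianProduct)
open import Data.List.Membership.Propositional using (_∈_)
open import Data.List.Membership.Propositional.Properties using (∈-allFin; ∈-lookup; ∈-cartesianProduct⁺)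
open import Data.List.Properties using (length-tabulate; map-tabulate; length-map; length-++)
open import Data.List.Relation.Binary.Sublist.Propositional using ([]; _∷_; _∷ʳ_) renaming (_⊆_ to _⊑_; ⊆-refl to ⊑-refl)
import Data.List.Relation.Binary.Sublist.Propositional.Properties as Sublist
open import Data.List.Relation.Unary.All using (All; []; _∷_)
import Data.List.Relation.Unary.All as All
import Data.List.Relation.Unary.All.Properties as All
open import Data.List.Relation.Unary.AllPairs using (AllPairs; []; _∷_)
import Data.List.Relation.Unary.AllPairs.Properties as AllPairs
open import Data.List.Relation.Unary.Any using (here; there; index)
open import Data.List.Relation.Unary.Any.Properties using (lookup-index)
open import Data.Maybe using (Maybe; just; nothing)
open import Data.Nat using (ℕ; zero; suc; pred; _+_; _*_; _^_; _∸_; _≤_; _<_; z≤n; s≤s; >-nonZero; _≤?_; _<?_)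
open import Data.Nat.Properties
open import Data.Nat.Tactic.RingSolver using (solve-∀)
open import Data.Product using (Σ; _×_; _,_; ∃; proj₁; proj₂; uncurry)
import Data.Rational as ℚ
open import Data.Rational using (ℚ; 0ℚ; _/_)
import Data.Rational.Properties as ℚ
import Data.Rational.Unnormalised as ℚᵘ
import Data.Rational.Unnormalised.Properties as ℚᵘ
open import Data.Sum using (_⊎_; inj₁; inj₂; [_,_]′)
open import Function using (_∘_; id)
open import Relation.Binary.Definitions using (Tri; tri<; tri≈; tri>)
open import Relation.Binary.PropositionalEquality using (_≡_; _≢_; refl; sym; trans; cong; cong₂; subst; subst₂; module ≡-Reasoning)
open import Relation.Nullary using (¬_; Dec; yes; no; contradiction)
open import Relation.Nullary.Decidable using (⌊_⌋; _×-dec_)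

-- Inequalities and indicator functions

-- A linear inequality a ≤ b is certified by one p ≤ q, obtained by adding up hypotheses, with b − a = q − p.
certify : ∀ {a b p q} → p ≤ q → a + q ≡ b + p → a ≤ b
certify {a} {b} {p} {q} p≤q eq =
  +-cancelʳ-≤ q a b (≤-trans (≤-reflexive eq) (+-monoʳ-≤ b p≤q))

infixr 4 _⊕_
_⊕_ : ∀ {a b c d} → a ≤ b → c ≤ d → a + c ≤ b + d
_⊕_ = +-mono-≤

1≤m^n : ∀ m n → 1 ≤ m → 1 ≤ m ^ n
1≤m^n m zero    _   = ≤-refl
1≤m^n m (suc n) 1≤m = *-mono-≤ 1≤m (1≤m^n m n 1≤m)

𝟙 : Bool → ℕ
𝟙 true  = 1
𝟙 false = 0

𝟙≤1 : ∀ b → 𝟙 b ≤ 1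
𝟙≤1 true  = ≤-refl
𝟙≤1 false = z≤n

𝟙-not : ∀ b → 𝟙 b + 𝟙 (not b) ≡ 1
𝟙-not true  = refl
𝟙-not false = refl

𝟙-∧ : ∀ a b → 𝟙 (a ∧ b) ≡ 𝟙 a * 𝟙 b
𝟙-∧ true  b = sym (+-identityʳ (𝟙 b))
𝟙-∧ false b = refl

𝟙-mono : ∀ {a b} → (a ≡ true → b ≡ true) → 𝟙 a ≤ 𝟙 b
𝟙-mono {false}         _   = z≤n
𝟙-mono {true} {true}  _   = ≤-refl
𝟙-mono {true} {false} imp = contradiction (imp refl) λ ()

𝟙-pos : ∀ {a} → 1 ≤ 𝟙 a → a ≡ true
𝟙-pos {true} _ = refl

𝟙-true : ∀ {a} → a ≡ true → 1 ≤ 𝟙 a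
𝟙-true refl = ≤-refl

𝟙-false : ∀ {a} → a ≡ false → 𝟙 a ≡ 0
𝟙-false refl = refl

∧-elim : ∀ {a b} → a ∧ b ≡ true → a ≡ true × b ≡ true
∧-elim {true} {true} _ = refl , refl

∧-intro : ∀ {a b} → a ≡ true → b ≡ true → a ∧ b ≡ true
∧-intro refl refl = refl

not-elim : ∀ {a} → not a ≡ true → a ≡ false
not-elim {false} _ = refl

not-intro : ∀ {a} → a ≡ false → not a ≡ true
not-intro refl = refl

true≢false : ∀ {ℓ} {X : Set ℓ} {a} → a ≡ true → a ≡ false → X
true≢false refl ()

¬true⇒false : ∀ {a} → ¬ a ≡ true → a ≡ false
¬true⇒false {true}  ¬a = contradiction refl ¬a
¬true⇒false {false} _  = refl

¬false⇒true : ∀ {a} → ¬ a ≡ false → a ≡ true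
¬false⇒true {true}  _  = refl
¬false⇒true {false} ¬a = contradiction refl ¬a

bool-cases : ∀ a → a ≡ true ⊎ a ≡ false
bool-cases true  = inj₁ refl
bool-cases false = inj₂ refl

witness : ∀ {P : Set} (d : Dec P) → ⌊ d ⌋ ≡ true → P
witness (yes p) _ = p

decide : ∀ {P : Set} (d : Dec P) → P → ⌊ d ⌋ ≡ true
decide (yes _) _ = refl
decide (no ¬p) p = contradiction p ¬p

refute : ∀ {P : Set} (d : Dec P) → ⌊ d ⌋ ≡ false → ¬ P
refute (no ¬p) _ = ¬p

-- Sums over lists

∑ : {A : Set} → (A → ℕ) → List A → ℕ
∑ f []       = 0
∑ f (x ∷ xs) = f x + ∑ f xs

module _ {A : Set} where

  ∑-mono-∈ : ∀ {f g : A → ℕ} xs → (∀ {x} → x ∈ xs → f x ≤ g x) → ∑ f xs ≤ ∑ g xs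
  ∑-mono-∈ []       _   = z≤n
  ∑-mono-∈ (x ∷ xs) f≤g = +-mono-≤ (f≤g (here refl)) (∑-mono-∈ xs (f≤g ∘ there))

  ∑-mono : ∀ {f g : A → ℕ} xs → (∀ x → f x ≤ g x) → ∑ f xs ≤ ∑ g xs
  ∑-mono xs f≤g = ∑-mono-∈ xs (λ {x} _ → f≤g x)

  ∑-cong : ∀ {f g : A → ℕ} xs → (∀ x → f x ≡ g x) → ∑ f xs ≡ ∑ g xs
  ∑-cong []       _   = refl
  ∑-cong (x ∷ xs) f≡g = cong₂ _+_ (f≡g x) (∑-cong xs f≡g)

  ∑-+ : ∀ (f g : A → ℕ) xs → ∑ (λ x → f x + g x) xs ≡ ∑ f xs + ∑ g xs
  ∑-+ f g []       = refl
  ∑-+ f g (x ∷ xs) = trans (cong (f x + g x +_) (∑-+ f g xs)) (interchange (f x) (g x) (∑ f xs) (∑ g xs))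
    where
    interchange : ∀ a b c d → a + b + (c + d) ≡ a + c + (b + d)
    interchange = solve-∀

  ∑-*ˡ : ∀ c (f : A → ℕ) xs → ∑ (λ x → c * f x) xs ≡ c * ∑ f xs
  ∑-*ˡ c f []       = sym (*-zeroʳ c)
  ∑-*ˡ c f (x ∷ xs) = trans (cong (c * f x +_) (∑-*ˡ c f xs)) (sym (*-distribˡ-+ c (f x) (∑ f xs)))

  ∑-*ʳ : ∀ (f : A → ℕ) c xs → ∑ (λ x → f x * c) xs ≡ ∑ f xs * c
  ∑-*ʳ f c xs = trans (∑-cong xs (λ x → *-comm (f x) c)) (trans (∑-*ˡ c f xs) (*-comm c (∑ f xs)))

  ∑-const : ∀ c (xs : List A) → ∑ (λ _ → c) xs ≡ length xs * c
  ∑-const c []       = refl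
  ∑-const c (x ∷ xs) = cong (c +_) (∑-const c xs)

  ∑-bound : ∀ {f : A → ℕ} {c} xs → (∀ x → f x ≤ c) → ∑ f xs ≤ length xs * c
  ∑-bound {c = c} xs f≤c = ≤-trans (∑-mono xs f≤c) (≤-reflexive (∑-const c xs))

  ∑-++ : ∀ (f : A → ℕ) xs ys → ∑ f (xs ++ ys) ≡ ∑ f xs + ∑ f ys
  ∑-++ f []       ys = refl
  ∑-++ f (x ∷ xs) ys = trans (cong (f x +_) (∑-++ f xs ys)) (sym (+-assoc (f x) _ _))

  ∑-filter : ∀ (f : A → ℕ) P xs → ∑ f (filterᵇ P xs) ≡ ∑ (λ x → 𝟙 (P x) * f x) xs
  ∑-filter f P []       = refl
  ∑-filter f P (x ∷ xs) with P x
  ... | true  = cong₂ _+_ (sym (+-identityʳ (f x))) (∑-filter f P xs)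
  ... | false = ∑-filter f P xs

  length-filter : ∀ P (xs : List A) → length (filterᵇ P xs) ≡ ∑ (𝟙 ∘ P) xs
  length-filter P []       = refl
  length-filter P (x ∷ xs) with P x
  ... | true  = cong suc (length-filter P xs)
  ... | false = length-filter P xs

  ∈-filter⁻ : ∀ P xs {x : A} → x ∈ filterᵇ P xs → P x ≡ true × x ∈ xs
  ∈-filter⁻ P (y ∷ ys) x∈ with P y in eq
  ∈-filter⁻ P (y ∷ ys) (here refl) | true  = eq , here refl
  ∈-filter⁻ P (y ∷ ys) (there x∈)  | true  = proj₁ (∈-filter⁻ P ys x∈) , there (proj₂ (∈-filter⁻ P ys x∈))
  ∈-filter⁻ P (y ∷ ys) x∈          | false = proj₁ (∈-filter⁻ P ys x∈) , there (proj₂ (∈-filter⁻ P ys x∈))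

  f≤∑ : ∀ (f : A → ℕ) {xs x} → x ∈ xs → f x ≤ ∑ f xs
  f≤∑ f (here refl) = m≤m+n _ _
  f≤∑ f (there x∈)  = ≤-trans (f≤∑ f x∈) (m≤n+m _ _)

  ∑-pos : ∀ (f : A → ℕ) xs → 1 ≤ ∑ f xs → ∃ λ x → x ∈ xs × 1 ≤ f x
  ∑-pos f (x ∷ xs) 1≤∑ with f x in eq
  ... | suc _ = x , here refl , ≤-trans (s≤s z≤n) (≤-reflexive (sym eq))
  ... | zero  with ∑-pos f xs 1≤∑
  ...   | y , y∈ , 1≤fy = y , there y∈ , 1≤fy

  average : ∀ (f : A → ℕ) xs → 1 ≤ length xs → ∃ λ x → x ∈ xs × ∑ f xs ≤ length xs * f x
  average f (x ∷ [])     _ = x , here refl , ≤-refl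
  average f (x ∷ y ∷ ys) _ with average f (y ∷ ys) (s≤s z≤n)
  ... | z , z∈ , ∑≤ with ≤-total (f x) (f z)
  ...   | inj₁ fx≤fz = z , there z∈ , +-mono-≤ fx≤fz ∑≤
  ...   | inj₂ fz≤fx = x , here refl , +-monoʳ-≤ (f x) (≤-trans ∑≤ (*-monoʳ-≤ (length (y ∷ ys)) fz≤fx))

  -- A reverse Markov inequality: the elements with `f x` below c / 2B contribute at most half of
  -- the guaranteed total, so the others, contributing at most c each, make up a proportion of at
  -- least 1 / 2B.
  markov : ∀ (f : A → ℕ) xs c B → 1 ≤ c → (∀ x → f x ≤ c) → length xs * c ≤ B * ∑ f xs →
           length xs ≤ 2 * B * ∑ (λ x → 𝟙 ⌊ c ≤? 2 * B * f x ⌋) xs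
  markov f xs c@(suc _) B _ f≤c dense =
    *-cancelʳ-≤ (length xs) _ c (certify (dense ⊕ dense ⊕ total) (arith (length xs * c) (B * ∑ f xs) (2 * B * ∑ good xs * c)))
    where
    good : A → ℕ
    good x = 𝟙 ⌊ c ≤? 2 * B * f x ⌋
    pointwise : ∀ x → 2 * B * f x ≤ 2 * B * c * good x + c
    pointwise x with c ≤? 2 * B * f x
    ... | yes _ = ≤-trans (*-monoʳ-≤ (2 * B) (f≤c x)) (≤-trans (≤-reflexive (sym (*-identityʳ (2 * B * c)))) (m≤m+n _ c))
    ... | no ≰c = ≤-trans (<⇒≤ (≰⇒> ≰c)) (m≤n+m c _)
    total : B * ∑ f xs + B * ∑ f xs ≤ 2 * B * ∑ good xs * c + length xs * c
    total = begin
      B * ∑ f xs + B * ∑ f xs                        ≡⟨ double B (∑ f xs) ⟩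
      2 * B * ∑ f xs                                 ≡⟨ sym (∑-*ˡ (2 * B) f xs) ⟩
      ∑ (λ x → 2 * B * f x) xs                       ≤⟨ ∑-mono xs pointwise ⟩
      ∑ (λ x → 2 * B * c * good x + c) xs            ≡⟨ ∑-+ _ _ xs ⟩
      ∑ (λ x → 2 * B * c * good x) xs + ∑ (λ _ → c) xs ≡⟨ cong₂ _+_ (∑-*ˡ (2 * B * c) good xs) (∑-const c xs) ⟩
      2 * B * c * ∑ good xs + length xs * c          ≡⟨ cong (_+ length xs * c) (swap (2 * B) c (∑ good xs)) ⟩
      2 * B * ∑ good xs * c + length xs * c          ∎
      where
      open ≤-Reasoning
      double : ∀ b s → b * s + b * s ≡ 2 * b * s
      double = solve-∀
      swap : ∀ a b d → a * b * d ≡ a * d * b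
      swap = solve-∀
    arith : ∀ l s g → l + (s + (s + (g + l))) ≡ g + (l + (l + (s + s)))
    arith = solve-∀

∑-map : ∀ {A B : Set} (f : B → ℕ) (g : A → B) xs → ∑ f (map g xs) ≡ ∑ (f ∘ g) xs
∑-map f g []       = refl
∑-map f g (x ∷ xs) = cong (f (g x) +_) (∑-map f g xs)

∑-concatMap : ∀ {A B : Set} (f : B → ℕ) (g : A → List B) xs → ∑ f (concatMap g xs) ≡ ∑ (λ x → ∑ f (g x)) xs
∑-concatMap f g []       = refl
∑-concatMap f g (x ∷ xs) = trans (∑-++ f (g x) (concatMap g xs)) (cong (∑ f (g x) +_) (∑-concatMap f g xs))

∑-swap : ∀ {A B : Set} (f : A → B → ℕ) xs ys → ∑ (λ x → ∑ (f x) ys) xs ≡ ∑ (λ y → ∑ (λ x → f x y) xs) ys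
∑-swap f []       ys = sym (trans (∑-const 0 ys) (*-zeroʳ (length ys)))
∑-swap f (x ∷ xs) ys = trans (cong (∑ (f x) ys +_) (∑-swap f xs ys)) (sym (∑-+ (f x) _ ys))

length≡∑ : ∀ {A : Set} (xs : List A) → length xs ≡ ∑ (λ _ → 1) xs
length≡∑ xs = sym (trans (∑-const 1 xs) (*-identityʳ (length xs)))

∑-product : ∀ {A B : Set} (f : A × B → ℕ) xs ys → ∑ f (cartesianProduct xs ys) ≡ ∑ (λ x → ∑ (λ y → f (x , y)) ys) xs
∑-product f []       ys = refl
∑-product f (x ∷ xs) ys = trans (∑-++ f (map (x ,_) ys) _) (cong₂ _+_ (∑-map f (x ,_) ys) (∑-product f xs ys))

length-allFin : ∀ n → length (allFin n) ≡ n
length-allFin n = length-tabulate id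

∑-punchIn : ∀ {n} (f : Fin (suc n) → ℕ) i → ∑ f (allFin (suc n)) ≡ f i + ∑ (f ∘ punchIn i) (allFin n)
∑-punchIn {n} f fzero = cong (f fzero +_) (trans (cong (∑ f) (sym (map-tabulate id fsuc))) (∑-map f fsuc (allFin n)))
∑-punchIn {suc n} f (fsuc i) = begin
  ∑ f (allFin (suc (suc n)))                                      ≡⟨ ∑-punchIn f fzero ⟩
  f fzero + ∑ (f ∘ fsuc) (allFin (suc n))                         ≡⟨ cong (f fzero +_) (∑-punchIn (f ∘ fsuc) i) ⟩
  f fzero + (f (fsuc i) + ∑ (f ∘ fsuc ∘ punchIn i) (allFin n))    ≡⟨ exchange (f fzero) (f (fsuc i)) _ ⟩
  f (fsuc i) + (f fzero + ∑ (f ∘ fsuc ∘ punchIn i) (allFin n))    ≡⟨ cong (f (fsuc i) +_) (sym (∑-punchIn (f ∘ punchIn (fsuc i)) fzero)) ⟩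
  f (fsuc i) + ∑ (f ∘ punchIn (fsuc i)) (allFin (suc n))          ∎
  where
  open ≡-Reasoning
  exchange : ∀ a b c → a + (b + c) ≡ b + (a + c)
  exchange = solve-∀

∑-≟ : ∀ {n} (i : Fin n) → ∑ (λ j → 𝟙 ⌊ i ≟ᶠ j ⌋) (allFin n) ≡ 1
∑-≟ {suc n} i = trans (∑-punchIn _ i) (cong₂ _+_ (cong 𝟙 (decide (i ≟ᶠ i) refl)) others)
  where
  others : ∑ (λ j → 𝟙 ⌊ i ≟ᶠ punchIn i j ⌋) (allFin n) ≡ 0
  others = trans (∑-cong (allFin n) (λ j → 𝟙-false (¬true⇒false λ eq → punchInᵢ≢i i j (sym (witness (i ≟ᶠ punchIn i j) eq)))))
                 (trans (∑-const 0 (allFin n)) (*-zeroʳ (length (allFin n))))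

-- Cliques and missed vertices

VSet : ℕ → Set
VSet n = Fin n → Bool

infixr 6 _∩_
_∩_ : ∀ {n} → VSet n → VSet n → VSet n
(A ∩ B) x = A x ∧ B x

_⊆_ : ∀ {n} → VSet n → VSet n → Set
A ⊆ B = ∀ x → A x ≡ true → B x ≡ true

#_ : ∀ {n} → VSet n → ℕ
#_ {n} A = ∑ (𝟙 ∘ A) (allFin n)

-- The vertex `v` itself is counted, so degree and `miss` add up to exactly n.
miss : ∀ {n} → Graph n → Fin n → ℕ
miss G v = # (λ x → not (adj G v x))

-- Taken over a list rather than a set, so that repeating a vertex gives it weight; both weighting
-- arguments rely on this.
missed : ∀ {n} → Graph n → Fin n → List (Fin n) → ℕ
missed G x = ∑ (λ y → 𝟙 (not (adj G x y)))

-- Ordered cliques are counted, so `n ^ k` is the natural normalisation. Fixing the first vertex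
-- cuts `A` down to its neighbourhood, which is the shape of the inductions on k below.
cliques : ∀ {n} → Graph n → ℕ → VSet n → ℕ
cliques G zero    A = 1
cliques {n} G (suc k) A = ∑ (λ x → 𝟙 (A x) * cliques G k (A ∩ adj G x)) (allFin n)

Clique : ∀ {n} → Graph n → List (Fin n) → Set
Clique G = AllPairs (λ u v → adj G u v ≡ true)

CliqueFree : ∀ {n} → Graph n → ℕ → Set
CliqueFree G k = ∀ xs → Clique G xs → length xs ≢ k

#-mono : ∀ {n} {A B : VSet n} → A ⊆ B → # A ≤ # B
#-mono {n} A⊆B = ∑-mono (allFin n) (λ x → 𝟙-mono (A⊆B x))

#-≤n : ∀ {n} (A : VSet n) → # A ≤ n
#-≤n {n} A = ≤-trans (∑-bound (allFin n) (𝟙≤1 ∘ A)) (≤-reflexive (trans (*-identityʳ _) (length-allFin n)))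

#-∅ : ∀ {n} {A : VSet n} → (∀ x → A x ≡ false) → # A ≡ 0
#-∅ {n} A≡∅ = trans (∑-cong (allFin n) (𝟙-false ∘ A≡∅)) (trans (∑-const 0 (allFin n)) (*-zeroʳ (length (allFin n))))

#-not : ∀ {n} (A : VSet n) → # A + # (not ∘ A) ≡ n
#-not {n} A = trans (sym (∑-+ _ _ (allFin n))) (trans (∑-cong (allFin n) (𝟙-not ∘ A)) (trans (sym (length≡∑ (allFin n))) (length-allFin n)))

module _ {n} (G : Graph n) where

  adj-sym′ : ∀ {u v} → adj G u v ≡ true → adj G v u ≡ true
  adj-sym′ {u} {v} uv = trans (adj-sym G v u) uv

  adj⇒≢ : ∀ {u v} → adj G u v ≡ true → u ≢ v
  adj⇒≢ {u} uv refl = true≢false uv (irrefl′ u)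
    where irrefl′ = adj-irrefl G

  cliques-mono : ∀ k {A B} → A ⊆ B → cliques G k A ≤ cliques G k B
  cliques-mono zero    A⊆B = ≤-refl
  cliques-mono (suc k) A⊆B = ∑-mono (allFin n) λ x →
    *-mono-≤ (𝟙-mono (A⊆B x)) (cliques-mono k λ y Ay → ∧-intro (A⊆B y (proj₁ (∧-elim Ay))) (proj₂ (∧-elim Ay)))

  cliques-bound : ∀ k A → cliques G k A ≤ n ^ k
  cliques-bound zero    A = ≤-refl
  cliques-bound (suc k) A = ≤-trans
    (∑-bound (allFin n) λ x → ≤-trans (*-mono-≤ (𝟙≤1 (A x)) (cliques-bound k (A ∩ adj G x))) (≤-reflexive (*-identityˡ (n ^ k))))
    (≤-reflexive (cong (_* n ^ k) (length-allFin n)))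

  cliques-pos⁺ : ∀ {A} xs → All (λ x → A x ≡ true) xs → Clique G xs → 1 ≤ cliques G (length xs) A
  cliques-pos⁺ []       _         _              = ≤-refl
  cliques-pos⁺ (x ∷ xs) (Ax ∷ As) (x~xs ∷ xs-cl) = ≤-trans
    (*-mono-≤ (𝟙-true Ax) (cliques-pos⁺ xs (All.zipWith (uncurry ∧-intro) (As , x~xs)) xs-cl))
    (f≤∑ _ (∈-allFin x))

  cliques-pos⁻ : ∀ k {A} → 1 ≤ cliques G k A →
                 ∃ λ xs → length xs ≡ k × All (λ x → A x ≡ true) xs × Clique G xs
  cliques-pos⁻ zero    _   = [] , refl , [] , []
  cliques-pos⁻ (suc k) {A} 1≤cl with ∑-pos _ (allFin n) 1≤cl
  ... | x , _ , 1≤fx with A x in Ax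
  ...   | true with cliques-pos⁻ k {A ∩ adj G x} (≤-trans 1≤fx (≤-reflexive (+-identityʳ _)))
  ...     | xs , len , all , cl = x ∷ xs , cong suc len , Ax ∷ All.map (proj₁ ∘ ∧-elim) all , All.map (proj₂ ∘ ∧-elim) all ∷ cl

  ∑-missed : ∀ L → ∑ (λ x → missed G x L) (allFin n) ≡ ∑ (miss G) L
  ∑-missed L = trans (∑-swap _ (allFin n) L)
    (∑-cong L λ y → ∑-cong (allFin n) λ x → cong (𝟙 ∘ not) (adj-sym G x y))

  missed-bound : ∀ d e L → All (λ y → d * miss G y ≤ e) L → d * ∑ (λ x → missed G x L) (allFin n) ≤ length L * e
  missed-bound d e L bounds = ≤-trans (≤-reflexive (cong (d *_) (∑-missed L))) (go L bounds)
    where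
    go : ∀ L → All (λ y → d * miss G y ≤ e) L → d * ∑ (miss G) L ≤ length L * e
    go []      _        = ≤-reflexive (*-zeroʳ d)
    go (y ∷ L) (b ∷ bs) = ≤-trans (≤-reflexive (*-distribˡ-+ d (miss G y) _)) (+-mono-≤ b (go L bs))

  missed≡0⇒adj : ∀ x L → missed G x L ≡ 0 → All (λ y → adj G x y ≡ true) L
  missed≡0⇒adj x []      _  = []
  missed≡0⇒adj x (y ∷ L) eq with adj G x y in xy
  ... | true = xy ∷ missed≡0⇒adj x L eq

  -- Exactly one vertex is dropped even if x misses none, so the length always falls by one.
  missed≤1⇒adj-all-but-one : ∀ x y L → missed G x (y ∷ L) ≤ 1 →
    ∃ λ L′ → L′ ⊑ (y ∷ L) × length L′ ≡ length L × All (λ y → adj G x y ≡ true) L′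
  missed≤1⇒adj-all-but-one x y [] _ = [] , y ∷ʳ [] , refl , []
  missed≤1⇒adj-all-but-one x y (z ∷ L) m≤1 with adj G x y in xy
  ... | false = z ∷ L , y ∷ʳ ⊑-refl , refl , missed≡0⇒adj x (z ∷ L) (n≤0⇒n≡0 (≤-pred m≤1))
  ... | true with missed≤1⇒adj-all-but-one x z L m≤1
  ...   | L′ , L′⊑L , len , all = y ∷ L′ , refl ∷ L′⊑L , cong suc len , xy ∷ all

∑-⊑ : ∀ {A : Set} (f : A → ℕ) {xs ys} → xs ⊑ ys → ∑ f xs ≤ ∑ f ys
∑-⊑ f []            = z≤n
∑-⊑ f (y ∷ʳ xs⊑ys)  = ≤-trans (∑-⊑ f xs⊑ys) (m≤n+m _ (f y))
∑-⊑ f (refl ∷ xs⊑ys) = +-monoʳ-≤ _ (∑-⊑ f xs⊑ys)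

AllPairs-⊑ : ∀ {A : Set} {R : A → A → Set} {xs ys} → xs ⊑ ys → AllPairs R ys → AllPairs R xs
AllPairs-⊑ []             _           = []
AllPairs-⊑ (y ∷ʳ xs⊑ys)   (_ ∷ rest)  = AllPairs-⊑ xs⊑ys rest
AllPairs-⊑ (refl ∷ xs⊑ys) (ys ∷ rest) = Sublist.All-resp-⊆ xs⊑ys ys ∷ AllPairs-⊑ xs⊑ys rest

-- The Andrásfai–Erdős–Sós theorem

-- κ and l are the numbers of vertices missed in K and L; U, V, W say whether x is adjacent to u, v,
-- w. If κ = 0 but both u and v are missed, the budget of 2 is spent, so l = 0 and w is met;
-- similarly for l = 0. So outside the four clique cases K and L use up one unit each and nothing is
-- left for u, v, w.
missed-cases : ∀ κ l U V W → κ + (l + (𝟙 (not U) + (𝟙 (not V) + (𝟙 (not W) + 0)))) ≤ 2 →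
  (κ ≡ 0 × U ≡ true) ⊎ (κ ≡ 0 × V ≡ true) ⊎ (l ≡ 0 × U ≡ true) ⊎ (l ≡ 0 × W ≡ true) ⊎
  (κ ≤ 1 × l ≤ 1 × U ≡ true × V ≡ true × W ≡ true)
missed-cases zero    l       true  V     W     _ = inj₁ (refl , refl)
missed-cases zero    l       false true  W     _ = inj₂ (inj₁ (refl , refl))
missed-cases zero    zero    false false true  _ = inj₂ (inj₂ (inj₂ (inj₁ (refl , refl))))
missed-cases zero    zero    false false false (s≤s (s≤s ()))
missed-cases zero    (suc l) false false W     (s≤s le) = contradiction (≤-trans (m≤n+m _ l) le) (λ { (s≤s ()) })
missed-cases (suc κ) zero    true  V     W     _ = inj₂ (inj₂ (inj₁ (refl , refl)))
missed-cases (suc κ) zero    false V     true  _ = inj₂ (inj₂ (inj₂ (inj₁ (refl , refl))))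
missed-cases (suc κ) zero    false V     false (s≤s le) =
  contradiction (≤-trans (≤-trans (s≤s (m≤n+m 1 (𝟙 (not V)))) (m≤n+m _ κ)) le) (λ { (s≤s ()) })
missed-cases (suc zero) (suc zero) true true true _ = inj₂ (inj₂ (inj₂ (inj₂ (≤-refl , ≤-refl , refl , refl , refl))))
missed-cases (suc zero) (suc zero) true true false (s≤s (s≤s ()))
missed-cases (suc zero) (suc zero) true false W    (s≤s (s≤s ()))
missed-cases (suc zero) (suc zero) false V    W    (s≤s (s≤s ()))
missed-cases (suc zero) (suc (suc l)) U V W (s≤s (s≤s ()))
missed-cases (suc (suc κ)) (suc l) U V W (s≤s (s≤s le)) = contradiction (≤-trans (m≤n+m _ κ) le) (λ ())

missed-++ : ∀ {n} (G : Graph n) x xs {ys c d} → d ≤ missed G x xs → c ≤ missed G x ys → d + c ≤ missed G x (xs ++ ys)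
missed-++ G x xs {ys} d≤ c≤ = ≤-trans (+-mono-≤ d≤ c≤) (≤-reflexive (sym (∑-++ _ xs ys)))

-- Brandt's weighting argument: cliques I ∪ K ⊆ N(u) ∩ N(v) and I ∪ L ⊆ N(u) ∩ N(w) with v ~ w. Give weight 3 to I
-- and weight 1 to K, L, u, v, w. Some vertex x misses weight at most 2; either it completes a clique of size s + 2,
-- or it is adjacent to all but one vertex of K and of L and can be moved into I.
no-linked-wedge : ∀ {n} (G : Graph n) s → CliqueFree G (2 + s) →
  (∀ {x y} → adj G x y ≡ true → (2 + 3 * s) * miss G x < 3 * n) →
  ∀ m {u v w} I K L → adj G v w ≡ true → length I + m ≡ s → length K ≡ m → length L ≡ m →
  Clique G (u ∷ I ++ K) → Clique G (v ∷ I ++ K) → Clique G (u ∷ I ++ L) → Clique G (w ∷ I ++ L) → ⊥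
-- With `K` and `L` empty, `I` has s vertices and is joined to the adjacent pair v, w: a clique of
-- size s + 2.
no-linked-wedge G s free deg zero {v = v} {w} I [] [] vw |I| _ _ _ (vI ∷ I-cl) _ (wI ∷ _) =
  free (w ∷ v ∷ I ++ []) ((adj-sym′ G vw ∷ wI) ∷ vI ∷ I-cl)
    (cong (2 +_) (trans (length-++ I) |I|))
no-linked-wedge {n} G s free deg (suc m) {u} {v} {w} I K@(k₀ ∷ K₀) L@(l₀ ∷ L₀) vw |I| |K| |L|
  uK@(uIK ∷ _) vK uL@(uIL ∷ _) wL
  with any? (λ x → missed G x (I ++ I ++ I ++ K ++ L ++ u ∷ v ∷ w ∷ []) ≤? 2)
... | no ¬x = contradiction total (<⇒≱ (*-monoʳ-< D (≤-reflexive (suc-pred (3 * n) {{>-nonZero 0<3n}}))))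
  where
  D = 2 + 3 * s
  all = I ++ I ++ I ++ K ++ L ++ u ∷ v ∷ w ∷ []
  0<3n : 0 < 3 * n
  0<3n = ≤-trans (s≤s z≤n) (deg vw)
  -- Strictness is kept as `≤ pred (3 * n)`, so that the bounds can be added up and still contradict
  -- an average missed weight of 3.
  bound : ∀ {x y} → adj G x y ≡ true → D * miss G x ≤ pred (3 * n)
  bound xy = ≤-pred (≤-trans (deg xy) (≤-reflexive (sym (suc-pred (3 * n) {{>-nonZero 0<3n}}))))
  near-u : ∀ {xs} → All (λ y → adj G u y ≡ true) xs → All (λ y → D * miss G y ≤ pred (3 * n)) xs
  near-u = All.map (λ uy → bound (adj-sym′ G uy))
  uk₀ : adj G u k₀ ≡ true
  uk₀ with All.++⁻ʳ I uIK
  ... | uk ∷ _ = uk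
  -- The total weight is 3 |I| + 2 (m + 1) + 3, which is D - m because |I| + m + 1 = s.
  |all| : length all ≤ D
  |all| = certify (z≤n {m}) (trans (cong (_+ m) |all|≡) (trans (arith (length I) m) (cong (λ j → 2 + 3 * j + 0) |I|)))
    where
    |all|≡ : length all ≡ length I + (length I + (length I + (suc m + (suc m + 3))))
    |all|≡ = trans (length-++ I) (cong (length I +_) (trans (length-++ I) (cong (length I +_) (trans (length-++ I)
      (cong (length I +_) (trans (length-++ K) (cong₂ _+_ |K| (trans (length-++ L) (cong (_+ 3) |L|)))))))))
    arith : ∀ i m → i + (i + (i + (suc m + (suc m + 3)))) + m ≡ 2 + 3 * (i + suc m) + 0
    arith = solve-∀
  bounds : All (λ y → D * miss G y ≤ pred (3 * n)) all
  bounds = All.++⁺ I-b (All.++⁺ I-b (All.++⁺ I-b (All.++⁺ (near-u (All.++⁻ʳ I uIK))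
    (All.++⁺ (near-u (All.++⁻ʳ I uIL)) (bound uk₀ ∷ bound vw ∷ bound (adj-sym′ G vw) ∷ [])))))
    where I-b = near-u (All.++⁻ˡ I uIK)
  total : D * (3 * n) ≤ D * pred (3 * n)
  total = begin
    D * (3 * n)                                 ≡⟨ cong (D *_) (trans (*-comm 3 n) (cong (_* 3) (sym (length-allFin n)))) ⟩
    D * (length (allFin n) * 3)                 ≡⟨ cong (D *_) (sym (∑-const 3 (allFin n))) ⟩
    D * ∑ (λ _ → 3) (allFin n)                  ≤⟨ *-monoʳ-≤ D (∑-mono (allFin n) (λ x → ≰⇒> (λ le → ¬x (x , le)))) ⟩
    D * ∑ (λ x → missed G x all) (allFin n)     ≤⟨ missed-bound G D (pred (3 * n)) all bounds ⟩
    length all * pred (3 * n)                   ≤⟨ *-monoˡ-≤ (pred (3 * n)) |all| ⟩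
    D * pred (3 * n)                            ∎
    where open ≤-Reasoning
... | yes (x , le) with missed G x I in mI
... | suc a = contradiction (≤-trans weight le) (λ { (s≤s (s≤s ())) })
  where
  1≤mI : 1 ≤ missed G x I
  1≤mI = ≤-trans (s≤s z≤n) (≤-reflexive (sym mI))
  weight : 3 ≤ missed G x (I ++ I ++ I ++ K ++ L ++ u ∷ v ∷ w ∷ [])
  weight = missed-++ G x I 1≤mI (missed-++ G x I 1≤mI (missed-++ G x I {c = 0} 1≤mI z≤n))
... | zero = finish (missed-cases (missed G x K) (missed G x L) (adj G x u) (adj G x v) (adj G x w) le′)
  where
  le′ : missed G x K + (missed G x L + (𝟙 (not (adj G x u)) + (𝟙 (not (adj G x v)) + (𝟙 (not (adj G x w)) + 0)))) ≤ 2
  le′ = ≤-trans (≤-trans (≤-reflexive (sym (trans (∑-++ f K _) (cong (missed G x K +_) (∑-++ f L _)))))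
    (missed-++ G x I z≤n (missed-++ G x I z≤n (missed-++ G x I z≤n ≤-refl)))) le
    where f = λ y → 𝟙 (not (adj G x y))
  xI = missed≡0⇒adj G x I mI
  complete : ∀ {z M} → length M ≡ suc m → adj G x z ≡ true → missed G x M ≡ 0 → Clique G (z ∷ I ++ M) → ⊥
  complete {z} {M} |M| xz mM cl = free (x ∷ z ∷ I ++ M) ((xz ∷ All.++⁺ xI (missed≡0⇒adj G x M mM)) ∷ cl)
    (cong (2 +_) (trans (length-++ I) (trans (cong (length I +_) |M|) |I|)))
  move : ∀ {z M M′} → adj G x z ≡ true → All (λ y → adj G x y ≡ true) M′ → M′ ⊑ M → Clique G (z ∷ I ++ M) → Clique G (z ∷ x ∷ I ++ M′)
  move xz xM′ M′⊑M (zIM ∷ IM-cl) =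
    (adj-sym′ G xz ∷ Sublist.All-resp-⊆ ⊑IM zIM) ∷ All.++⁺ xI xM′ ∷ AllPairs-⊑ ⊑IM IM-cl
    where ⊑IM = Sublist.++⁺ (⊑-refl {x = I}) M′⊑M
  finish : _ → ⊥
  finish (inj₁ (mK , xu))                      = complete |K| xu mK uK
  finish (inj₂ (inj₁ (mK , xv)))               = complete |K| xv mK vK
  finish (inj₂ (inj₂ (inj₁ (mL , xu))))        = complete |L| xu mL uL
  finish (inj₂ (inj₂ (inj₂ (inj₁ (mL , xw))))) = complete |L| xw mL wL
  finish (inj₂ (inj₂ (inj₂ (inj₂ (mK , mL , xu , xv , xw)))))
    with missed≤1⇒adj-all-but-one G x k₀ K₀ mK | missed≤1⇒adj-all-but-one G x l₀ L₀ mL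
  ... | K′ , K′⊑K , |K′| , xK′ | L′ , L′⊑L , |L′| , xL′ =
    no-linked-wedge G s free deg m (x ∷ I) K′ L′ vw (trans (sym (+-suc (length I) m)) |I|)
      (trans |K′| (cong pred |K|)) (trans |L′| (cong pred |L|))
      (move xu xK′ K′⊑K uK) (move xv xK′ K′⊑K vK) (move xu xL′ L′⊑L uL) (move xw xL′ L′⊑L wL)

-- Cliques created by one new edge

module _ {n} (G : Graph n) {u v : Fin n} (u≢v : u ≢ v) where

  private
    new : Fin n → Fin n → Bool
    new x y = (⌊ u ≟ᶠ x ⌋ ∧ ⌊ v ≟ᶠ y ⌋) ∨ (⌊ v ≟ᶠ x ⌋ ∧ ⌊ u ≟ᶠ y ⌋)

    new-sym : ∀ x y → new x y ≡ new y x
    new-sym x y = trans (Bool.∨-comm (⌊ u ≟ᶠ x ⌋ ∧ ⌊ v ≟ᶠ y ⌋) _)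
      (cong₂ _∨_ (Bool.∧-comm ⌊ v ≟ᶠ x ⌋ _) (Bool.∧-comm ⌊ u ≟ᶠ x ⌋ _))

    both : ∀ {a b x y : Fin n} → ⌊ a ≟ᶠ x ⌋ ∧ ⌊ b ≟ᶠ y ⌋ ≡ true → x ≡ a × y ≡ b
    both {a} {b} {x} {y} eq with ∧-elim {⌊ a ≟ᶠ x ⌋} eq
    ... | ax , by = sym (witness (a ≟ᶠ x) ax) , sym (witness (b ≟ᶠ y) by)

    ∨-elim : ∀ {a b} → a ∨ b ≡ true → a ≡ true ⊎ b ≡ true
    ∨-elim {true}  _ = inj₁ refl
    ∨-elim {false} b = inj₂ b

    new-elim : ∀ {x y} → new x y ≡ true → (x ≡ u × y ≡ v) ⊎ (x ≡ v × y ≡ u)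
    new-elim {x} {y} eq = [ inj₁ ∘ both , inj₂ ∘ both ]′ (∨-elim {⌊ u ≟ᶠ x ⌋ ∧ ⌊ v ≟ᶠ y ⌋} eq)

    new-irrefl : ∀ x → new x x ≡ false
    new-irrefl x = ¬true⇒false λ eq → [ (λ (xu , xv) → u≢v (trans (sym xu) xv)) , (λ (xv , xu) → u≢v (trans (sym xu) xv)) ]′ (new-elim eq)

  addEdge : Graph n
  addEdge = record
    { adj    = λ x y → adj G x y ∨ new x y
    ; sym    = λ x y → cong₂ _∨_ (adj-sym G x y) (new-sym x y)
    ; irrefl = λ x → cong₂ _∨_ (adj-irrefl G x) (new-irrefl x)
    }

  addEdge-⊇ : SpanningSub G addEdge
  addEdge-⊇ x y xy = cong (_∨ new x y) xy

  addEdge-new : adj addEdge u v ≡ true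
  addEdge-new = trans (cong (λ b → adj G u v ∨ b ∨ (⌊ v ≟ᶠ u ⌋ ∧ ⌊ u ≟ᶠ v ⌋)) (∧-intro (decide (u ≟ᶠ u) refl) (decide (v ≟ᶠ v) refl)))
                      (Bool.∨-zeroʳ (adj G u v))

  addEdge-elim : ∀ {x y} → adj addEdge x y ≡ true → adj G x y ≡ true ⊎ (x ≡ u × y ≡ v) ⊎ (x ≡ v × y ≡ u)
  addEdge-elim {x} {y} eq with adj G x y
  ... | true  = inj₁ refl
  ... | false = inj₂ (new-elim eq)

  addEdge-old : ∀ {x y} → x ≢ u → x ≢ v → adj addEdge x y ≡ true → adj G x y ≡ true
  addEdge-old x≢u x≢v eq with addEdge-elim eq
  ... | inj₁ xy               = xy
  ... | inj₂ (inj₁ (x≡u , _)) = contradiction x≡u x≢u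
  ... | inj₂ (inj₂ (x≡v , _)) = contradiction x≡v x≢v

  -- `ys` is `xs` without u and v. That both lie in `xs` is recorded for the induction: any further
  -- vertex of the clique is then distinct from both, so its edges are old ones.
  CommonClique : List (Fin n) → List (Fin n) → Set
  CommonClique ys xs = ys ⊑ xs × u ∈ xs × v ∈ xs × length xs ≡ 2 + length ys ×
    All (λ y → adj G u y ≡ true × adj G v y ≡ true) ys × Clique G ys

  private
    remove : ∀ {z xs} → z ∈ xs → Clique G xs →
      ∃ λ ys → ys ⊑ xs × length xs ≡ suc (length ys) × All (λ y → adj G z y ≡ true) ys × Clique G ys
    remove {z} {z ∷ xs} (here refl) (zxs ∷ cl) = xs , z ∷ʳ ⊑-refl , refl , zxs , cl
    remove {z} {x ∷ xs} (there z∈)  (xxs ∷ cl) with remove z∈ cl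
    ... | ys , ys⊑ , len , zys , ys-cl =
      x ∷ ys , refl ∷ ys⊑ , cong suc len , adj-sym′ G (All.lookup xxs z∈) ∷ zys , Sublist.All-resp-⊆ ys⊑ xxs ∷ ys-cl

    find-new : ∀ x xs → All (λ y → adj addEdge x y ≡ true) xs →
      All (λ y → adj G x y ≡ true) xs ⊎ (x ≡ u × v ∈ xs) ⊎ (x ≡ v × u ∈ xs)
    find-new x []       _          = inj₁ []
    find-new x (y ∷ xs) (xy ∷ all) with addEdge-elim xy | find-new x xs all
    ... | inj₂ (inj₁ (x≡u , y≡v)) | _ = inj₂ (inj₁ (x≡u , here (sym y≡v)))
    ... | inj₂ (inj₂ (x≡v , y≡u)) | _ = inj₂ (inj₂ (x≡v , here (sym y≡u)))
    ... | inj₁ xy′ | inj₁ all′                = inj₁ (xy′ ∷ all′)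
    ... | inj₁ xy′ | inj₂ (inj₁ (x≡u , v∈))  = inj₂ (inj₁ (x≡u , there v∈))
    ... | inj₁ xy′ | inj₂ (inj₂ (x≡v , u∈))  = inj₂ (inj₂ (x≡v , there u∈))

  -- A clique using the new edge becomes, without the two ends, a clique in their old common
  -- neighbourhood. Hence joining two vertices that have no k-clique in common creates no clique of
  -- size k + 2.
  addEdge-clique : ∀ xs → Clique addEdge xs → Clique G xs ⊎ ∃ λ ys → CommonClique ys xs
  addEdge-clique [] _ = inj₁ []
  addEdge-clique (x ∷ xs) (x~ ∷ cl) with addEdge-clique xs cl
  ... | inj₂ (ys , ys⊑ , u∈ , v∈ , len , uvys , ys-cl) =
    inj₂ (x ∷ ys , refl ∷ ys⊑ , there u∈ , there v∈ , cong suc len ,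
          (adj-sym′ G (old (All.lookup x~ u∈)) , adj-sym′ G (old (All.lookup x~ v∈))) ∷ uvys ,
          All.map old (Sublist.All-resp-⊆ ys⊑ x~) ∷ ys-cl)
    where
    old : ∀ {y} → adj addEdge x y ≡ true → adj G x y ≡ true
    old = addEdge-old (adj⇒≢ addEdge (All.lookup x~ u∈)) (adj⇒≢ addEdge (All.lookup x~ v∈))
  ... | inj₁ xs-cl with find-new x xs x~
  ...   | inj₁ x~′ = inj₁ (x~′ ∷ xs-cl)
  ...   | inj₂ (inj₁ (refl , v∈)) with remove v∈ xs-cl
  ...     | ys , ys⊑ , len , vys , ys-cl =
    inj₂ (ys , u ∷ʳ ys⊑ , here refl , there v∈ , cong suc len ,
          All.zipWith (λ (uy , vy) → old uy vy , vy) (Sublist.All-resp-⊆ ys⊑ x~ , vys) , ys-cl)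
    where
    old : ∀ {y} → adj addEdge u y ≡ true → adj G v y ≡ true → adj G u y ≡ true
    old uy vy = adj-sym′ G (addEdge-old (adj⇒≢ addEdge (adj-sym′ addEdge uy)) (λ { refl → adj⇒≢ G vy refl }) (adj-sym′ addEdge uy))
  addEdge-clique (x ∷ xs) (x~ ∷ cl) | inj₁ xs-cl | inj₂ (inj₂ (refl , u∈)) with remove u∈ xs-cl
  ...     | ys , ys⊑ , len , uys , ys-cl =
    inj₂ (ys , v ∷ʳ ys⊑ , there u∈ , here refl , cong suc len ,
          All.zipWith (λ (vy , uy) → uy , old vy uy) (Sublist.All-resp-⊆ ys⊑ x~ , uys) , ys-cl)
    where
    old : ∀ {y} → adj addEdge v y ≡ true → adj G u y ≡ true → adj G v y ≡ true
    old vy uy = adj-sym′ G (addEdge-old (λ { refl → adj⇒≢ G uy refl }) (adj⇒≢ addEdge (adj-sym′ addEdge vy)) (adj-sym′ addEdge vy))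

Linked : ∀ {n} → Graph n → ℕ → Fin n → Fin n → Set
Linked G k u v = ∃ λ ys → length ys ≡ k × All (λ y → adj G u y ≡ true) ys × All (λ y → adj G v y ≡ true) ys × Clique G ys

linked? : ∀ {n} (G : Graph n) k u v → Linked G k u v ⊎ ¬ Linked G k u v
linked? G k u v with 1 ≤? cliques G k (adj G u ∩ adj G v)
... | yes 1≤ = let ys , len , all , cl = cliques-pos⁻ G k 1≤ in
  inj₁ (ys , len , All.map (proj₁ ∘ ∧-elim) all , All.map (λ {y} → proj₂ ∘ ∧-elim {adj G u y}) all , cl)
... | no ≰  = inj₂ λ { (ys , refl , us , vs , cl) → ≰ (cliques-pos⁺ G ys (All.zipWith (uncurry ∧-intro) (us , vs)) cl) }

Linked-mono : ∀ {n} (G G⁺ : Graph n) {k u v} → SpanningSub G G⁺ → Linked G k u v → Linked G⁺ k u v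
Linked-mono G G⁺ G⊆ (ys , len , us , vs , cl) = ys , len , All.map (G⊆ _ _) us , All.map (G⊆ _ _) vs , mono-cl cl
  where
  mono-cl : ∀ {xs} → Clique G xs → Clique G⁺ xs
  mono-cl []         = []
  mono-cl (xs ∷ xss) = All.map (G⊆ _ _) xs ∷ mono-cl xss

-- Edge-maximality takes the form of `linked`: a missing edge could not be added, because a k-clique
-- in the common neighbourhood blocks it. Everything is confined to `W`, so the deleted vertices
-- stay isolated and need no degree bound.
record Saturation {n} (G : Graph n) (k : ℕ) (W : VSet n) (ps : List (Fin n × Fin n)) : Set where
  field
    graph    : Graph n
    extends  : SpanningSub G graph
    inside   : ∀ {x y} → adj graph x y ≡ true → W x ≡ true
    free     : CliqueFree graph (2 + k)
    linked   : ∀ {u v} → (u , v) ∈ ps → W u ≡ true → W v ≡ true → u ≢ v → adj graph u v ≡ false → Linked graph k u v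

-- One pass over the pairs is enough, since a linked pair stays linked when further edges are added.
saturate : ∀ {n} (G : Graph n) k W → (∀ {x y} → adj G x y ≡ true → W x ≡ true) → CliqueFree G (2 + k) →
           ∀ ps → Saturation G k W ps
saturate G k W inside free [] = record
  { graph = G ; extends = λ _ _ → id ; inside = inside ; free = free ; linked = λ () }
saturate {n} G k W inside free ((u , v) ∷ ps) = go (saturate G k W inside free ps)
  where
  go : Saturation G k W ps → Saturation G k W ((u , v) ∷ ps)
  go sat with bool-cases (W u) | bool-cases (W v) | u ≟ᶠ v | linked? (Saturation.graph sat) k u v
  ... | inj₂ ¬Wu | _ | _ | _ = record { Saturation sat ; linked = λ { (here refl) Wu → true≢false Wu ¬Wu ; (there p∈) → Saturation.linked sat p∈ } }
  ... | _ | inj₂ ¬Wv | _ | _ = record { Saturation sat ; linked = λ { (here refl) _ Wv → true≢false Wv ¬Wv ; (there p∈) → Saturation.linked sat p∈ } }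
  ... | _ | _ | yes u≡v | _  = record { Saturation sat ; linked = λ { (here refl) _ _ u≢v → contradiction u≡v u≢v ; (there p∈) → Saturation.linked sat p∈ } }
  ... | _ | _ | _ | inj₁ uv  = record { Saturation sat ; linked = λ { (here refl) _ _ _ _ → uv ; (there p∈) → Saturation.linked sat p∈ } }
  ... | inj₁ Wu | inj₁ Wv | no u≢v | inj₂ ¬uv = record
    { graph   = addEdge graph u≢v
    ; extends = λ x y xy → addEdge-⊇ graph u≢v x y (extends x y xy)
    ; inside  = λ xy → [ inside′ , [ (λ { (refl , _) → Wu }) , (λ { (refl , _) → Wv }) ]′ ]′ (addEdge-elim graph u≢v xy)
    ; free    = λ xs xs-cl len → [ (λ cl → free′ xs cl len)
        , (λ (ys , _ , _ , _ , |xs| , uvys , cl) → ¬uv (ys , cong (pred ∘ pred) (trans (sym |xs|) len) , All.map proj₁ uvys , All.map proj₂ uvys , cl)) ]′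
        (addEdge-clique graph u≢v xs xs-cl)
    ; linked  = λ { (here refl) _ _ _ ¬adj → true≢false (addEdge-new graph u≢v) ¬adj
                  ; (there p∈) Wx Wy x≢y ¬adj → Linked-mono graph (addEdge graph u≢v) (addEdge-⊇ graph u≢v)
                      (linked p∈ Wx Wy x≢y (¬true⇒false λ xy → true≢false (addEdge-⊇ graph u≢v _ _ xy) ¬adj)) }
    }
    where open Saturation sat renaming (inside to inside′; free to free′)

module _ {n} (G : Graph n) (W : VSet n) where

  -- Extend a clique greedily inside W; it becomes maximal before reaching k vertices.
  maximal-clique : ∀ k fuel Q → length Q + fuel ≡ k → CliqueFree G k → Clique G Q → All (λ x → W x ≡ true) Q →
    ∃ λ Q′ → length Q′ < k × Clique G Q′ × All (λ x → W x ≡ true) Q′ ×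
             (∀ x → W x ≡ true → ∃ λ i → adj G x (lookup Q′ i) ≡ false)
  maximal-clique k zero Q len free Q-cl _ = contradiction (trans (sym (+-identityʳ (length Q))) len) (free Q Q-cl)
  maximal-clique k (suc fuel) Q len free Q-cl Q⊆W with any? (λ x → (W x Bool.≟ true) ×-dec (missed G x Q ≤? 0))
  ... | yes (x , Wx , none) =
    maximal-clique k fuel (x ∷ Q) (trans (sym (+-suc (length Q) fuel)) len) free
      (missed≡0⇒adj G x Q (n≤0⇒n≡0 none) ∷ Q-cl) (Wx ∷ Q⊆W)
  ... | no maximal = Q , ≤-trans (s≤s (m≤m+n (length Q) fuel)) (≤-reflexive (trans (sym (+-suc (length Q) fuel)) len)) , Q-cl , Q⊆W , nonneighbour
    where
    nonneighbour : ∀ x → W x ≡ true → ∃ λ i → adj G x (lookup Q i) ≡ false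
    nonneighbour x Wx with ∑-pos _ Q (≰⇒> λ none → maximal (x , Wx , none))
    ... | y , y∈Q , 1≤ = index y∈Q , not-elim (𝟙-pos (subst (λ z → 1 ≤ 𝟙 (not (adj G x z))) (lookup-index y∈Q) 1≤))

-- After saturation non-adjacency is transitive on W, so the classes are indexed by a maximal clique.
andrásfai-erdős-sós : ∀ {n} (G : Graph n) s (W : VSet n) → (∀ {x y} → adj G x y ≡ true → W x ≡ true) →
  CliqueFree G (2 + s) → (∀ x → W x ≡ true → (2 + 3 * s) * miss G x < 3 * n) → Partite (suc s) G
andrásfai-erdős-sós {n} G s W inside free deg = colour , proper
  where
  pairs = cartesianProduct (allFin n) (allFin n)
  module S = Saturation (saturate G s W inside free pairs)
  Ĝ = S.graph

  deg′ : ∀ {x y} → adj Ĝ x y ≡ true → (2 + 3 * s) * miss Ĝ x < 3 * n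
  deg′ {x} xy = ≤-trans (s≤s (*-monoʳ-≤ (2 + 3 * s) (#-mono λ y ¬xy → not-intro (¬true⇒false λ xy → true≢false (S.extends x y xy) (not-elim ¬xy)))))
    (deg x (S.inside xy))

  linked : ∀ {u v} → W u ≡ true → W v ≡ true → u ≢ v → adj Ĝ u v ≡ false → Linked Ĝ s u v
  linked {u} {v} = S.linked (∈-cartesianProduct⁺ (∈-allFin u) (∈-allFin v))

  nonadj-trans : ∀ {u v w} → W u ≡ true → W v ≡ true → W w ≡ true → adj Ĝ v u ≡ false → adj Ĝ w u ≡ false → adj Ĝ v w ≡ false
  nonadj-trans {u} {v} {w} Wu Wv Ww vu wu = ¬true⇒false λ vw → absurd vw (u ≟ᶠ v) (u ≟ᶠ w)
    where
    absurd : adj Ĝ v w ≡ true → Dec (u ≡ v) → Dec (u ≡ w) → ⊥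
    absurd vw (yes refl) _          = true≢false (adj-sym′ Ĝ vw) wu
    absurd vw (no _)     (yes refl) = true≢false vw vu
    absurd vw (no u≢v)   (no u≢w)
      with linked Wu Wv u≢v (trans (adj-sym Ĝ u v) vu) | linked Wu Ww u≢w (trans (adj-sym Ĝ u w) wu)
    ... | K , |K| , uK , vK , K-cl | L , |L| , uL , wL , L-cl =
      -- The wedge argument starts with `I` empty; `K` and `L` are the cliques that block the edges
      -- uv and uw.
      no-linked-wedge Ĝ s S.free deg′ s [] K L vw refl |K| |L| (uK ∷ K-cl) (vK ∷ K-cl) (uL ∷ L-cl) (wL ∷ L-cl)

  maximal = maximal-clique Ĝ W (2 + s) (2 + s) [] refl S.free [] []
  Q = proj₁ maximal
  |Q|≤ : length Q ≤ suc s
  |Q|≤ = ≤-pred (proj₁ (proj₂ maximal))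
  Q⊆W : ∀ i → W (lookup Q i) ≡ true
  Q⊆W i = All.lookup (proj₁ (proj₂ (proj₂ (proj₂ maximal)))) (∈-lookup i)
  class : ∀ x → W x ≡ true → ∃ λ i → adj Ĝ x (lookup Q i) ≡ false
  class = proj₂ (proj₂ (proj₂ (proj₂ maximal)))

  colour : Fin n → Fin (suc s)
  colour x with bool-cases (W x)
  ... | inj₁ Wx = inject≤ (proj₁ (class x Wx)) |Q|≤
  -- Vertices outside `W` are isolated in `G`, so any colour will do.
  ... | inj₂ _  = fzero

  proper : ∀ u v → adj G u v ≡ true → colour u ≢ colour v
  proper u v uv eq with bool-cases (W u) | bool-cases (W v)
  ... | inj₂ ¬Wu | _        = true≢false (inside uv) ¬Wu
  ... | inj₁ _   | inj₂ ¬Wv = true≢false (inside (adj-sym′ G uv)) ¬Wv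
  ... | inj₁ Wu  | inj₁ Wv with class u Wu | class v Wv
  ...   | i , ui | j , vj with inject≤-injective |Q|≤ |Q|≤ i j eq
  ...     | refl = true≢false (S.extends u v uv) (nonadj-trans (Q⊆W i) Wu Wv ui vj)

-- Every (s+2)-clique contains a rich pair

-- Which pair of the clique survives the exchanges depends on the vertices traded in, so all pairs
-- are counted together and one is singled out at the end.
pairSum : ∀ {n} → Graph n → ℕ → VSet n → List (Fin n) → ℕ
pairSum G k A O = ∑ (λ u → ∑ (λ v → 𝟙 (adj G u v) * cliques G k (A ∩ adj G u ∩ adj G v)) O) O

∑∑-swap : ∀ {A B : Set} (f : B → B → A → ℕ) (xs : List A) ys →
  ∑ (λ u → ∑ (λ v → ∑ (f u v) xs) ys) ys ≡ ∑ (λ x → ∑ (λ u → ∑ (λ v → f u v x) ys) ys) xs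
∑∑-swap f xs ys = trans (∑-cong ys λ u → ∑-swap (f u) ys xs) (∑-swap (λ u x → ∑ (λ v → f u v x) ys) ys xs)

module _ {n} (G : Graph n) (s : ℕ) (deg : ∀ x → (2 + 3 * s) * miss G x ≤ 3 * n) where

  private
    D = 2 + 3 * s

  -- Trade the vertices of a clique O ∪ N one by one: at least n / 4D vertices x miss at most one vertex of O
  -- and none of N (weights 1 and 2), and such an x may replace a vertex of O, joining N.
  few-missed : ∀ o (O N : List (Fin n)) → length O ≡ 3 + o → length O + length N ≡ 2 + s →
    n ≤ 4 * D * # (λ x → ⌊ missed G x O ≤? 1 ⌋ ∧ ⌊ missed G x N ≤? 0 ⌋)
  few-missed o O N |O| |O|+|N| = certify (total ⊕ bound ⊕ z≤n {3 * n * o + 2 * (D * # good)})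
    (arith n s o (D * S) (# good) (length (O ++ N ++ N)) |all|)
    where
    good : VSet n
    good x = ⌊ missed G x O ≤? 1 ⌋ ∧ ⌊ missed G x N ≤? 0 ⌋
    S = ∑ (λ x → missed G x (O ++ N ++ N)) (allFin n)
    bound : D * S ≤ length (O ++ N ++ N) * (3 * n)
    bound = missed-bound G D (3 * n) (O ++ N ++ N) (All.tabulate λ {y} _ → deg y)
    pointwise : ∀ x → 2 ≤ missed G x (O ++ N ++ N) + 2 * 𝟙 (good x)
    pointwise x with missed G x O ≤? 1 | missed G x N ≤? 0
    ... | yes _ | yes _ = m≤n+m 2 _
    ... | no ≰  | _     = ≤-trans (missed-++ G x O (≰⇒> ≰) z≤n) (m≤m+n _ _)
    ... | yes _ | no ≰  = ≤-trans (missed-++ G x O z≤n (missed-++ G x N (≰⇒> ≰) (≰⇒> ≰))) (m≤m+n _ _)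
    total : D * (n * 2) ≤ D * S + D * (2 * # good)
    total = ≤-trans (*-monoʳ-≤ D (≤-trans (≤-reflexive (trans (cong (_* 2) (sym (length-allFin n))) (sym (∑-const 2 (allFin n)))))
      (≤-trans (∑-mono (allFin n) pointwise) (≤-reflexive (trans (∑-+ _ _ (allFin n)) (cong (S +_) (∑-*ˡ 2 (𝟙 ∘ good) (allFin n))))))))
      (≤-reflexive (*-distribˡ-+ D S (2 * # good)))
    -- |O| + 2 |N| = 1 + 2s - o, and 3 (1 + 2s) = 2D - 1, so the average missed weight is at most 2
    -- - 1 / D. This gives n / 2D good vertices; the weaker n / 4D is the number that the greedy
    -- argument also provides.
    |all| : length (O ++ N ++ N) + o ≡ 1 + 2 * s
    |all| = +-cancelʳ-≡ 3 _ _ (begin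
      length (O ++ N ++ N) + o + 3                     ≡⟨ cong (λ l → l + o + 3) (trans (length-++ O) (cong (length O +_) (length-++ N))) ⟩
      length O + (length N + length N) + o + 3         ≡⟨ regroup (length O) (length N) o ⟩
      length O + (length N + length N) + (3 + o)       ≡⟨ cong (length O + (length N + length N) +_) (sym |O|) ⟩
      length O + (length N + length N) + length O      ≡⟨ double (length O) (length N) ⟩
      2 * (length O + length N)                        ≡⟨ cong (2 *_) |O|+|N| ⟩
      2 * (2 + s)                                      ≡⟨ expand s ⟩
      1 + 2 * s + 3                                    ∎)
      where
      open ≡-Reasoning
      regroup : ∀ a b o → a + (b + b) + o + 3 ≡ a + (b + b) + (3 + o)
      regroup = solve-∀
      double : ∀ a b → a + (b + b) + a ≡ 2 * (a + b)
      double = solve-∀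
      expand : ∀ s → 2 * (2 + s) ≡ 1 + 2 * s + 3
      expand = solve-∀
    arith : ∀ n s o S g l → l + o ≡ 1 + 2 * s →
      n + (S + (2 + 3 * s) * (2 * g) + (l * (3 * n) + (3 * n * o + 2 * ((2 + 3 * s) * g)))) ≡
      4 * (2 + 3 * s) * g + ((2 + 3 * s) * (n * 2) + (S + 0))
    arith n s o S g l eq = trans (collect n s o S g l) (trans (cong (λ m → n + S + 4 * (2 + 3 * s) * g + m * (3 * n)) eq) (expand n s S g))
      where
      collect : ∀ n s o S g l → n + (S + (2 + 3 * s) * (2 * g) + (l * (3 * n) + (3 * n * o + 2 * ((2 + 3 * s) * g)))) ≡
        n + S + 4 * (2 + 3 * s) * g + (l + o) * (3 * n)
      collect = solve-∀
      expand : ∀ n s S g → n + S + 4 * (2 + 3 * s) * g + (1 + 2 * s) * (3 * n) ≡ 4 * (2 + 3 * s) * g + ((2 + 3 * s) * (n * 2) + (S + 0))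
      expand = solve-∀

  -- `N` holds the vertices traded in so far, and `A` contains their joint neighbourhood. Each of
  -- the good vertices x is adjacent to `N` and to all but one of `O`; it joins `N` while `O` loses
  -- a vertex. After o trades two adjacent vertices of the original clique remain, and the o new
  -- vertices form a clique in their joint neighbourhood.
  many-cliques : 1 ≤ n → ∀ o (O N : List (Fin n)) A → length O ≡ 2 + o → length O + length N ≡ 2 + s → Clique G O →
    (∀ x → missed G x N ≡ 0 → A x ≡ true) → n ^ o ≤ (4 * D) ^ o * pairSum G o A O
  many-cliques _ zero (a ∷ b ∷ []) N A _ _ ((ab ∷ []) ∷ _) _ = ≤-trans
    (≤-trans (*-monoˡ-≤ 1 (𝟙-true ab)) (≤-trans (f≤∑ (λ v → 𝟙 (adj G a v) * 1) {xs = a ∷ b ∷ []} (there (here refl)))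
      (f≤∑ (λ u → ∑ (λ v → 𝟙 (adj G u v) * 1) (a ∷ b ∷ [])) {xs = a ∷ b ∷ []} (here refl))))
    (≤-reflexive (sym (+-identityʳ _)))
  many-cliques 1≤n (suc o) O@(y ∷ O₀) N A |O| |O|+|N| O-cl N⇒A = begin
    n * n ^ o                                        ≤⟨ *-monoˡ-≤ (n ^ o) (few-missed o O N |O| |O|+|N|) ⟩
    4 * D * # good * n ^ o                           ≡⟨ trans (*-assoc (4 * D) (# good) (n ^ o)) (cong (4 * D *_) (sym (∑-*ʳ (𝟙 ∘ good) (n ^ o) (allFin n)))) ⟩
    4 * D * ∑ (λ x → 𝟙 (good x) * n ^ o) (allFin n)  ≤⟨ *-monoʳ-≤ (4 * D) (∑-mono (allFin n) step) ⟩
    4 * D * ∑ (λ x → (4 * D) ^ o * T x) (allFin n)   ≡⟨ trans (cong (4 * D *_) (∑-*ˡ ((4 * D) ^ o) T (allFin n))) (sym (*-assoc (4 * D) ((4 * D) ^ o) (∑ T (allFin n)))) ⟩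
    4 * D * (4 * D) ^ o * ∑ T (allFin n)             ≡⟨ cong (4 * D * (4 * D) ^ o *_) (sym T≡) ⟩
    4 * D * (4 * D) ^ o * pairSum G (suc o) A O      ∎
    where
    open ≤-Reasoning
    good : VSet n
    good x = ⌊ missed G x O ≤? 1 ⌋ ∧ ⌊ missed G x N ≤? 0 ⌋
    t : Fin n → Fin n → Fin n → ℕ
    t u v x = 𝟙 (adj G u v) * (𝟙 ((A ∩ adj G u ∩ adj G v) x) * cliques G o ((A ∩ adj G u ∩ adj G v) ∩ adj G x))
    T : Fin n → ℕ
    T x = ∑ (λ u → ∑ (λ v → t u v x) O) O
    T≡ : pairSum G (suc o) A O ≡ ∑ T (allFin n)
    T≡ = trans (∑-cong O λ u → ∑-cong O λ v → sym (∑-*ˡ (𝟙 (adj G u v)) _ (allFin n))) (∑∑-swap t (allFin n) O)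
    step : ∀ x → 𝟙 (good x) * n ^ o ≤ (4 * D) ^ o * T x
    step x with good x in good-x
    ... | false = z≤n
    ... | true with ∧-elim {⌊ missed G x O ≤? 1 ⌋} good-x
    ...   | O≤1 , N≤0 with missed≤1⇒adj-all-but-one G x y O₀ (witness (missed G x O ≤? 1) O≤1)
    ...     | O′ , O′⊑O , |O′| , xO′ = ≤-trans (≤-reflexive (+-identityʳ (n ^ o))) (≤-trans IH (*-monoʳ-≤ ((4 * D) ^ o) ≤T))
      where
      xN : missed G x N ≡ 0
      xN = n≤0⇒n≡0 (witness (missed G x N ≤? 0) N≤0)
      IH : n ^ o ≤ (4 * D) ^ o * pairSum G o (A ∩ adj G x) O′
      IH = many-cliques 1≤n o O′ (x ∷ N) (A ∩ adj G x) (trans |O′| (cong pred |O|))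
        (trans (+-suc (length O′) (length N)) (trans (cong (λ l → suc (l + length N)) |O′|) |O|+|N|))
        (AllPairs-⊑ O′⊑O O-cl)
        λ z z-xN → ∧-intro (N⇒A z (m+n≡0⇒n≡0 (𝟙 (not (adj G z x))) z-xN))
          (adj-sym′ G (¬false⇒true λ zx → 1+n≢0 (trans (cong (λ b → 𝟙 (not b) + missed G z N) (sym zx)) z-xN)))
      term : ∀ {u v} → u ∈ O′ → v ∈ O′ → 𝟙 (adj G u v) * cliques G o ((A ∩ adj G x) ∩ adj G u ∩ adj G v) ≤ t u v x
      term {u} {v} u∈ v∈ = *-monoʳ-≤ (𝟙 (adj G u v)) (≤-trans
        (cliques-mono G o λ z Az → let Axz , uvz = ∧-elim {A z ∧ adj G x z} Az ; Az , xz = ∧-elim {A z} Axz in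
          ∧-intro {A z ∧ adj G u z ∧ adj G v z} (∧-intro {A z} Az uvz) xz)
        (≤-trans (≤-reflexive (sym (*-identityˡ _))) (*-monoˡ-≤ _ (𝟙-true
          (∧-intro (N⇒A x xN) (∧-intro (adj-sym′ G (All.lookup xO′ u∈)) (adj-sym′ G (All.lookup xO′ v∈))))))))
      ≤T : pairSum G o (A ∩ adj G x) O′ ≤ T x
      ≤T = ≤-trans (∑-mono-∈ O′ λ u∈ → ≤-trans (∑-mono-∈ O′ λ v∈ → term u∈ v∈) (∑-⊑ _ O′⊑O)) (∑-⊑ _ O′⊑O)

  clique⇒rich-pair : ∀ Q → Clique G Q → length Q ≡ 2 + s →
    ∃ λ u → ∃ λ v → u ∈ Q × v ∈ Q × adj G u v ≡ true × n ^ s ≤ (2 + s) * (2 + s) * (4 * D) ^ s * cliques G s (adj G u ∩ adj G v)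
  clique⇒rich-pair Q@(a ∷ _) Q-cl |Q| with average (λ u → ∑ (λ v → pair u v) Q) Q (s≤s z≤n)
    where
    pair : Fin n → Fin n → ℕ
    pair u v = 𝟙 (adj G u v) * cliques G s (adj G u ∩ adj G v)
  ... | u , u∈ , ∑≤ with average (λ v → 𝟙 (adj G u v) * cliques G s (adj G u ∩ adj G v)) Q (s≤s z≤n)
  ...   | v , v∈ , ∑∑≤ = u , v , u∈ , v∈ , uv , ≤-trans bound (*-monoʳ-≤ C (≤-trans (*-monoˡ-≤ _ (𝟙≤1 (adj G u v))) (≤-reflexive (*-identityˡ _))))
    where
    C = (2 + s) * (2 + s) * (4 * D) ^ s
    1≤n : Fin n → 1 ≤ n
    1≤n i = ≤-trans (s≤s z≤n) (toℕ<n i)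
    term = 𝟙 (adj G u v) * cliques G s (adj G u ∩ adj G v)
    bound : n ^ s ≤ C * term
    bound = begin
      n ^ s                                             ≤⟨ many-cliques (1≤n a) s Q [] (λ _ → true) |Q| (trans (+-identityʳ _) |Q|) Q-cl (λ _ _ → refl) ⟩
      (4 * D) ^ s * pairSum G s (λ _ → true) Q          ≤⟨ *-monoʳ-≤ ((4 * D) ^ s) (≤-trans ∑≤ (*-monoʳ-≤ (length Q) ∑∑≤)) ⟩
      (4 * D) ^ s * (length Q * (length Q * term))      ≡⟨ cong (λ l → (4 * D) ^ s * (l * (l * term))) |Q| ⟩
      (4 * D) ^ s * ((2 + s) * ((2 + s) * term))        ≡⟨ regroup ((4 * D) ^ s) (2 + s) term ⟩
      C * term                                          ∎
      where
      open ≤-Reasoning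
      regroup : ∀ p q t → p * (q * (q * t)) ≡ q * q * p * t
      regroup = solve-∀
    -- A nonadjacent pair contributes 0 to the sum, whereas `n ^ s` is positive.
    uv : adj G u v ≡ true
    uv = ¬false⇒true λ ¬uv → contradiction (≤-trans (1≤m^n n s (1≤n a)) bound)
      (<⇒≱ (≤-reflexive (cong suc (trans (cong (λ b → C * (𝟙 b * cliques G s (adj G u ∩ adj G v))) ¬uv) (*-zeroʳ C)))))

-- Supersaturation

Injective : ∀ {t n} → (Fin t → Fin n) → Set
Injective U = ∀ {a b} → U a ≡ U b → a ≡ b

none : ∀ {X : Set} → Fin 0 → X
none ()

cons : ∀ {X : Set} {t} → X → (Fin t → X) → Fin (suc t) → X
cons x U fzero    = x
cons x U (fsuc a) = U a

image : ∀ {t n} → (Fin t → Fin n) → VSet n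
image U x = ⌊ any? (λ a → U a ≟ᶠ x) ⌋

all-in : ∀ {t n} → VSet n → (Fin t → Fin n) → Bool
all-in A U = ⌊ all? (λ a → A (U a) Bool.≟ true) ⌋

all-in⁺ : ∀ {t n} (A : VSet n) (U : Fin t → Fin n) → (∀ a → A (U a) ≡ true) → all-in A U ≡ true
all-in⁺ A U = decide (all? _)

all-in⁻ : ∀ {t n} (A : VSet n) (U : Fin t → Fin n) → all-in A U ≡ true → ∀ a → A (U a) ≡ true
all-in⁻ A U = witness (all? _)

contained : ∀ {k t n} → VSet n → (Fin k → Fin t → Fin n) → Bool
contained A T = ⌊ all? (λ i → all? (λ a → A (T i a) Bool.≟ true)) ⌋

contained⁺ : ∀ {k t n} (A : VSet n) (T : Fin k → Fin t → Fin n) → (∀ i a → A (T i a) ≡ true) → contained A T ≡ true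
contained⁺ A T = decide (all? _)

contained⁻ : ∀ {k t n} (A : VSet n) (T : Fin k → Fin t → Fin n) → contained A T ≡ true → ∀ i a → A (T i a) ≡ true
contained⁻ A T = witness (all? _)

#-image : ∀ {t n} (U : Fin t → Fin n) → # image U ≤ t
#-image {t} {n} U = begin
  # image U                                                    ≤⟨ ∑-mono (allFin n) pointwise ⟩
  ∑ (λ x → ∑ (λ a → 𝟙 ⌊ U a ≟ᶠ x ⌋) (allFin t)) (allFin n)     ≡⟨ ∑-swap _ (allFin n) (allFin t) ⟩
  ∑ (λ a → ∑ (λ x → 𝟙 ⌊ U a ≟ᶠ x ⌋) (allFin n)) (allFin t)     ≡⟨ ∑-cong (allFin t) (∑-≟ ∘ U) ⟩
  ∑ (λ _ → 1) (allFin t)                                       ≡⟨ trans (sym (length≡∑ (allFin t))) (length-allFin t) ⟩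
  t                                                            ∎
  where
  open ≤-Reasoning
  pointwise : ∀ x → 𝟙 (image U x) ≤ ∑ (λ a → 𝟙 ⌊ U a ≟ᶠ x ⌋) (allFin t)
  pointwise x with any? (λ a → U a ≟ᶠ x)
  ... | no _         = z≤n
  ... | yes (a , eq) = ≤-trans (𝟙-true (decide (U a ≟ᶠ x) eq)) (f≤∑ _ (∈-allFin a))

#-∩-not-image : ∀ {t n} (A : VSet n) (U : Fin t → Fin n) → # A ≤ # (A ∩ not ∘ image U) + t
#-∩-not-image {t} {n} A U = ≤-trans (∑-mono (allFin n) split)
  (≤-trans (≤-reflexive (∑-+ _ _ (allFin n))) (+-monoʳ-≤ _ (#-image U)))
  where
  split : ∀ x → 𝟙 (A x) ≤ 𝟙 ((A ∩ not ∘ image U) x) + 𝟙 (image U x)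
  split x with A x | image U x
  ... | false | _     = z≤n
  ... | true  | true  = ≤-refl
  ... | true  | false = ≤-refl

cons-injective : ∀ {t n} {x : Fin n} {U : Fin t → Fin n} → image U x ≡ false → Injective U → Injective (cons x U)
cons-injective x∉U inj {fzero}  {fzero}  _  = refl
cons-injective {U = U} x∉U inj {fzero}  {fsuc b} eq = contradiction (b , sym eq) (refute (any? _) x∉U)
cons-injective {U = U} x∉U inj {fsuc a} {fzero}  eq = contradiction (a , eq) (refute (any? _) x∉U)
cons-injective x∉U inj {fsuc a} {fsuc b} eq = cong fsuc (inj eq)

#-pos : ∀ {n} {A : VSet n} → 1 ≤ # A → ∃ λ x → A x ≡ true
#-pos {n} 1≤ with ∑-pos _ (allFin n) 1≤
... | x , _ , 1≤𝟙 = x , 𝟙-pos 1≤𝟙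

choose : ∀ {n} t (A : VSet n) → t ≤ # A → ∃ λ (U : Fin t → Fin n) → Injective U × ∀ a → A (U a) ≡ true
choose zero    A _   = (λ ()) , (λ { {()} }) , λ ()
choose (suc t) A t<A with choose t A (<⇒≤ t<A)
... | U , inj , A-U with #-pos {A = A ∩ not ∘ image U} (+-cancelʳ-≤ t 1 _ (≤-trans t<A (#-∩-not-image A U)))
...   | x , Ax = cons x U , cons-injective (not-elim (proj₂ (∧-elim {A x} Ax))) inj ,
                 λ { fzero → proj₁ (∧-elim Ax) ; (fsuc a) → A-U a }

-- The vertices of U are chosen one at a time, by averaging over the vertices not chosen yet.
common-neighbours : ∀ {A : Set} {n} (Y : A → VSet n) B xs → (∀ {e} → e ∈ xs → n ≤ B * # Y e) → ∀ t → t + 2 * B * t < n →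
  ∃ λ (U : Fin t → Fin n) → Injective U × length xs ≤ (2 * B) ^ t * ∑ (λ e → 𝟙 (all-in (Y e) U)) xs
common-neighbours Y B xs dense zero _ = none , (λ { {()} }) ,
  ≤-trans (≤-reflexive (length≡∑ xs)) (≤-trans (∑-mono xs λ e → 𝟙-true (all-in⁺ (Y e) none λ ())) (≤-reflexive (sym (+-identityʳ _))))
common-neighbours {A} {n} Y B xs dense (suc t) large
  with common-neighbours Y B xs dense t (≤-trans (s≤s (+-mono-≤ (n≤1+n t) (*-monoʳ-≤ (2 * B) (n≤1+n t)))) large)
... | U , inj , |xs|≤ = cons x U , cons-injective x∉U inj , bound
  where
  fresh : List (Fin n)
  fresh = filterᵇ (not ∘ image U) (allFin n)
  w w′ : A → ℕ
  w e = 𝟙 (all-in (Y e) U)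
  f : Fin n → ℕ
  f x = ∑ (λ e → w e * 𝟙 (Y e x)) xs
  t<n : t < n
  t<n = ≤-trans (s≤s (≤-trans (n≤1+n t) (m≤m+n (suc t) _))) large
  fresh-nonempty : 1 ≤ length fresh
  fresh-nonempty = ≤-trans (+-cancelʳ-≤ t 1 _ (≤-trans t<n (≤-trans (≤-reflexive n≡) (#-∩-not-image (λ _ → true) U))))
    (≤-reflexive (sym (length-filter (not ∘ image U) (allFin n))))
    where
    n≡ : n ≡ # (λ (_ : Fin n) → true)
    n≡ = trans (sym (length-allFin n)) (length≡∑ (allFin n))
  averaged = average f fresh fresh-nonempty
  x = proj₁ averaged
  x∉U : image U x ≡ false
  x∉U = not-elim (proj₁ (∈-filter⁻ (not ∘ image U) (allFin n) (proj₁ (proj₂ averaged))))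
  w′ e = 𝟙 (all-in (Y e) (cons x U))
  -- As 2Bt ≤ n, leaving out the vertices of `U` at most halves the guaranteed density.
  dense′ : ∀ {e} → e ∈ xs → n ≤ 2 * B * # (Y e ∩ not ∘ image U)
  dense′ {e} e∈ = certify (dense e∈ ⊕ dense e∈ ⊕ *-monoʳ-≤ B (#-∩-not-image (Y e) U) ⊕ *-monoʳ-≤ B (#-∩-not-image (Y e) U) ⊕ 2Bt≤n)
    (arith n B (# Y e) (# (Y e ∩ not ∘ image U)) t)
    where
    2Bt≤n : 2 * B * t ≤ n
    2Bt≤n = ≤-trans (*-monoʳ-≤ (2 * B) (n≤1+n t)) (≤-trans (m≤n+m _ (suc t)) (<⇒≤ large))
    arith : ∀ n b y z t → n + (b * y + (b * y + (b * (z + t) + (b * (z + t) + n)))) ≡ 2 * b * z + (n + (n + (b * y + (b * y + 2 * b * t))))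
    arith = solve-∀
  doubled : n * ∑ w xs ≤ n * (2 * B * f x)
  doubled = begin
    n * ∑ w xs                                                       ≡⟨ sym (∑-*ˡ n w xs) ⟩
    ∑ (λ e → n * w e) xs                                             ≤⟨ ∑-mono-∈ xs (λ {e} e∈ → *-monoˡ-≤ (w e) (dense′ e∈)) ⟩
    ∑ (λ e → 2 * B * # (Y e ∩ not ∘ image U) * w e) xs               ≡⟨ ∑-cong xs (λ e → trans (*-assoc (2 * B) _ (w e)) (cong (2 * B *_) (spread e))) ⟩
    ∑ (λ e → 2 * B * ∑ (λ x → w e * 𝟙 (Y e x)) fresh) xs             ≡⟨ ∑-*ˡ (2 * B) _ xs ⟩
    2 * B * ∑ (λ e → ∑ (λ x → w e * 𝟙 (Y e x)) fresh) xs             ≡⟨ cong (2 * B *_) (∑-swap (λ e x → w e * 𝟙 (Y e x)) xs fresh) ⟩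
    2 * B * ∑ f fresh                                                ≤⟨ *-monoʳ-≤ (2 * B) (proj₂ (proj₂ averaged)) ⟩
    2 * B * (length fresh * f x)                                     ≤⟨ *-monoʳ-≤ (2 * B) (*-monoˡ-≤ (f x) |fresh|≤n) ⟩
    2 * B * (n * f x)                                                ≡⟨ exchange (2 * B) n (f x) ⟩
    n * (2 * B * f x)                                                ∎
    where
    open ≤-Reasoning
    exchange : ∀ a b c → a * (b * c) ≡ b * (a * c)
    exchange = solve-∀
    |fresh|≤n : length fresh ≤ n
    |fresh|≤n = ≤-trans (≤-reflexive (length-filter (not ∘ image U) (allFin n))) (#-≤n (not ∘ image U))
    spread : ∀ e → # (Y e ∩ not ∘ image U) * w e ≡ ∑ (λ x → w e * 𝟙 (Y e x)) fresh
    spread e = trans (sym (∑-*ʳ _ (w e) (allFin n))) (trans (∑-cong (allFin n) λ x →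
      trans (cong (_* w e) (𝟙-∧ (Y e x) (not (image U x)))) (rotate (𝟙 (Y e x)) (𝟙 (not (image U x))) (w e)))
      (sym (∑-filter (λ x → w e * 𝟙 (Y e x)) (not ∘ image U) (allFin n))))
      where
      rotate : ∀ a b c → a * b * c ≡ b * (c * a)
      rotate = solve-∀
  fx≤ : f x ≤ ∑ w′ xs
  fx≤ = ∑-mono xs λ e → ≤-trans (≤-reflexive (sym (𝟙-∧ (all-in (Y e) U) (Y e x)))) (𝟙-mono λ both →
    let YU , Yx = ∧-elim {all-in (Y e) U} both in
    all-in⁺ (Y e) (cons x U) λ { fzero → Yx ; (fsuc a) → all-in⁻ (Y e) U YU a })
  bound : length xs ≤ 2 * B * (2 * B) ^ t * ∑ w′ xs
  bound = begin
    length xs                              ≤⟨ |xs|≤ ⟩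
    (2 * B) ^ t * ∑ w xs                   ≤⟨ *-monoʳ-≤ ((2 * B) ^ t) (*-cancelˡ-≤ n {{>-nonZero (≤-trans (s≤s z≤n) t<n)}} doubled) ⟩
    (2 * B) ^ t * (2 * B * f x)            ≤⟨ *-monoʳ-≤ ((2 * B) ^ t) (*-monoʳ-≤ (2 * B) fx≤) ⟩
    (2 * B) ^ t * (2 * B * ∑ w′ xs)        ≡⟨ regroup ((2 * B) ^ t) (2 * B) (∑ w′ xs) ⟩
    2 * B * (2 * B) ^ t * ∑ w′ xs          ∎
    where
    open ≤-Reasoning
    regroup : ∀ p b s → p * (b * s) ≡ b * p * s
    regroup = solve-∀

-- Distinct parts are disjoint by `complete` and irreflexivity. Edges inside a part are allowed,
-- since copies of H need not be induced.
record Blowup {n} (G : Graph n) (k t : ℕ) : Set where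
  field
    part      : Fin k → Fin t → Fin n
    injective : ∀ i → Injective (part i)
    complete  : ∀ {i j} → i ≢ j → ∀ a b → adj G (part i a) (part j b) ≡ true

incidences : ∀ {A : Set} {n} → (A → VSet n) → List A → List (A × Fin n)
incidences {n = n} good = concatMap (λ e → map (e ,_) (filterᵇ (good e) (allFin n)))

module _ {A : Set} {n} (good : A → VSet n) (xs : List A) where

  ∑-incidences : ∀ (f : A → Fin n → ℕ) →
    ∑ (uncurry f) (incidences good xs) ≡ ∑ (λ e → ∑ (λ x → 𝟙 (good e x) * f e x) (allFin n)) xs
  ∑-incidences f = trans (∑-concatMap (uncurry f) _ xs) (∑-cong xs λ e →
    trans (∑-map (uncurry f) (e ,_) (filterᵇ (good e) (allFin n))) (∑-filter (f e) (good e) (allFin n)))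

  incidences-∈ : ∀ {e x} → (e , x) ∈ incidences good xs → good e x ≡ true
  incidences-∈ = All.lookup {P = λ (e , x) → good e x ≡ true} (All.concat⁺ (All.map⁺ {xs = xs} (All.tabulate λ {e} _ →
    All.map⁺ (All.tabulate λ x∈ → proj₁ (∈-filter⁻ (good e) (allFin n) x∈)))))

  incidences-dense : ∀ B → (∀ {e} → e ∈ xs → n ≤ B * # good e) → length xs * n ≤ B * length (incidences good xs)
  incidences-dense B many = begin
    length xs * n                       ≡⟨ sym (∑-const n xs) ⟩
    ∑ (λ _ → n) xs                      ≤⟨ ∑-mono-∈ xs many ⟩
    ∑ (λ e → B * # good e) xs           ≡⟨ ∑-*ˡ B (λ e → # good e) xs ⟩
    B * ∑ (λ e → # good e) xs           ≡⟨ cong (B *_) (sym |inc|) ⟩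
    B * length (incidences good xs)     ∎
    where
    open ≤-Reasoning
    |inc| : length (incidences good xs) ≡ ∑ (λ e → # good e) xs
    |inc| = trans (length≡∑ (incidences good xs)) (trans (∑-incidences (λ _ _ → 1)) (∑-cong xs λ e → ∑-cong (allFin n) λ x → *-identityʳ _))

positive : ∀ {a} b c → 1 ≤ a → a ≤ b * c → 1 ≤ c
positive b (suc c) _   _  = s≤s z≤n
positive b zero    1≤a a≤ = contradiction (≤-trans 1≤a (≤-trans a≤ (≤-reflexive (*-zeroʳ b)))) λ ()

-- One blow-up lies in a positive proportion of the sets `S e`. The index type is arbitrary because
-- the induction enlarges it, and because the applications index by vertices and by pairs of an edge
-- and a vertex. `C` and `N` are chosen before the graph and the family.
Supersaturation : ℕ → ℕ → ℕ → Set₁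
Supersaturation k t B = Σ ℕ λ C → Σ ℕ λ N → ∀ {A : Set} {n} (G : Graph n) (S : A → VSet n) xs → N < n → 1 ≤ length xs →
  (∀ {e} → e ∈ xs → n ^ k ≤ B * cliques G k (S e)) →
  ∃ λ (T : Blowup G k t) → length xs ≤ C * ∑ (λ e → 𝟙 (contained (S e) (Blowup.part T))) xs

-- The first vertex x of the clique is absorbed into the index (e , x), which leaves k-1 vertices.
supersaturate : ∀ k t B → Supersaturation k t B
supersaturate zero t B = 1 , 0 , λ G S xs _ _ _ →
  record { part = none ; injective = λ () ; complete = λ { {()} } } ,
  ≤-trans (≤-reflexive (length≡∑ xs)) (≤-trans (∑-mono xs λ e → 𝟙-true (contained⁺ {0} {t} (S e) none λ ())) (≤-reflexive (sym (+-identityʳ _))))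
supersaturate (suc k) t B with supersaturate k t (2 * B)
... | C₁ , N₁ , IH = B′ * (2 * B′) ^ t , N₁ + (t + 2 * B′ * t) , go
  where
  -- 2B is lost in passing to good extensions, C₁ in the induction, and 2 in the second use of
  -- `markov`.
  B′ = 2 * (2 * B * C₁)
  go : ∀ {A : Set} {n} (G : Graph n) (S : A → VSet n) xs → N₁ + (t + 2 * B′ * t) < n → 1 ≤ length xs →
    (∀ {e} → e ∈ xs → n ^ suc k ≤ B * cliques G (suc k) (S e)) →
    ∃ λ (T : Blowup G (suc k) t) → length xs ≤ B′ * (2 * B′) ^ t * ∑ (λ e → 𝟙 (contained (S e) (Blowup.part T))) xs
  go {A} {n} G S xs large 1≤xs dense = record
    { part      = T′
    ; injective = λ { fzero → proj₁ (proj₂ common) ; (fsuc i) → Blowup.injective T i }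
    ; complete  = λ { {fzero} {fzero} i≢j _ _ → contradiction refl i≢j
                    ; {fzero} {fsuc j} _ a b → joined a j b
                    ; {fsuc i} {fzero} _ a b → adj-sym′ G (joined b i a)
                    ; {fsuc i} {fsuc j} i≢j a b → Blowup.complete T {i} {j} (i≢j ∘ cong fsuc) a b } } ,
    ≤-trans |xs|≤ (*-monoʳ-≤ (B′ * (2 * B′) ^ t) (∑-mono xs λ e → 𝟙-mono (contained-T′ e)))
    where
    1≤n : 1 ≤ n
    1≤n = ≤-trans (s≤s z≤n) large
    1≤n^k : 1 ≤ n ^ k
    1≤n^k = 1≤m^n n k 1≤n
    extensions : A → Fin n → ℕ
    extensions e x = 𝟙 (S e x) * cliques G k (S e ∩ adj G x)
    good : A → VSet n
    good e x = ⌊ n ^ k ≤? 2 * B * extensions e x ⌋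
    good⇒S : ∀ {e x} → good e x ≡ true → S e x ≡ true
    good⇒S {e} {x} gx = 𝟙-pos (m*n≥1⇒m≥1 (positive (2 * B) (extensions e x) 1≤n^k (witness (n ^ k ≤? 2 * B * extensions e x) gx)))
      where
      m*n≥1⇒m≥1 : ∀ {m n} → 1 ≤ m * n → 1 ≤ m
      m*n≥1⇒m≥1 {suc m} _ = s≤s z≤n
    pairs = incidences good xs
    many-good : ∀ {e} → e ∈ xs → n ≤ 2 * B * # good e
    many-good {e} e∈ = ≤-trans (≤-reflexive (sym (length-allFin n)))
      (markov (extensions e) (allFin n) (n ^ k) B 1≤n^k
        (λ x → ≤-trans (*-mono-≤ (𝟙≤1 (S e x)) (cliques-bound G k (S e ∩ adj G x))) (≤-reflexive (*-identityˡ _)))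
        (≤-trans (≤-reflexive (cong (_* n ^ k) (length-allFin n))) (dense e∈)))
    |xs|*n≤ : length xs * n ≤ 2 * B * length pairs
    |xs|*n≤ = incidences-dense good xs (2 * B) many-good
    S′ : A × Fin n → VSet n
    S′ (e , x) = S e ∩ adj G x
    dense′ : ∀ {p} → p ∈ pairs → n ^ k ≤ 2 * B * cliques G k (S′ p)
    dense′ {e , x} p∈ = ≤-trans (witness (n ^ k ≤? 2 * B * extensions e x) (incidences-∈ good xs p∈))
      (*-monoʳ-≤ (2 * B) (≤-trans (*-monoˡ-≤ _ (𝟙≤1 (S e x))) (≤-reflexive (*-identityˡ _))))
    found : ∃ λ (T : Blowup G k t) → length pairs ≤ C₁ * ∑ (λ p → 𝟙 (contained (S′ p) (Blowup.part T))) pairs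
    found = IH G S′ pairs (≤-trans (s≤s (m≤m+n N₁ _)) large) (positive (2 * B) (length pairs) (*-mono-≤ 1≤xs 1≤n) |xs|*n≤) dense′
    T = proj₁ found
    -- The vertices x for which the pair (e , x) survives. A vertex of `Y e` lies in `S e` and is
    -- joined to all of `T`, so t vertices common to many sets `Y e` can serve as the new part.
    Y : A → VSet n
    Y e x = good e x ∧ contained (S′ (e , x)) (Blowup.part T)
    regular : A → Bool
    regular e = ⌊ n ≤? B′ * # Y e ⌋
    xs′ = filterᵇ regular xs
    |xs|≤|xs′| : length xs ≤ B′ * length xs′
    |xs|≤|xs′| = ≤-trans (markov (λ e → # Y e) xs n (2 * B * C₁) 1≤n (#-≤n ∘ Y) total)
      (≤-reflexive (cong (B′ *_) (sym (length-filter regular xs))))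
      where
      open ≤-Reasoning
      total : length xs * n ≤ 2 * B * C₁ * ∑ (λ e → # Y e) xs
      total = begin
        length xs * n                                                     ≤⟨ |xs|*n≤ ⟩
        2 * B * length pairs                                              ≤⟨ *-monoʳ-≤ (2 * B) (proj₂ found) ⟩
        2 * B * (C₁ * ∑ (λ p → 𝟙 (contained (S′ p) (Blowup.part T))) pairs) ≡⟨ sym (*-assoc (2 * B) C₁ _) ⟩
        2 * B * C₁ * ∑ (λ p → 𝟙 (contained (S′ p) (Blowup.part T))) pairs ≡⟨ cong (2 * B * C₁ *_) (trans (∑-incidences good xs (λ e x → 𝟙 (contained (S′ (e , x)) (Blowup.part T))))
                                                                              (∑-cong xs λ e → ∑-cong (allFin n) λ x → sym (𝟙-∧ (good e x) _))) ⟩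
        2 * B * C₁ * ∑ (λ e → # Y e) xs                                   ∎
    common : ∃ λ (U : Fin t → Fin n) → Injective U × length xs′ ≤ (2 * B′) ^ t * ∑ (λ e → 𝟙 (all-in (Y e) U)) xs′
    common = common-neighbours Y B′ xs′ (λ {e} e∈ → witness (n ≤? _) (proj₁ (∈-filter⁻ regular xs e∈))) t (≤-trans (s≤s (m≤n+m _ N₁)) large)
    U = proj₁ common
    T′ = cons U (Blowup.part T)
    |xs|≤ : length xs ≤ B′ * (2 * B′) ^ t * ∑ (λ e → 𝟙 (all-in (Y e) U)) xs
    |xs|≤ = ≤-trans |xs|≤|xs′| (≤-trans (*-monoʳ-≤ B′ (≤-trans (proj₂ (proj₂ common))
      (*-monoʳ-≤ ((2 * B′) ^ t) (≤-trans (≤-reflexive (∑-filter _ regular xs)) (∑-mono xs λ e →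
        ≤-trans (*-monoˡ-≤ _ (𝟙≤1 (regular e))) (≤-reflexive (*-identityˡ _))))))) (≤-reflexive (sym (*-assoc B′ _ _))))
    Y⇒ : ∀ e → all-in (Y e) U ≡ true → ∀ a i b → S e (Blowup.part T i b) ≡ true × adj G (U a) (Blowup.part T i b) ≡ true
    Y⇒ e YU a i b = ∧-elim {S e (Blowup.part T i b)} (contained⁻ (S′ (e , U a)) (Blowup.part T) (proj₂ (∧-elim {good e (U a)} (all-in⁻ (Y e) U YU a))) i b)
    contained-T′ : ∀ e → all-in (Y e) U ≡ true → contained (S e) T′ ≡ true
    contained-T′ e YU = contained⁺ (S e) T′ λ
      { fzero a    → good⇒S {e} {U a} (proj₁ (∧-elim {good e (U a)} (all-in⁻ (Y e) U YU a)))
      ; (fsuc i) b → proj₁ (Y⇒ e YU b i b) }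
    -- Adjacency is read off from a single index e whose `Y e` contains `U`; there is one because
    -- `xs` is nonempty and the bound makes the number of such e positive.
    joined : ∀ a j b → adj G (U a) (Blowup.part T j b) ≡ true
    joined a j b = joined-at (∑-pos w xs (positive (B′ * (2 * B′) ^ t) (∑ w xs) 1≤xs |xs|≤))
      where
      w : A → ℕ
      w e = 𝟙 (all-in (Y e) U)
      joined-at : (∃ λ e → e ∈ xs × 1 ≤ w e) → adj G (U a) (Blowup.part T j b) ≡ true
      joined-at (e , _ , YU) = proj₂ (Y⇒ e (𝟙-pos YU) a j b)

abstract
  supersaturation : ∀ k t B → Supersaturation k t B
  supersaturation = supersaturate

-- Embedding H

-- The parts have size h, so u can always take slot u of its part and no two vertices compete for a
-- slot. Vertices of class `nothing` are placed by `base` among joint neighbours of the blow-up.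
embed : ∀ {n h k} {G : Graph n} (H : Graph h) (T : Blowup G k h) (class : Fin h → Maybe (Fin k)) (base : Fin h → Fin n) →
  (∀ {u v i j} → adj H u v ≡ true → class u ≡ just i → class v ≡ just j → i ≢ j) →
  (∀ {u} → class u ≡ nothing → ∀ i a → adj G (base u) (Blowup.part T i a) ≡ true) →
  (∀ {u v} → class u ≡ nothing → class v ≡ nothing → base u ≡ base v → u ≡ v) →
  (∀ {u v} → class u ≡ nothing → class v ≡ nothing → adj H u v ≡ true → adj G (base u) (base v) ≡ true) →
  Contains G H
embed {n} {h} {k} {G} H T class base proper joined inj edges = f , f-inj , f-edge
  where
  open Blowup T
  place : Maybe (Fin k) → Fin h → Fin n
  place (just i) u = part i u
  place nothing  u = base u
  f : Fin h → Fin n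
  f u = place (class u) u
  f-inj : ∀ u v → f u ≡ f v → u ≡ v
  f-inj u v eq with class u in cu | class v in cv
  ... | nothing | nothing = inj cu cv eq
  ... | nothing | just j  = contradiction eq (adj⇒≢ G (joined cu j v))
  ... | just i  | nothing = contradiction (sym eq) (adj⇒≢ G (joined cv i u))
  ... | just i  | just j with i ≟ᶠ j
  ...   | yes refl = injective i eq
  ...   | no i≢j   = contradiction eq (adj⇒≢ G (complete i≢j u v))
  f-edge : ∀ u v → adj H u v ≡ true → adj G (f u) (f v) ≡ true
  f-edge u v uv with class u in cu | class v in cv
  ... | nothing | nothing = edges cu cv uv
  ... | nothing | just j  = joined cu j v
  ... | just i  | nothing = adj-sym′ G (joined cv i u)
  ... | just i  | just j  = complete (proper uv cu cv) u v

-- Many vertices whose neighbourhoods contain a positive density of (s+1)-cliques would share a blow-up of such a clique,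
-- and H would embed with one colour class among these vertices.
few-rich-vertices : ∀ {h} (H : Graph h) s (c : Fin h → Fin (2 + s)) → ProperColouring H (2 + s) c → ∀ B →
  Σ ℕ λ M → Σ ℕ λ N → ∀ {n} (G : Graph n) → N < n → ¬ Contains G H →
  ∀ (A : VSet n) → (∀ {z} → A z ≡ true → n ^ suc s ≤ B * cliques G (suc s) (adj G z)) → # A ≤ M
few-rich-vertices {h} H s c proper B with supersaturation (suc s) h B
... | C , N , blow-up = C * h , N , bound
  where
  bound : ∀ {n} (G : Graph n) → N < n → ¬ Contains G H →
    ∀ (A : VSet n) → (∀ {z} → A z ≡ true → n ^ suc s ≤ B * cliques G (suc s) (adj G z)) → # A ≤ C * h
  bound {n} G large H-free A rich = ≮⇒≥ λ Ch<#A → H-free (too-many Ch<#A)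
    where
    too-many : C * h < # A → Contains G H
    too-many Ch<#A = embed H T class base class-proper joined base-inj no-edges
     where
      xs = filterᵇ A (allFin n)
      Ch<|xs| : C * h < length xs
      Ch<|xs| = ≤-trans Ch<#A (≤-reflexive (sym (length-filter A (allFin n))))
      found : ∃ λ (T : Blowup G (suc s) h) → length xs ≤ C * ∑ (λ z → 𝟙 (contained (adj G z) (Blowup.part T))) xs
      found = blow-up G (adj G) xs large (≤-trans (s≤s z≤n) Ch<|xs|) (λ {z} z∈ → rich {z} (proj₁ (∈-filter⁻ A (allFin n) z∈)))
      T = proj₁ found
      joint : VSet n
      joint z = contained (adj G z) (Blowup.part T)
      h<joint : h < # joint
      h<joint = *-cancelˡ-< C h (# joint) (≤-trans Ch<|xs| (≤-trans (proj₂ found) (*-monoʳ-≤ C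
        (≤-trans (≤-reflexive (∑-filter (𝟙 ∘ joint) A (allFin n))) (∑-mono (allFin n) λ z →
          ≤-trans (*-monoˡ-≤ (𝟙 (joint z)) (𝟙≤1 (A z))) (≤-reflexive (*-identityˡ (𝟙 (joint z)))))))))
      chosen = choose h joint (<⇒≤ h<joint)
      base = proj₁ chosen
      outer : Fin (2 + s) → Maybe (Fin (suc s))
      outer fzero    = nothing
      outer (fsuc i) = just i
      class = outer ∘ c
      outer-just : ∀ {i j} → outer i ≡ just j → i ≡ fsuc j
      outer-just {fsuc i} refl = refl
      outer-nothing : ∀ {i} → outer i ≡ nothing → i ≡ fzero
      outer-nothing {fzero} _ = refl
      class-proper : ∀ {u v i j} → adj H u v ≡ true → class u ≡ just i → class v ≡ just j → i ≢ j
      class-proper uv cu cv refl = proper _ _ uv (trans (outer-just cu) (sym (outer-just cv)))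
      joined : ∀ {u} → class u ≡ nothing → ∀ i a → adj G (base u) (Blowup.part T i a) ≡ true
      joined {u} _ = contained⁻ (adj G (base u)) (Blowup.part T) (proj₂ (proj₂ chosen) u)
      base-inj : ∀ {u v} → class u ≡ nothing → class v ≡ nothing → base u ≡ base v → u ≡ v
      base-inj _ _ = proj₁ (proj₂ chosen)
      no-edges : ∀ {u v} → class u ≡ nothing → class v ≡ nothing → adj H u v ≡ true → adj G (base u) (base v) ≡ true
      no-edges cu cv uv = contradiction (trans (outer-nothing cu) (sym (outer-nothing cv))) (proper _ _ uv)

-- Common neighbours of cliques

module _ {n} (G : Graph n) (s : ℕ) (deg : ∀ x → (2 + 3 * s) * miss G x ≤ 3 * n) where

  private
    D = 2 + 3 * s

  -- For each k-clique in `A`, all vertices y but those outside `U` and those missed by the clique,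
  -- at most 3n / D per clique vertex, are common neighbours in `U`; the pairs are then counted by
  -- y. `U` is arbitrary because fixing the first vertex x replaces it by `U ∩ adj G x`.
  ∑-extensions : ∀ k (A U : VSet n) → D * n * cliques G k A ≤
    D * ∑ (λ y → 𝟙 (U y) * cliques G k (A ∩ adj G y)) (allFin n) + (D * # (not ∘ U) + k * (3 * n)) * cliques G k A
  ∑-extensions zero A U = ≤-reflexive (trans (cong (λ m → D * m * 1) (sym (#-not U)))
    (trans (expand D (# U) (# (not ∘ U)) n) (cong (λ m → D * m + (D * # (not ∘ U) + 0 * (3 * n)) * 1) (sym (∑-*ʳ (𝟙 ∘ U) 1 (allFin n))))))
    where
    expand : ∀ d u v n → d * (u + v) * 1 ≡ d * (u * 1) + (d * v + 0 * (3 * n)) * 1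
    expand = solve-∀
  ∑-extensions (suc k) A U = begin
    D * n * ∑ (λ x → 𝟙 (A x) * cl x) (allFin n)                                  ≡⟨ sym (∑-*ˡ (D * n) _ (allFin n)) ⟩
    ∑ (λ x → D * n * (𝟙 (A x) * cl x)) (allFin n)                                ≤⟨ ∑-mono (allFin n) step ⟩
    ∑ (λ x → D * ∑ (t x) (allFin n) + E * (𝟙 (A x) * cl x)) (allFin n)           ≡⟨ ∑-+ _ _ (allFin n) ⟩
    ∑ (λ x → D * ∑ (t x) (allFin n)) (allFin n) + ∑ (λ x → E * (𝟙 (A x) * cl x)) (allFin n)
                                                                                 ≡⟨ cong₂ _+_ (∑-*ˡ D _ (allFin n)) (∑-*ˡ E _ (allFin n)) ⟩
    D * ∑ (λ x → ∑ (t x) (allFin n)) (allFin n) + E * cliques G (suc k) A        ≡⟨ cong (λ m → D * m + E * cliques G (suc k) A) (∑-swap t (allFin n) (allFin n)) ⟩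
    D * ∑ (λ y → ∑ (λ x → t x y) (allFin n)) (allFin n) + E * cliques G (suc k) A
                                                                                 ≡⟨ cong (λ m → D * m + E * cliques G (suc k) A) (∑-cong (allFin n) λ y → ∑-*ˡ (𝟙 (U y)) _ (allFin n)) ⟩
    D * ∑ (λ y → 𝟙 (U y) * cliques G (suc k) (A ∩ adj G y)) (allFin n) + E * cliques G (suc k) A ∎
    where
    open ≤-Reasoning
    E = D * # (not ∘ U) + suc k * (3 * n)
    cl : Fin n → ℕ
    cl x = cliques G k (A ∩ adj G x)
    t : Fin n → Fin n → ℕ
    t x y = 𝟙 (U y) * (𝟙 ((A ∩ adj G y) x) * cliques G k ((A ∩ adj G y) ∩ adj G x))
    term : ∀ x → A x ≡ true → ∀ y → 𝟙 ((U ∩ adj G x) y) * cliques G k ((A ∩ adj G x) ∩ adj G y) ≤ t x y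
    term x Ax y with U y | adj G x y in xy
    ... | false | _     = z≤n
    ... | true  | false = z≤n
    ... | true  | true  = ≤-trans (+-monoˡ-≤ 0 (≤-trans
      (cliques-mono G k λ z Az → let Axz , yz = ∧-elim {A z ∧ adj G x z} Az ; Az , xz = ∧-elim {A z} Axz in
        ∧-intro {A z ∧ adj G y z} (∧-intro {A z} Az yz) xz)
      (≤-trans (≤-reflexive (sym (*-identityˡ _))) (*-monoˡ-≤ _ (𝟙-true (∧-intro Ax (adj-sym′ G xy))))))) (≤-refl)
    loss : ∀ x → D * # (not ∘ (U ∩ adj G x)) ≤ D * # (not ∘ U) + 3 * n
    loss x = ≤-trans (*-monoʳ-≤ D (≤-trans (∑-mono (allFin n) split) (≤-reflexive (∑-+ (𝟙 ∘ not ∘ U) (λ y → 𝟙 (not (adj G x y))) (allFin n)))))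
      (≤-trans (≤-reflexive (*-distribˡ-+ D (# (not ∘ U)) (miss G x))) (+-monoʳ-≤ (D * # (not ∘ U)) (deg x)))
      where
      split : ∀ y → 𝟙 (not (U y ∧ adj G x y)) ≤ 𝟙 (not (U y)) + 𝟙 (not (adj G x y))
      split y with U y
      ... | true  = ≤-refl
      ... | false = s≤s z≤n
    step-at : ∀ x b → A x ≡ b → D * n * (𝟙 b * cl x) ≤ D * ∑ (t x) (allFin n) + E * (𝟙 b * cl x)
    step-at x false _  = ≤-trans (≤-reflexive (*-zeroʳ (D * n))) z≤n
    step-at x true  Ax = begin
      D * n * (cl x + 0)                                              ≡⟨ cong (D * n *_) (+-identityʳ (cl x)) ⟩
      D * n * cl x                                                    ≤⟨ ∑-extensions k (A ∩ adj G x) (U ∩ adj G x) ⟩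
      D * ∑ (λ y → 𝟙 ((U ∩ adj G x) y) * cliques G k ((A ∩ adj G x) ∩ adj G y)) (allFin n)
        + (D * # (not ∘ (U ∩ adj G x)) + k * (3 * n)) * cl x          ≤⟨ *-monoʳ-≤ D (∑-mono (allFin n) (term x Ax)) ⊕ *-monoˡ-≤ (cl x) (+-monoˡ-≤ (k * (3 * n)) (loss x)) ⟩
      D * ∑ (t x) (allFin n) + (D * # (not ∘ U) + 3 * n + k * (3 * n)) * cl x ≡⟨ cong₂ (λ a b → D * ∑ (t x) (allFin n) + a * b) (+-assoc (D * # (not ∘ U)) (3 * n) (k * (3 * n))) (sym (+-identityʳ (cl x))) ⟩
      D * ∑ (t x) (allFin n) + E * (cl x + 0)                         ∎
    step : ∀ x → D * n * (𝟙 (A x) * cl x) ≤ D * ∑ (t x) (allFin n) + E * (𝟙 (A x) * cl x)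
    step x = step-at x (A x) refl

  -- D - 3s = 2, so an s-clique has a linear number of common neighbours.
  common-extensions : ∀ A → n * cliques G s A ≤ D * ∑ (λ y → cliques G s (A ∩ adj G y)) (allFin n)
  common-extensions A = certify
    (∑-extensions s A (λ _ → true) ⊕ z≤n {n * cliques G s A})
    (trans (cong (λ p → n * cl + (p + (D * # (not ∘ full) + s * (3 * n)) * cl + n * cl)) (cong (D *_) (∑-cong (allFin n) λ y → *-identityˡ _)))
      (trans (cong (λ m → n * cl + (D * X + (D * m + s * (3 * n)) * cl + n * cl)) (#-∅ {A = not ∘ full} (λ _ → refl))) (arith s n cl (D * X))))
    where
    full : VSet n
    full _ = true
    cl = cliques G s A
    X = ∑ (λ y → cliques G s (A ∩ adj G y)) (allFin n)
    arith : ∀ s n cl X → n * cl + (X + ((2 + 3 * s) * 0 + s * (3 * n)) * cl + n * cl) ≡ X + ((2 + 3 * s) * n * cl + 0)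
    arith = solve-∀

edges : ∀ {n} → Graph n → List (Fin n × Fin n)
edges {n} G = filterᵇ (λ (u , v) → ⌊ toℕ u <? toℕ v ⌋ ∧ adj G u v) (cartesianProduct (allFin n) (allFin n))

inner : ∀ {s} → Fin (2 + s) → Maybe (Fin s)
inner fzero           = nothing
inner (fsuc fzero)    = nothing
inner (fsuc (fsuc i)) = just i

inner-just : ∀ {s} {i j : Fin (2 + s)} {k} → inner i ≡ just k → inner j ≡ just k → i ≡ j
inner-just {i = fsuc (fsuc i)} {j = fsuc (fsuc j)} refl refl = refl

inner-nothing : ∀ {h s} (c : Fin h → Fin (2 + s)) u → inner (c u) ≡ nothing → inFirstTwo c u ≡ true
inner-nothing c u eq with c u
... | fzero      = refl
... | fsuc fzero = refl

-- The vertices of H[S_c] isolated in it need not lie in the joint neighbourhood of the blow-up; they are sent to further joint neighbours.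
family⇒contains : ∀ {n h s} (G : Graph n) (H : Graph h) (T : Blowup G s h) (E : Graph n) → SpanningSub E G →
  (∀ {u v} → adj E u v ≡ true → contained (adj G u) (Blowup.part T) ≡ true) →
  h + h ≤ # (λ y → contained (adj G y) (Blowup.part T)) → ContainsFamily E H (2 + s) → Contains G H
family⇒contains {n} {h} {s} G H T E E⊆G joint-E many (c , proper , f , f-inj , f-edge) =
  embed H T (inner ∘ c) base inner-proper base-joined base-inj base-edges
  where
  open Blowup T
  joint : VSet n
  joint y = contained (adj G y) part
  -- The values of `f` occupy at most h of the 2h or more joint neighbours.
  spare : ∃ λ (U : Fin h → Fin n) → Injective U × ∀ a → (joint ∩ not ∘ image f) (U a) ≡ true
  spare = choose h (joint ∩ not ∘ image f) (+-cancelʳ-≤ h h _ (≤-trans many (#-∩-not-image joint f)))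
  g = proj₁ spare
  linked-in-S : Fin h → Bool
  linked-in-S u = ⌊ any? (λ v → (inFirstTwo c v Bool.≟ true) ×-dec (adj H u v Bool.≟ true)) ⌋
  place : Bool → Fin h → Fin n
  place true  = f
  place false = g
  base : Fin h → Fin n
  base u = place (linked-in-S u) u
  joint-f : ∀ {u} → inFirstTwo c u ≡ true → linked-in-S u ≡ true → joint (f u) ≡ true
  joint-f {u} u∈S lu with witness (any? (λ v → (inFirstTwo c v Bool.≟ true) ×-dec (adj H u v Bool.≟ true))) lu
  ... | v , v∈S , uv = joint-E (f-edge u v u∈S v∈S uv)
  joint-g : ∀ u → joint (g u) ≡ true
  joint-g u = proj₁ (∧-elim {joint (g u)} (proj₂ (proj₂ spare) u))
  f≢g : ∀ u v → f u ≢ g v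
  f≢g u v eq = refute (any? (λ a → f a ≟ᶠ g v)) (not-elim (proj₂ (∧-elim {joint (g v)} (proj₂ (proj₂ spare) v)))) (u , eq)
  inner-proper : ∀ {u v i j} → adj H u v ≡ true → inner (c u) ≡ just i → inner (c v) ≡ just j → i ≢ j
  inner-proper {u} {v} uv cu cv refl = proper u v uv (inner-just cu cv)
  base-joint : ∀ u b → linked-in-S u ≡ b → inFirstTwo c u ≡ true → joint (place b u) ≡ true
  base-joint u true  lu u∈S = joint-f u∈S lu
  base-joint u false _  _   = joint-g u
  base-joined : ∀ {u} → inner (c u) ≡ nothing → ∀ i a → adj G (base u) (part i a) ≡ true
  base-joined {u} cu = contained⁻ (adj G (base u)) part (base-joint u (linked-in-S u) refl (inner-nothing c u cu))
  place-inj : ∀ {u v} a b → inFirstTwo c u ≡ true → inFirstTwo c v ≡ true → place a u ≡ place b v → u ≡ v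
  place-inj {u} {v} true true u∈S v∈S eq = f-inj u v u∈S v∈S eq
  place-inj {u} {v} true false _ _ eq    = contradiction eq (f≢g u v)
  place-inj {u} {v} false true _ _ eq    = contradiction (sym eq) (f≢g v u)
  place-inj false false _ _ eq           = proj₁ (proj₂ spare) eq
  base-inj : ∀ {u v} → inner (c u) ≡ nothing → inner (c v) ≡ nothing → base u ≡ base v → u ≡ v
  base-inj {u} {v} cu cv = place-inj (linked-in-S u) (linked-in-S v) (inner-nothing c u cu) (inner-nothing c v cv)
  base-edges : ∀ {u v} → inner (c u) ≡ nothing → inner (c v) ≡ nothing → adj H u v ≡ true → adj G (base u) (base v) ≡ true
  base-edges {u} {v} cu cv uv = trans (cong₂ (adj G) (on-f lu) (on-f lv)) (E⊆G _ _ (f-edge u v u∈S v∈S uv))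
    where
    u∈S = inner-nothing c u cu
    v∈S = inner-nothing c v cv
    lu : linked-in-S u ≡ true
    lu = decide (any? _) (v , v∈S , uv)
    lv : linked-in-S v ≡ true
    lv = decide (any? _) (u , u∈S , adj-sym′ H uv)
    on-f : ∀ {w} → linked-in-S w ≡ true → base w ≡ f w
    on-f {w} lw = cong (λ b → place b w) lw

RichEdgeBound : ∀ {h} → Graph h → ℕ → ℕ → Set
RichEdgeBound H s B = Σ ℕ λ C → Σ ℕ λ N → ∀ {n} (G : Graph n) → N < n → ¬ Contains G H → (∀ x → (2 + 3 * s) * miss G x ≤ 3 * n) →
  ∀ (R : Graph n) → SpanningSub R G → (∀ {u v} → adj R u v ≡ true → n ^ s ≤ B * cliques G s (adj G u ∩ adj G v)) →
  ∀ b → (∀ (E : Graph n) → ¬ ContainsFamily E H (2 + s) → edgeCount E ≤ b) → edgeCount R ≤ C * b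

-- Supersaturation is applied to pairs of a rich edge e and a vertex y, and the pairs served by `T`
-- number at most α β: α edges whose ends are joined to `T`, and β vertices joined to `T`. As α is
-- at most the number of rich edges and β at most n, both are positive proportions. The α edges span
-- a graph free of the family and so number at most b; the β vertices provide the room for isolated
-- vertices of the family member.
few-rich-edges′ : ∀ {h} (H : Graph h) s B → Supersaturation s h (2 * ((2 + 3 * s) * B)) → RichEdgeBound H s B
few-rich-edges′ {h} H s B (C , N , blow-up) = K * C , N + K * C * (h + h) , bound
  where
  D = 2 + 3 * s
  -- B is the richness, D comes from `common-extensions`, and 2 from `markov`.
  K = 2 * (D * B)
  bound : ∀ {n} (G : Graph n) → N + K * C * (h + h) < n → ¬ Contains G H → (∀ x → D * miss G x ≤ 3 * n) →
    ∀ (R : Graph n) → SpanningSub R G → (∀ {u v} → adj R u v ≡ true → n ^ s ≤ B * cliques G s (adj G u ∩ adj G v)) →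
    ∀ b → (∀ (E : Graph n) → ¬ ContainsFamily E H (2 + s) → edgeCount E ≤ b) → edgeCount R ≤ K * C * b
  bound {n} G large H-free deg R R⊆G rich b extremal = by-cases (1 ≤? length xs)
    where
    xs = edges R
    1≤n : 1 ≤ n
    1≤n = ≤-trans (s≤s z≤n) large
    S : Fin n × Fin n → VSet n
    S (u , v) = adj G u ∩ adj G v
    extensions : Fin n × Fin n → Fin n → ℕ
    extensions e y = cliques G s (S e ∩ adj G y)
    good : Fin n × Fin n → VSet n
    good e y = ⌊ n ^ s ≤? K * extensions e y ⌋
    R-edge : ∀ {u v} → (u , v) ∈ xs → adj R u v ≡ true
    R-edge {u} {v} e∈ = proj₂ (∧-elim {⌊ toℕ u <? toℕ v ⌋}
      (proj₁ (∈-filter⁻ (λ (u , v) → ⌊ toℕ u <? toℕ v ⌋ ∧ adj R u v) (cartesianProduct (allFin n) (allFin n)) e∈)))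
    many-good : ∀ {e} → e ∈ xs → n ≤ K * # good e
    many-good {e} e∈ = ≤-trans (≤-reflexive (sym (length-allFin n)))
      (markov (extensions e) (allFin n) (n ^ s) (D * B) (1≤m^n n s 1≤n) (λ y → cliques-bound G s (S e ∩ adj G y)) dense)
      where
      open ≤-Reasoning
      dense : length (allFin n) * n ^ s ≤ D * B * ∑ (extensions e) (allFin n)
      dense = begin
        length (allFin n) * n ^ s                   ≡⟨ cong (_* n ^ s) (length-allFin n) ⟩
        n * n ^ s                                   ≤⟨ *-monoʳ-≤ n (rich (R-edge e∈)) ⟩
        n * (B * cliques G s (S e))                 ≡⟨ exchange n B (cliques G s (S e)) ⟩
        B * (n * cliques G s (S e))                 ≤⟨ *-monoʳ-≤ B (common-extensions G s deg (S e)) ⟩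
        B * (D * ∑ (extensions e) (allFin n))       ≡⟨ rotate B D (∑ (extensions e) (allFin n)) ⟩
        D * B * ∑ (extensions e) (allFin n)         ∎
        where
        exchange : ∀ a b c → a * (b * c) ≡ b * (a * c)
        exchange = solve-∀
        rotate : ∀ a b c → a * (b * c) ≡ b * a * c
        rotate = solve-∀
    pairs = incidences good xs
    |xs|*n≤ : length xs * n ≤ K * length pairs
    |xs|*n≤ = incidences-dense good xs K many-good
    S′ : (Fin n × Fin n) × Fin n → VSet n
    S′ (e , y) = S e ∩ adj G y
    Supersaturated : Blowup G s h → Set
    Supersaturated T = length pairs ≤ C * ∑ (λ p → 𝟙 (contained (S′ p) (Blowup.part T))) pairs
    found : 1 ≤ length xs → ∃ Supersaturated
    found 1≤xs = blow-up G S′ pairs (≤-trans (s≤s (m≤m+n N _)) large) (positive K (length pairs) (*-mono-≤ 1≤xs 1≤n) |xs|*n≤)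
      λ { {e , y} p∈ → witness (n ^ s ≤? K * extensions e y) (incidences-∈ good xs p∈) }
    module _ (1≤xs : 1 ≤ length xs) (T : Blowup G s h) (supersaturated : Supersaturated T) where
      joint : VSet n
      joint y = contained (adj G y) (Blowup.part T)
      α = ∑ (λ e → 𝟙 (contained (S e) (Blowup.part T))) xs
      β = # joint
      split : ∀ e y → 𝟙 (good e y) * 𝟙 (contained (S′ (e , y)) (Blowup.part T)) ≤ 𝟙 (contained (S e) (Blowup.part T)) * 𝟙 (joint y)
      split e y = begin
        𝟙 (good e y) * 𝟙 (contained (S′ (e , y)) part)       ≤⟨ *-monoˡ-≤ (𝟙 (contained (S′ (e , y)) part)) (𝟙≤1 (good e y)) ⟩
        1 * 𝟙 (contained (S′ (e , y)) part)                  ≡⟨ *-identityˡ (𝟙 (contained (S′ (e , y)) part)) ⟩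
        𝟙 (contained (S′ (e , y)) part)                      ≤⟨ 𝟙-mono both ⟩
        𝟙 (contained (S e) part ∧ joint y)                   ≡⟨ 𝟙-∧ (contained (S e) part) (joint y) ⟩
        𝟙 (contained (S e) part) * 𝟙 (joint y)               ∎
        where
        open ≤-Reasoning
        open Blowup T using (part)
        both : contained (S′ (e , y)) part ≡ true → contained (S e) part ∧ joint y ≡ true
        both in-both = ∧-intro
          (contained⁺ (S e) part λ i a → proj₁ (∧-elim {S e (part i a)} (contained⁻ (S′ (e , y)) part in-both i a)))
          (contained⁺ (adj G y) part λ i a → proj₂ (∧-elim {S e (part i a)} (contained⁻ (S′ (e , y)) part in-both i a)))
      product : length xs * n ≤ K * C * (α * β)
      product = begin
        length xs * n                                                          ≤⟨ |xs|*n≤ ⟩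
        K * length pairs                                                       ≤⟨ *-monoʳ-≤ K supersaturated ⟩
        K * (C * ∑ (λ p → 𝟙 (contained (S′ p) (Blowup.part T))) pairs)         ≡⟨ sym (*-assoc K C (∑ (λ p → 𝟙 (contained (S′ p) (Blowup.part T))) pairs)) ⟩
        K * C * ∑ (λ p → 𝟙 (contained (S′ p) (Blowup.part T))) pairs           ≡⟨ cong (K * C *_) (∑-incidences good xs (λ e y → 𝟙 (contained (S′ (e , y)) (Blowup.part T)))) ⟩
        K * C * ∑ (λ e → ∑ (λ y → 𝟙 (good e y) * 𝟙 (contained (S′ (e , y)) (Blowup.part T))) (allFin n)) xs
                                                                               ≤⟨ *-monoʳ-≤ (K * C) (∑-mono xs λ e → ∑-mono (allFin n) (split e)) ⟩
        K * C * ∑ (λ e → ∑ (λ y → 𝟙 (contained (S e) (Blowup.part T)) * 𝟙 (joint y)) (allFin n)) xs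
                                                                               ≡⟨ cong (K * C *_) (∑-cong xs λ e → ∑-*ˡ (𝟙 (contained (S e) (Blowup.part T))) (𝟙 ∘ joint) (allFin n)) ⟩
        K * C * ∑ (λ e → 𝟙 (contained (S e) (Blowup.part T)) * β) xs           ≡⟨ cong (K * C *_) (∑-*ʳ (λ e → 𝟙 (contained (S e) (Blowup.part T))) β xs) ⟩
        K * C * (α * β)                                                        ∎
        where open ≤-Reasoning
      |xs|≤α : length xs ≤ K * C * α
      |xs|≤α = *-cancelʳ-≤ (length xs) (K * C * α) n {{>-nonZero 1≤n}}
        (≤-trans product (≤-trans (≤-reflexive (sym (*-assoc (K * C) α β))) (*-monoʳ-≤ (K * C * α) (#-≤n joint))))
      n≤β : n ≤ K * C * β
      n≤β = *-cancelˡ-≤ (length xs) {{>-nonZero 1≤xs}} (≤-trans product (≤-trans (*-monoʳ-≤ (K * C) (*-monoˡ-≤ β α≤|xs|))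
        (≤-reflexive (exchange (K * C) (length xs) β))))
        where
        α≤|xs| : α ≤ length xs
        α≤|xs| = ≤-trans (∑-mono xs λ e → 𝟙≤1 (contained (S e) (Blowup.part T))) (≤-reflexive (sym (length≡∑ xs)))
        exchange : ∀ a b c → a * (b * c) ≡ b * (a * c)
        exchange = solve-∀
      many-joint : h + h ≤ β
      many-joint = <⇒≤ (*-cancelˡ-< (K * C) (h + h) β (≤-trans (≤-trans (s≤s (m≤n+m (K * C * (h + h)) N)) large) n≤β))
      E : Graph n
      E = record
        { adj    = λ u v → adj R u v ∧ (joint u ∧ joint v)
        ; sym    = λ u v → cong₂ _∧_ (adj-sym R u v) (Bool.∧-comm (joint u) (joint v))
        ; irrefl = λ u → cong (_∧ (joint u ∧ joint u)) (adj-irrefl R u)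
        }
      E-elim : ∀ {u v} → adj E u v ≡ true → adj R u v ≡ true × joint u ≡ true × joint v ≡ true
      E-elim {u} {v} uv = let Ruv , juv = ∧-elim {adj R u v} uv in Ruv , ∧-elim {joint u} juv
      E-free : ¬ ContainsFamily E H (2 + s)
      E-free family = H-free (family⇒contains G H T E (λ u v uv → R⊆G u v (proj₁ (E-elim {u} {v} uv))) (λ {u} {v} uv → proj₁ (proj₂ (E-elim {u} {v} uv))) many-joint family)
      α≤E : α ≤ edgeCount E
      α≤E = ≤-trans (≤-reflexive (∑-filter (λ e → 𝟙 (contained (S e) (Blowup.part T))) isR all))
        (≤-trans (∑-mono all λ e → ≤-trans (≤-reflexive (sym (𝟙-∧ (isR e) (contained (S e) (Blowup.part T))))) (𝟙-mono (into e)))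
        (≤-reflexive (sym (length-filter isE all))))
        where
        all = cartesianProduct (allFin n) (allFin n)
        isR isE : Fin n × Fin n → Bool
        isR (u , v) = ⌊ toℕ u <? toℕ v ⌋ ∧ adj R u v
        isE (u , v) = ⌊ toℕ u <? toℕ v ⌋ ∧ adj E u v
        into : ∀ e → isR e ∧ contained (S e) (Blowup.part T) ≡ true → isE e ≡ true
        into (u , v) both = let Re , ST = ∧-elim {isR (u , v)} both ; u<v , Ruv = ∧-elim {⌊ toℕ u <? toℕ v ⌋} Re in
          ∧-intro u<v (∧-intro Ruv (∧-intro
            (contained⁺ (adj G u) (Blowup.part T) λ i a → proj₁ (∧-elim {adj G u (Blowup.part T i a)} (contained⁻ (S (u , v)) (Blowup.part T) ST i a)))
            (contained⁺ (adj G v) (Blowup.part T) λ i a → proj₂ (∧-elim {adj G u (Blowup.part T i a)} (contained⁻ (S (u , v)) (Blowup.part T) ST i a)))))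
      conclusion : length xs ≤ K * C * b
      conclusion = ≤-trans |xs|≤α (*-monoʳ-≤ (K * C) (≤-trans α≤E (extremal E E-free)))
    by-cases : Dec (1 ≤ length xs) → length xs ≤ K * C * b
    by-cases (yes 1≤xs) = uncurry (conclusion 1≤xs) (found 1≤xs)
    by-cases (no none)  = ≤-trans (≮⇒≥ none) z≤n

few-rich-edges : ∀ {h} (H : Graph h) s B → RichEdgeBound H s B
few-rich-edges {h} H s B = few-rich-edges′ H s B (supersaturation s h (2 * ((2 + 3 * s) * B)))

-- Structure

argmax : ∀ {k} (f : Fin (suc k) → ℕ) → ∃ λ i → ∀ j → f j ≤ f i
argmax {zero}  f = fzero , λ { fzero → ≤-refl }
argmax {suc k} f with argmax (f ∘ fsuc)
... | i , i-max with ≤-total (f fzero) (f (fsuc i))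
...   | inj₁ f₀≤ = fsuc i , λ { fzero → f₀≤ ; (fsuc j) → i-max j }
...   | inj₂ ≤f₀ = fzero , λ { fzero → ≤-refl ; (fsuc j) → ≤-trans (i-max j) ≤f₀ }

Clique-∈ : ∀ {n} (G : Graph n) {Q u v} → Clique G Q → u ∈ Q → v ∈ Q → u ≢ v → adj G u v ≡ true
Clique-∈ G (_ ∷ _)    (here refl) (here refl) u≢v = contradiction refl u≢v
Clique-∈ G (xQ ∷ _)   (here refl) (there v∈)  _   = All.lookup xQ v∈
Clique-∈ G (xQ ∷ _)   (there u∈)  (here refl) _   = adj-sym′ G (All.lookup xQ u∈)
Clique-∈ G (_ ∷ Q-cl) (there u∈)  (there v∈)  u≢v = Clique-∈ G Q-cl u∈ v∈ u≢v

#-≤-+ : ∀ {n} (A B C : VSet n) → (∀ x → 𝟙 (A x) ≤ 𝟙 (B x) + 𝟙 (C x)) → # A ≤ # B + # C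
#-≤-+ {n} A B C A≤ = ≤-trans (∑-mono (allFin n) A≤) (≤-reflexive (∑-+ (𝟙 ∘ B) (𝟙 ∘ C) (allFin n)))

#-+-≤ : ∀ {n} (A B C : VSet n) → (∀ x → 𝟙 (A x) + 𝟙 (B x) ≤ 𝟙 (C x)) → # A + # B ≤ # C
#-+-≤ {n} A B C ≤C = ≤-trans (≤-reflexive (sym (∑-+ (𝟙 ∘ A) (𝟙 ∘ B) (allFin n)))) (∑-mono (allFin n) ≤C)

#-∩-split : ∀ {n} (A B : VSet n) → # A ≡ # (A ∩ B) + # (A ∩ not ∘ B)
#-∩-split {n} A B = trans (∑-cong (allFin n) split) (∑-+ (𝟙 ∘ (A ∩ B)) (𝟙 ∘ (A ∩ not ∘ B)) (allFin n))
  where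
  split : ∀ x → 𝟙 (A x) ≡ 𝟙 (A x ∧ B x) + 𝟙 (A x ∧ not (B x))
  split x with A x | B x
  ... | false | _     = refl
  ... | true  | true  = refl
  ... | true  | false = refl

abstract
  -- n / 4D choices at each of the s steps of both the greedy and the exchange argument, and pigeonhole on the pairs in a clique.
  richness : ℕ → ℕ
  richness s = (2 + s) * (2 + s) * (4 * (2 + 3 * s)) ^ s

  richness-≡ : ∀ s → richness s ≡ (2 + s) * (2 + s) * (4 * (2 + 3 * s)) ^ s
  richness-≡ s = refl

module Rich {n} (G : Graph n) (s : ℕ) where

  abstract
    rich : Fin n → Fin n → Bool
    rich u v = ⌊ n ^ s ≤? richness s * cliques G s (adj G u ∩ adj G v) ⌋

    rich⁺ : ∀ {u v} → n ^ s ≤ richness s * cliques G s (adj G u ∩ adj G v) → rich u v ≡ true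
    rich⁺ = decide (_ ≤? _)

    rich⁻ : ∀ {u v} → rich u v ≡ true → n ^ s ≤ richness s * cliques G s (adj G u ∩ adj G v)
    rich⁻ {u} {v} = witness (n ^ s ≤? richness s * cliques G s (adj G u ∩ adj G v))

  rich-sym : ∀ {u v} → rich u v ≡ true → rich v u ≡ true
  rich-sym {u} {v} uv = rich⁺ (≤-trans (rich⁻ uv)
    (*-monoʳ-≤ (richness s) (cliques-mono G s λ x both → trans (Bool.∧-comm (adj G v x) (adj G u x)) both)))

  rich-sym-≡ : ∀ u v → rich u v ≡ rich v u
  rich-sym-≡ u v with bool-cases (rich u v)
  ... | inj₁ uv  = trans uv (sym (rich-sym {u} {v} uv))
  ... | inj₂ ¬uv = trans ¬uv (sym (¬true⇒false λ vu → true≢false (rich-sym {v} {u} vu) ¬uv))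

  richNeighbours : Fin n → VSet n
  richNeighbours v = adj G v ∩ rich v

  richDegree : Fin n → ℕ
  richDegree v = # richNeighbours v

  abstract
    heavy : ℕ → VSet n
    heavy q v = ⌊ n ≤? 2 * q * richDegree v ⌋

    heavy⁻ : ∀ {q v} → heavy q v ≡ true → n ≤ 2 * q * richDegree v
    heavy⁻ {q} {v} = witness (n ≤? 2 * q * richDegree v)

    light⁻ : ∀ {q v} → heavy q v ≡ false → 2 * q * richDegree v < n
    light⁻ {q} {v} light = ≰⇒> (refute (n ≤? 2 * q * richDegree v) light)

  -- Each rich neighbour x of v is the first vertex of at least n ^ s / `richness s` ordered
  -- (s+1)-cliques in the neighbourhood of v, and a heavy v has at least n / 2q such x. This is the
  -- hypothesis of `few-rich-vertices`.
  heavy-cliques : ∀ q {v} → heavy q v ≡ true → n ^ suc s ≤ 2 * q * richness s * cliques G (suc s) (adj G v)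
  heavy-cliques q {v} hv = begin
    n * n ^ s                                                                  ≤⟨ *-monoˡ-≤ (n ^ s) (heavy⁻ hv) ⟩
    2 * q * richDegree v * n ^ s                                               ≡⟨ *-assoc (2 * q) (richDegree v) (n ^ s) ⟩
    2 * q * (richDegree v * n ^ s)                                             ≡⟨ cong (2 * q *_) (sym (∑-*ʳ (𝟙 ∘ richNeighbours v) (n ^ s) (allFin n))) ⟩
    2 * q * ∑ (λ x → 𝟙 (richNeighbours v x) * n ^ s) (allFin n)                ≤⟨ *-monoʳ-≤ (2 * q) (∑-mono (allFin n) step) ⟩
    2 * q * ∑ (λ x → richness s * (𝟙 (adj G v x) * cl x)) (allFin n)           ≡⟨ cong (2 * q *_) (∑-*ˡ (richness s) (λ x → 𝟙 (adj G v x) * cl x) (allFin n)) ⟩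
    2 * q * (richness s * cliques G (suc s) (adj G v))                         ≡⟨ sym (*-assoc (2 * q) (richness s) (cliques G (suc s) (adj G v))) ⟩
    2 * q * richness s * cliques G (suc s) (adj G v)                           ∎
    where
    open ≤-Reasoning
    cl : Fin n → ℕ
    cl x = cliques G s (adj G v ∩ adj G x)
    step : ∀ x → 𝟙 (richNeighbours v x) * n ^ s ≤ richness s * (𝟙 (adj G v x) * cl x)
    step x with adj G v x | bool-cases (rich v x)
    ... | false | _ = z≤n
    ... | true  | inj₂ ¬r = ≤-trans (≤-reflexive (cong (λ b → 𝟙 b * n ^ s) ¬r)) z≤n
    ... | true  | inj₁ r  = ≤-trans (≤-trans (*-monoˡ-≤ (n ^ s) (𝟙≤1 (rich v x))) (≤-reflexive (*-identityˡ (n ^ s))))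
      (≤-trans (rich⁻ r) (≤-reflexive (cong (richness s *_) (sym (*-identityˡ (cl x))))))

-- Here 1 / q stands in for ε: `deg` says that a vertex misses at most 3n / D - n / q. A light
-- vertex loses fewer than n / 2q neighbours with the rich edges and at most n / 2q with the heavy
-- vertices, so the surplus n / q pays for the deletion. `4D≤q` makes D times the number of heavy
-- vertices at most n / 8.
module Structure {n} (G : Graph n) (s q : ℕ) (1≤n : 1 ≤ n) (4D≤q : 4 * (2 + 3 * s) ≤ q)
  (deg : ∀ v → (2 + 3 * s) * (q * miss G v + n) ≤ 3 * q * n)
  (few-heavy : 2 * q * # (Rich.heavy G s q) ≤ n) where

  open Rich G s

  private
    D = 2 + 3 * s
    Z W : VSet n
    Z = heavy q
    W = not ∘ Z

    1≤q : 1 ≤ q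
    1≤q = ≤-trans (s≤s z≤n) 4D≤q

  miss-bound : ∀ v → D * miss G v ≤ 3 * n
  miss-bound v = *-cancelˡ-≤ q {{>-nonZero 1≤q}} (certify (deg v ⊕ z≤n {D * n}) (arith D q (miss G v) n))
    where
    arith : ∀ d q m n → q * (d * m) + (3 * q * n + d * n) ≡ q * (3 * n) + (d * (q * m + n) + 0)
    arith = solve-∀

  private
    W⇒light : ∀ {v} → W v ≡ true → 2 * q * richDegree v < n
    W⇒light Wv = light⁻ (not-elim Wv)

    poor : Graph n
    poor = record
      { adj    = λ u v → (adj G u v ∧ not (rich u v)) ∧ (W u ∧ W v)
      ; sym    = λ u v → cong₂ _∧_ (cong₂ (λ a b → a ∧ not b) (adj-sym G u v) (rich-sym-≡ u v)) (Bool.∧-comm (W u) (W v))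
      ; irrefl = λ u → cong (λ b → (b ∧ not (rich u u)) ∧ (W u ∧ W u)) (adj-irrefl G u)
      }

    poor-elim : ∀ {u v} → adj poor u v ≡ true → adj G u v ≡ true × rich u v ≡ false × W u ≡ true
    poor-elim {u} {v} uv with ∧-elim {adj G u v ∧ not (rich u v)} uv
    ... | Gr , Wuv with ∧-elim {adj G u v} Gr
    ...   | Guv , ¬r = Guv , not-elim ¬r , proj₁ (∧-elim {W u} Wuv)

    poor-free : CliqueFree poor (2 + s)
    poor-free Q Q-cl |Q| with clique⇒rich-pair G s miss-bound Q (Clique-poor Q-cl) |Q|
      where
      Clique-poor : ∀ {Q} → Clique poor Q → Clique G Q
      Clique-poor []        = []
      Clique-poor {x ∷ _} (xQ ∷ cl) = All.map (λ {y} xy → proj₁ (poor-elim {x} {y} xy)) xQ ∷ Clique-poor cl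
    ... | u , v , u∈ , v∈ , uv , ruv =
      true≢false (rich⁺ (≤-trans ruv (≤-reflexive (cong (_* cliques G s (adj G u ∩ adj G v)) (sym (richness-≡ s))))))
        (proj₁ (proj₂ (poor-elim {u} {v} (Clique-∈ poor Q-cl u∈ v∈ (adj⇒≢ G uv)))))

    poor-deg : ∀ x → W x ≡ true → D * miss poor x < 3 * n
    poor-deg x Wx = *-cancelˡ-< (2 * q) (D * miss poor x) (3 * n) (≤-trans
      (s≤s (≤-trans (m≤m+n (2 * q * (D * miss poor x)) (1 + 3 * s)) ≤-refl))
      (certify (*-monoʳ-≤ (2 * q * D) miss≤ ⊕ *-monoʳ-≤ D (W⇒light Wx) ⊕ *-monoʳ-≤ D few-heavy ⊕ deg x ⊕ deg x)
        (arith s q n (miss poor x) (miss G x) (richDegree x) (# Z))))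
      where
      bits : ∀ a r zx zy → zx ≡ false → 𝟙 (not ((a ∧ not r) ∧ (not zx ∧ not zy))) ≤ 𝟙 (not a) + (𝟙 (a ∧ r) + 𝟙 zy)
      bits false _     _     _     _ = s≤s z≤n
      bits true  true  _     _     _ = s≤s z≤n
      bits true  false false true  _ = ≤-refl
      bits true  false false false _ = z≤n
      pointwise : ∀ y → 𝟙 (not (adj poor x y)) ≤ 𝟙 (not (adj G x y)) + (𝟙 (richNeighbours x y) + 𝟙 (Z y))
      pointwise y = bits (adj G x y) (rich x y) (Z x) (Z y) (not-elim Wx)
      miss≤ : miss poor x ≤ miss G x + (richDegree x + # Z)
      miss≤ = ≤-trans (∑-mono (allFin n) pointwise) (≤-reflexive (trans (∑-+ (λ y → 𝟙 (not (adj G x y))) (λ y → 𝟙 (richNeighbours x y) + 𝟙 (Z y)) (allFin n))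
        (cong (miss G x +_) (∑-+ (𝟙 ∘ richNeighbours x) (𝟙 ∘ Z) (allFin n)))))
      arith : ∀ s q n m′ m ρ z →
        suc (2 * q * ((2 + 3 * s) * m′) + (1 + 3 * s)) + (2 * q * (2 + 3 * s) * (m + (ρ + z)) + ((2 + 3 * s) * n + ((2 + 3 * s) * n + (3 * q * n + 3 * q * n)))) ≡
        2 * q * (3 * n) + (2 * q * (2 + 3 * s) * m′ + ((2 + 3 * s) * (1 + 2 * q * ρ) + ((2 + 3 * s) * (2 * q * z) + ((2 + 3 * s) * (q * m + n) + (2 + 3 * s) * (q * m + n)))))
      arith = solve-∀

  abstract
    base-partition : Partite (suc s) poor
    base-partition = andrásfai-erdős-sós poor s W (λ {x} {y} xy → proj₂ (proj₂ (poor-elim {x} {y} xy))) poor-free poor-deg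

  private
    p₀ : Fin n → Fin (suc s)
    p₀ = proj₁ base-partition

  -- Part sizes and missed vertices

  V : Fin (suc s) → VSet n
  V j x = W x ∧ ⌊ p₀ x ≟ᶠ j ⌋

  V-elim : ∀ {j x} → V j x ≡ true → W x ≡ true × p₀ x ≡ j
  V-elim {j} {x} Vx with ∧-elim {W x} Vx
  ... | Wx , px = Wx , witness (p₀ x ≟ᶠ j) px

  V-rich : ∀ {j x y} → V j x ≡ true → V j y ≡ true → adj G x y ≡ true → rich x y ≡ true
  V-rich {j} {x} {y} Vx Vy xy = ¬false⇒true λ ¬r → proj₂ base-partition x y
    (∧-intro (∧-intro xy (not-intro ¬r)) (∧-intro (proj₁ (V-elim {j} {x} Vx)) (proj₁ (V-elim {j} {y} Vy))))
    (trans (proj₂ (V-elim {j} {x} Vx)) (sym (proj₂ (V-elim {j} {y} Vy))))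

  missing : Fin (suc s) → Fin n → ℕ
  missing l x = # (V l ∩ not ∘ adj G x)

  V-disjoint : ∀ {j l} → l ≢ j → ∀ x → 𝟙 (V l x) + 𝟙 (V j x) ≤ 1
  V-disjoint {j} {l} l≢j x with W x | p₀ x ≟ᶠ l | p₀ x ≟ᶠ j
  ... | false | _        | _        = z≤n
  ... | true  | no _     | no _     = z≤n
  ... | true  | no _     | yes _    = ≤-refl
  ... | true  | yes _    | no _     = ≤-refl
  ... | true  | yes refl | yes refl = contradiction refl l≢j

  missing-two : ∀ {j l} → l ≢ j → ∀ x → missing l x + missing j x ≤ miss G x
  missing-two {j} {l} l≢j x = #-+-≤ (V l ∩ not ∘ adj G x) (V j ∩ not ∘ adj G x) (not ∘ adj G x) pointwise
    where
    pointwise : ∀ y → 𝟙 (V l y ∧ not (adj G x y)) + 𝟙 (V j y ∧ not (adj G x y)) ≤ 𝟙 (not (adj G x y))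
    pointwise y with adj G x y
    ... | true  = ≤-reflexive (cong₂ (λ a b → 𝟙 a + 𝟙 b) (Bool.∧-zeroʳ (V l y)) (Bool.∧-zeroʳ (V j y)))
    ... | false = ≤-trans (≤-reflexive (cong₂ (λ a b → 𝟙 a + 𝟙 b) (Bool.∧-identityʳ (V l y)) (Bool.∧-identityʳ (V j y)))) (V-disjoint l≢j y)

  AllRich : Fin (suc s) → Fin n → Set
  AllRich j x = ∀ {y} → V j y ≡ true → adj G x y ≡ true → rich x y ≡ true

  V-bound : ∀ {j} x → AllRich j x → # (V j) ≤ missing j x + richDegree x
  V-bound {j} x all-rich = ≤-trans (≤-reflexive (trans (#-∩-split (V j) (adj G x)) (+-comm (# (V j ∩ adj G x)) (missing j x))))
    (+-monoʳ-≤ (missing j x) (#-mono λ y both → let Vy , xy = ∧-elim {V j y} both in ∧-intro xy (all-rich Vy xy)))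

  -- Nonneighbours in different parts are disjoint, and a vertex with only rich edges into `V j`
  -- misses all of it except at most `richDegree x` vertices. Missing its own part thus uses up most
  -- of what x may miss.
  missing+V : ∀ {j l} → l ≢ j → ∀ x → AllRich j x → missing l x + # (V j) ≤ miss G x + richDegree x
  missing+V {j} {l} l≢j x all-rich = certify (missing-two l≢j x ⊕ V-bound x all-rich) (arith (missing l x) (# (V j)) (missing j x) (miss G x) (richDegree x))
    where
    arith : ∀ a v b m ρ → a + v + (m + (b + ρ)) ≡ m + ρ + (a + b + v)
    arith = solve-∀

  -- The rich degree of a light vertex is below n / 2q, which the surplus n / q in `deg` covers.
  light-bound : ∀ {x a} → W x ≡ true → a ≤ miss G x + richDegree x → D * a ≤ 3 * n
  light-bound {x} {a} Wx a≤ = *-cancelˡ-≤ (2 * q) {{>-nonZero (*-mono-≤ (s≤s (z≤n {1})) 1≤q)}} (certify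
    (*-monoʳ-≤ (2 * q * D) a≤ ⊕ *-monoʳ-≤ D (<⇒≤ (W⇒light Wx)) ⊕ deg x ⊕ deg x ⊕ z≤n {D * n})
    (arith D q n a (miss G x) (richDegree x)))
    where
    arith : ∀ d q n a m ρ → 2 * q * (d * a) + (2 * q * d * (m + ρ) + (d * n + (3 * q * n + (3 * q * n + d * n)))) ≡
      2 * q * (3 * n) + (2 * q * d * a + (d * (2 * q * ρ) + (d * (q * m + n) + (d * (q * m + n) + 0))))
    arith = solve-∀

  -- D times the amount by which part j falls short of 3n / D. The truncated subtraction is a true
  -- one by `V-large`.
  slack : Fin (suc s) → ℕ
  slack j = 3 * n ∸ D * # (V j)

  -- An upper bound on the part: any vertex in it is nonadjacent to all of the part but its few rich
  -- neighbours.
  V-large : ∀ j → D * # (V j) ≤ 3 * n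
  V-large j with 1 ≤? # (V j)
  ... | no none = ≤-trans (*-monoʳ-≤ D (≮⇒≥ none)) (≤-trans (≤-reflexive (*-zeroʳ D)) z≤n)
  ... | yes 1≤  with #-pos {A = V j} 1≤
  ...   | x , Vx = light-bound {x} (proj₁ (V-elim {j} {x} Vx)) (≤-trans (V-bound x (V-rich {j} {x} Vx))
    (+-monoˡ-≤ (richDegree x) (#-mono {A = V j ∩ not ∘ adj G x} λ y both → proj₂ (∧-elim {V j y} both))))

  V+slack : ∀ j → D * # (V j) + slack j ≡ 3 * n
  V+slack j = m+[n∸m]≡n (V-large j)

  -- Of the 3n / D vertices that x can afford to miss, |V j| are accounted for by its own part.
  missing≤slack : ∀ {j l x} → l ≢ j → V j x ≡ true → D * missing l x ≤ slack j
  missing≤slack {j} {l} {x} l≢j Vx = certify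
    (light-bound {x} (proj₁ (V-elim {j} {x} Vx)) (missing+V l≢j x (V-rich {j} {x} Vx)))
    (trans (cong (D * missing l x +_) (sym (V+slack j))) (arith D (missing l x) (# (V j)) (slack j)))
    where
    arith : ∀ d a v σ → d * a + (d * v + σ) ≡ σ + d * (a + v)
    arith = solve-∀

  -- 3 (s + 1) = D + 1, while the parts together contain exactly the vertices that are not heavy.
  ∑-slack : ∑ slack (allFin (suc s)) ≤ n + D * # Z
  ∑-slack = ≤-reflexive (+-cancelʳ-≡ (D * # W) (∑ slack (allFin (suc s))) (n + D * # Z) (begin
    ∑ slack (allFin (suc s)) + D * # W                                     ≡⟨ cong (λ w → ∑ slack (allFin (suc s)) + D * w) (sym ∑V) ⟩
    ∑ slack (allFin (suc s)) + D * ∑ (λ j → # (V j)) (allFin (suc s))      ≡⟨ trans (+-comm (∑ slack (allFin (suc s))) _) (cong (_+ ∑ slack (allFin (suc s))) (sym (∑-*ˡ D (λ j → # (V j)) (allFin (suc s))))) ⟩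
    ∑ (λ j → D * # (V j)) (allFin (suc s)) + ∑ slack (allFin (suc s))      ≡⟨ sym (∑-+ (λ j → D * # (V j)) slack (allFin (suc s))) ⟩
    ∑ (λ j → D * # (V j) + slack j) (allFin (suc s))                       ≡⟨ ∑-cong (allFin (suc s)) V+slack ⟩
    ∑ (λ _ → 3 * n) (allFin (suc s))                                       ≡⟨ trans (∑-const (3 * n) (allFin (suc s))) (cong (_* (3 * n)) (length-allFin (suc s))) ⟩
    suc s * (3 * n)                                                        ≡⟨ arith s n ⟩
    n + D * n                                                              ≡⟨ cong (λ m → n + D * m) (sym (#-not Z)) ⟩
    n + D * (# Z + # W)                                                    ≡⟨ trans (cong (n +_) (*-distribˡ-+ D (# Z) (# W))) (sym (+-assoc n (D * # Z) (D * # W))) ⟩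
    n + D * # Z + D * # W                                                  ∎))
    where
    open ≡-Reasoning
    arith : ∀ s n → suc s * (3 * n) ≡ n + (2 + 3 * s) * n
    arith = solve-∀
    ∑V : ∑ (λ j → # (V j)) (allFin (suc s)) ≡ # W
    ∑V = trans (∑-swap (λ j x → 𝟙 (V j x)) (allFin (suc s)) (allFin n)) (∑-cong (allFin n) λ x →
      trans (∑-cong (allFin (suc s)) λ j → 𝟙-∧ (W x) ⌊ p₀ x ≟ᶠ j ⌋) (trans (∑-*ˡ (𝟙 (W x)) (λ j → 𝟙 ⌊ p₀ x ≟ᶠ j ⌋) (allFin (suc s)))
        (trans (cong (𝟙 (W x) *_) (∑-≟ (p₀ x))) (*-identityʳ (𝟙 (W x))))))

  -- Cliques with one vertex in each part of js are chosen greedily; a vertex of V_j misses at most slack j / D vertices of any other part.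
  greedy : ∀ js (A : VSet n) → AllPairs _≢_ js →
    (∀ {l} → l ∈ js → 4 * (∑ slack js + D * # (V l ∩ not ∘ A)) + n ≤ 12 * n) →
    n ^ length js ≤ (4 * D) ^ length js * cliques G (length js) A
  greedy []       A _             _    = ≤-refl
  greedy (j ∷ js) A (j≢ ∷ js-uniq) room = begin
    n * n ^ k                                                        ≤⟨ *-monoˡ-≤ (n ^ k) first ⟩
    4 * D * # (V j ∩ A) * n ^ k                                      ≡⟨ trans (*-assoc (4 * D) (# (V j ∩ A)) (n ^ k)) (cong (4 * D *_) (sym (∑-*ʳ (𝟙 ∘ (V j ∩ A)) (n ^ k) (allFin n)))) ⟩
    4 * D * ∑ (λ x → 𝟙 ((V j ∩ A) x) * n ^ k) (allFin n)             ≤⟨ *-monoʳ-≤ (4 * D) (∑-mono (allFin n) step) ⟩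
    4 * D * ∑ (λ x → (4 * D) ^ k * (𝟙 (A x) * cl x)) (allFin n)      ≡⟨ cong (4 * D *_) (∑-*ˡ ((4 * D) ^ k) (λ x → 𝟙 (A x) * cl x) (allFin n)) ⟩
    4 * D * ((4 * D) ^ k * cliques G (suc k) A)                      ≡⟨ sym (*-assoc (4 * D) ((4 * D) ^ k) (cliques G (suc k) A)) ⟩
    4 * D * (4 * D) ^ k * cliques G (suc k) A                        ∎
    where
    open ≤-Reasoning
    k = length js
    cl : Fin n → ℕ
    cl x = cliques G k (A ∩ adj G x)
    -- `room` leaves D |V j ∩ A| = 3n - slack j - D |V j minus A| ≥ n / 4.
    first : n ≤ 4 * D * # (V j ∩ A)
    first = certify (room (here refl) ⊕ z≤n {4 * ∑ slack js}) (first-arith D n (slack j) (∑ slack js) (# (V j ∩ A)) (# (V j ∩ not ∘ A))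
      (trans (cong (λ v → D * v + slack j) (sym (#-∩-split (V j) A))) (V+slack j)))
      where
      collect : ∀ d n σ S a t → n + (12 * n + 4 * S) ≡ n + 4 * (3 * n) + 4 * S
      collect = solve-∀
      expand : ∀ d n σ S a t → n + 4 * (d * (a + t) + σ) + 4 * S ≡ 4 * d * a + (4 * (σ + S + d * t) + n + 0)
      expand = solve-∀
      first-arith : ∀ d n σ S a t → d * (a + t) + σ ≡ 3 * n → n + (12 * n + 4 * S) ≡ 4 * d * a + (4 * (σ + S + d * t) + n + 0)
      first-arith d n σ S a t eq = trans (collect d n σ S a t) (trans (cong (λ m → n + 4 * m + 4 * S) (sym eq)) (expand d n σ S a t))
    -- The invariant is kept: `slack j` leaves the sum, and x removes at most slack j / D further
    -- vertices from `V l`.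
    room′ : ∀ {x} → V j x ≡ true → ∀ {l} → l ∈ js → 4 * (∑ slack js + D * # (V l ∩ not ∘ (A ∩ adj G x))) + n ≤ 12 * n
    room′ {x} Vx {l} l∈ = certify (room (there l∈) ⊕ *-monoʳ-≤ 4 (missing≤slack {j} {l} {x} (λ { refl → All.lookup j≢ l∈ refl }) Vx) ⊕ *-monoʳ-≤ (4 * D) split)
      (arith D n (slack j) (∑ slack js) (# (V l ∩ not ∘ (A ∩ adj G x))) (# (V l ∩ not ∘ A)) (missing l x))
      where
      split : # (V l ∩ not ∘ (A ∩ adj G x)) ≤ # (V l ∩ not ∘ A) + missing l x
      split = #-≤-+ (V l ∩ not ∘ (A ∩ adj G x)) (V l ∩ not ∘ A) (V l ∩ not ∘ adj G x) pointwise
        where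
        pointwise : ∀ y → 𝟙 (V l y ∧ not (A y ∧ adj G x y)) ≤ 𝟙 (V l y ∧ not (A y)) + 𝟙 (V l y ∧ not (adj G x y))
        pointwise y with V l y | A y
        ... | false | _     = z≤n
        ... | true  | false = s≤s z≤n
        ... | true  | true  = ≤-refl
      arith : ∀ d n σ S c a b → 4 * (S + d * c) + n + (12 * n + (4 * σ + 4 * d * (a + b))) ≡ 12 * n + (4 * (σ + S + d * a) + n + (4 * (d * b) + 4 * d * c))
      arith = solve-∀
    step : ∀ x → 𝟙 ((V j ∩ A) x) * n ^ k ≤ (4 * D) ^ k * (𝟙 (A x) * cl x)
    step x with bool-cases ((V j ∩ A) x)
    ... | inj₂ out = ≤-trans (≤-reflexive (cong (λ b → 𝟙 b * n ^ k) out)) z≤n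
    ... | inj₁ both with ∧-elim {V j x} both
    ...   | Vx , Ax = begin
      𝟙 ((V j ∩ A) x) * n ^ k                ≡⟨ trans (cong (λ b → 𝟙 b * n ^ k) both) (*-identityˡ (n ^ k)) ⟩
      n ^ k                                  ≤⟨ greedy js (A ∩ adj G x) js-uniq (room′ Vx) ⟩
      (4 * D) ^ k * cl x                     ≡⟨ cong ((4 * D) ^ k *_) (sym (trans (cong (λ b → 𝟙 b * cl x) Ax) (*-identityˡ (cl x)))) ⟩
      (4 * D) ^ k * (𝟙 (A x) * cl x)         ∎

  -- `greedy` over the parts other than i requires the sum of their slacks plus D times the loss in
  -- each part to be at most 11n / 4. With #Z the number of heavy vertices, the slacks sum to at
  -- most n + D #Z - slack i, z loses at most 3n / 2 and v at most slack i + n / 8. The two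
  -- occurrences of slack i cancel, D #Z ≤ n / 8, and 1 + 3/2 + 1/8 + 1/8 = 11/4.
  pair-rich : ∀ i z v → (∀ {l} → l ≢ i → 2 * (D * missing l z) ≤ 3 * n) → (∀ {l} → l ≢ i → 8 * (D * missing l v) ≤ 8 * slack i + n) →
    rich z v ≡ true
  pair-rich i z v z-room v-room = rich⁺ (begin
    n ^ s                                                             ≤⟨ subst (λ k → n ^ k ≤ (4 * D) ^ k * cliques G k A) |js| (greedy js A js-uniq room) ⟩
    (4 * D) ^ s * cliques G s A                                       ≡⟨ sym (*-identityˡ _) ⟩
    1 * ((4 * D) ^ s * cliques G s A)                                 ≤⟨ *-monoˡ-≤ ((4 * D) ^ s * cliques G s A) (s≤s (z≤n {1 + s + (1 + s) * (2 + s)})) ⟩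
    (2 + s) * (2 + s) * ((4 * D) ^ s * cliques G s A)                 ≡⟨ sym (*-assoc ((2 + s) * (2 + s)) ((4 * D) ^ s) (cliques G s A)) ⟩
    (2 + s) * (2 + s) * (4 * D) ^ s * cliques G s A                   ≡⟨ cong (_* cliques G s A) (sym (richness-≡ s)) ⟩
    richness s * cliques G s A                                        ∎)
    where
    open ≤-Reasoning
    A = adj G z ∩ adj G v
    js = map (punchIn i) (allFin s)
    |js| : length js ≡ s
    |js| = trans (length-map (punchIn i) (allFin s)) (length-allFin s)
    js-uniq : AllPairs _≢_ js
    js-uniq = AllPairs.map⁺ (AllPairs.tabulate⁺ λ {a} {b} a≢b eq → a≢b (punchIn-injective i a b eq))
    js≢i : All (λ l → l ≢ i) js
    js≢i = All.map⁺ (All.tabulate λ {k} _ → punchInᵢ≢i i k)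
    slack-sum : slack i + ∑ slack js ≤ n + D * # Z
    slack-sum = ≤-trans (≤-reflexive (trans (cong (slack i +_) (∑-map slack (punchIn i) (allFin s))) (sym (∑-punchIn slack i)))) ∑-slack
    8DZ≤n : 8 * (D * # Z) ≤ n
    8DZ≤n = ≤-trans (≤-reflexive (regroup D (# Z))) (≤-trans (*-monoˡ-≤ (# Z) (*-monoʳ-≤ 2 4D≤q)) few-heavy)
      where
      regroup : ∀ d z → 8 * (d * z) ≡ 2 * (4 * d) * z
      regroup = solve-∀
    room : ∀ {l} → l ∈ js → 4 * (∑ slack js + D * # (V l ∩ not ∘ A)) + n ≤ 12 * n
    room {l} l∈ = *-cancelˡ-≤ 2 (certify
      (*-monoʳ-≤ 8 slack-sum ⊕ *-monoʳ-≤ 4 (z-room l≢i) ⊕ v-room l≢i ⊕ 8DZ≤n ⊕ *-monoʳ-≤ (8 * D) split)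
      (arith D n (slack i) (∑ slack js) (# Z) (# (V l ∩ not ∘ A)) (missing l z) (missing l v)))
      where
      l≢i : l ≢ i
      l≢i = All.lookup js≢i l∈
      split : # (V l ∩ not ∘ A) ≤ missing l z + missing l v
      split = #-≤-+ (V l ∩ not ∘ A) (V l ∩ not ∘ adj G z) (V l ∩ not ∘ adj G v) pointwise
        where
        pointwise : ∀ y → 𝟙 (V l y ∧ not (adj G z y ∧ adj G v y)) ≤ 𝟙 (V l y ∧ not (adj G z y)) + 𝟙 (V l y ∧ not (adj G v y))
        pointwise y with V l y | adj G z y
        ... | false | _     = z≤n
        ... | true  | false = s≤s z≤n
        ... | true  | true  = ≤-refl
      arith : ∀ d n σ S z c a b →
        2 * (4 * (S + d * c) + n) + (8 * (n + d * z) + (4 * (3 * n) + (8 * σ + n + (n + 8 * d * (a + b))))) ≡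
        2 * (12 * n) + (8 * (σ + S) + (4 * (2 * (d * a)) + (8 * (d * b) + (8 * (d * z) + 8 * d * c))))
      arith = solve-∀

  -- A heavy vertex goes to the part in which it misses the most vertices, so that it misses at most 3n / 2D of every other part.
  part : Fin n → Fin (suc s)
  part z = if Z z then proj₁ (argmax (λ j → missing j z)) else p₀ z

  private
    part-heavy : ∀ {z l} → Z z ≡ true → l ≢ part z → 2 * (D * missing l z) ≤ 3 * n
    part-heavy {z} {l} Zz l≢ = certify (miss-bound z ⊕ *-monoʳ-≤ D (missing-two l≢i z) ⊕ *-monoʳ-≤ D (proj₂ (argmax (λ j → missing j z)) l))
      (arith D n (missing l z) (missing i z) (miss G z))
      where
      i = proj₁ (argmax (λ j → missing j z))
      l≢i : l ≢ i
      l≢i l≡i = l≢ (trans l≡i (sym (cong (λ b → if b then i else p₀ z) Zz)))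
      arith : ∀ d n a b m → 2 * (d * a) + (3 * n + (d * m + d * b)) ≡ 3 * n + (d * m + (d * (a + b) + d * a))
      arith = solve-∀

    part-V : ∀ {x} → W x ≡ true → V (part x) x ≡ true
    part-V {x} Wx = ∧-intro Wx (decide (p₀ x ≟ᶠ part x) (sym (cong (λ b → if b then proj₁ (argmax (λ j → missing j x)) else p₀ x) (not-elim Wx))))

    V-room : ∀ {i x} → V i x ≡ true → ∀ {l} → l ≢ i → 8 * (D * missing l x) ≤ 8 * slack i + n
    V-room {i} {x} Vx l≢i = ≤-trans (*-monoʳ-≤ 8 (missing≤slack {i} {x = x} l≢i Vx)) (m≤m+n (8 * slack i) n)

    heavy-all-rich : ∀ {z} → Z z ≡ true → AllRich (part z) z
    heavy-all-rich {z} Zz {y} Vy _ = pair-rich (part z) z y (part-heavy Zz) (V-room {part z} {y} Vy)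

    -- This is where the threshold `4 * D` comes from: all edges from v into its part are rich and
    -- there are fewer than n / 8D of them, so v behaves like a light vertex of that part up to an
    -- error of n / 8.
    calm-room : ∀ {v} → Z v ≡ true → heavy (4 * D) v ≡ false → ∀ {l} → l ≢ part v → 8 * (D * missing l v) ≤ 8 * slack (part v) + n
    calm-room {v} Zv calm {l} l≢ = certify
      (*-monoʳ-≤ (8 * D) (missing+V l≢ v (heavy-all-rich Zv)) ⊕ *-monoʳ-≤ 8 (miss-bound v) ⊕ <⇒≤ (light⁻ calm))
      (arith-with D n (missing l v) (# (V (part v))) (slack (part v)) (miss G v) (richDegree v) (V+slack (part v)))
      where
      expand : ∀ d n a v σ m ρ → 8 * (d * a) + (8 * d * (m + ρ) + (8 * (d * v + σ) + n)) ≡ 8 * σ + n + (8 * d * (a + v) + (8 * (d * m) + 2 * (4 * d) * ρ))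
      expand = solve-∀
      arith-with : ∀ d n a v σ m ρ → d * v + σ ≡ 3 * n →
        8 * (d * a) + (8 * d * (m + ρ) + (8 * (3 * n) + n)) ≡ 8 * σ + n + (8 * d * (a + v) + (8 * (d * m) + 2 * (4 * d) * ρ))
      arith-with d n a v σ m ρ eq = trans (cong (λ t → 8 * (d * a) + (8 * d * (m + ρ) + (8 * t + n))) (sym eq)) (expand d n a v σ m ρ)

  -- Two light ends are covered by the base partition. Otherwise `pair-rich` applies with a heavy
  -- end as z and the other end as v, which is either light or, though heavy for q, has fewer than n
  -- / 8D rich neighbours.
  inside-edge : ∀ u v → adj G u v ≡ true → part u ≡ part v → rich u v ≡ true ⊎ (heavy (4 * D) u ≡ true × heavy (4 * D) v ≡ true)
  inside-edge u v uv pu≡pv = cases (bool-cases (Z u)) (bool-cases (Z v)) (bool-cases (heavy (4 * D) u)) (bool-cases (heavy (4 * D) v))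
    where
    Goal = rich u v ≡ true ⊎ (heavy (4 * D) u ≡ true × heavy (4 * D) v ≡ true)
    cases : Z u ≡ true ⊎ Z u ≡ false → Z v ≡ true ⊎ Z v ≡ false →
      heavy (4 * D) u ≡ true ⊎ heavy (4 * D) u ≡ false → heavy (4 * D) v ≡ true ⊎ heavy (4 * D) v ≡ false → Goal
    cases (inj₂ ¬Zu) (inj₂ ¬Zv) _ _ = inj₁ (V-rich {part u} {u} {v} (part-V (not-intro ¬Zu))
      (subst (λ i → V i v ≡ true) (sym pu≡pv) (part-V (not-intro ¬Zv))) uv)
    cases (inj₁ Zu) (inj₂ ¬Zv) _ _ = inj₁ (heavy-all-rich Zu (subst (λ i → V i v ≡ true) (sym pu≡pv) (part-V (not-intro ¬Zv))) uv)
    cases (inj₂ ¬Zu) (inj₁ Zv) _ _ = inj₁ (rich-sym {v} {u} (heavy-all-rich Zv (subst (λ i → V i u ≡ true) pu≡pv (part-V (not-intro ¬Zu))) (adj-sym′ G uv)))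
    cases (inj₁ Zu) (inj₁ Zv) (inj₁ hu) (inj₁ hv) = inj₂ (hu , hv)
    cases (inj₁ Zu) (inj₁ Zv) _ (inj₂ ¬hv) = inj₁ (pair-rich (part u) u v (part-heavy Zu)
      (subst (λ i → ∀ {l} → l ≢ i → 8 * (D * missing l v) ≤ 8 * slack i + n) (sym pu≡pv) (calm-room Zv ¬hv)))
    cases (inj₁ Zu) (inj₁ Zv) (inj₂ ¬hu) _ = inj₁ (rich-sym {v} {u} (pair-rich (part v) v u (part-heavy Zv)
      (subst (λ i → ∀ {l} → l ≢ i → 8 * (D * missing l u) ≤ 8 * slack i + n) pu≡pv (calm-room Zu ¬hu))))

-- From rationals to naturals

open import Data.Integer using (+_)

degree+miss : ∀ {n} (G : Graph n) v → degree G v + miss G v ≡ n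
degree+miss {n} G v = trans (cong (_+ miss G v) (length-filter (adj G v) (allFin n))) (#-not (adj G v))

toℚᵘ-/ : ∀ i d → ℚ.toℚᵘ (i ℚ./ suc d) ℚᵘ.≃ ℚᵘ.mkℚᵘ i d
toℚᵘ-/ i d = ℚ.toℚᵘ-fromℚᵘ (ℚᵘ.mkℚᵘ i d)

toℚᵘ-numerator : ∀ ε {i} → ℚ.↥ ε ≡ i → ℚ.toℚᵘ ε ≡ ℚᵘ.mkℚᵘ i (ℚ.ℚ.denominator-1 ε)
toℚᵘ-numerator record{} refl = refl

-- The degree condition multiplied by D and by the denominator of ε, with the negative term moved to
-- the right so that everything lives in ℕ.
degree-inequality : ∀ {n} (G : Graph n) s ε e → ℚ.↥ ε ≡ + suc e → MinDegreeAbove G (suc s) ε → ∀ v →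
  (2 + 3 * s) * ℚ.↧ₙ ε * n + suc e * (2 + 3 * s) * n < degree G v * ((2 + 3 * s) * ℚ.↧ₙ ε) + 3 * ℚ.↧ₙ ε * n
degree-inequality {n} G s ε e ↥ε above v = ℤ.drop‿+<+ (subst₂ ℤ._<_ left right (ℤ.+-monoˡ-< (+ 3 ℤ.* + k ℤ.* + n) cross))
  where
  D k d : ℕ
  D = 2 + 3 * s
  k = ℚ.↧ₙ ε
  d = degree G v
  t = ℚ.1ℚ ℚ.- threeOver (suc s)
  lhs : ℚ.toℚᵘ ((t ℚ.+ ε) ℚ.* ((+ n) ℚ./ 1)) ℚᵘ.≃ ((ℚᵘ.1ℚᵘ ℚᵘ.- ℚᵘ.mkℚᵘ (+ 3) (suc (3 * s))) ℚᵘ.+ ℚᵘ.mkℚᵘ (+ suc e) (ℚ.ℚ.denominator-1 ε)) ℚᵘ.* ℚᵘ.mkℚᵘ (+ n) 0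
  lhs = ℚᵘ.≃-trans (ℚ.toℚᵘ-homo-* (t ℚ.+ ε) ((+ n) ℚ./ 1)) (ℚᵘ.*-cong
    (ℚᵘ.≃-trans (ℚ.toℚᵘ-homo-+ t ε) (ℚᵘ.+-cong
      (ℚᵘ.≃-trans (ℚ.toℚᵘ-homo-+ ℚ.1ℚ (ℚ.- threeOver (suc s))) (ℚᵘ.+-congʳ ℚᵘ.1ℚᵘ
        (ℚᵘ.≃-trans (ℚ.toℚᵘ-homo‿- (threeOver (suc s))) (ℚᵘ.-‿cong (toℚᵘ-/ (+ 3) (suc (3 * s)))))))
      (ℚᵘ.≃-reflexive (toℚᵘ-numerator ε ↥ε))))
    (toℚᵘ-/ (+ n) 0))
  cross : (((+ 1 ℤ.* + D ℤ.+ (ℤ.- + 3) ℤ.* + 1) ℤ.* + k ℤ.+ + suc e ℤ.* + (1 * D)) ℤ.* + n) ℤ.* + 1 ℤ.< + d ℤ.* + (1 * D * k * 1)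
  cross = ℚᵘ.drop-*<* (ℚᵘ.<-respˡ-≃ lhs (ℚᵘ.<-respʳ-≃ (toℚᵘ-/ (+ d) 0) (ℚ.toℚᵘ-mono-< (above v))))
  pos-*³ : ∀ a b c → + (a * b * c) ≡ + a ℤ.* + b ℤ.* + c
  pos-*³ a b c = trans (ℤ.pos-* (a * b) c) (cong (ℤ._* + c) (ℤ.pos-* a b))
  left : (((+ 1 ℤ.* + D ℤ.+ (ℤ.- + 3) ℤ.* + 1) ℤ.* + k ℤ.+ + suc e ℤ.* + (1 * D)) ℤ.* + n) ℤ.* + 1 ℤ.+ + 3 ℤ.* + k ℤ.* + n
         ≡ + (D * k * n + suc e * D * n)
  left = trans (cong (λ m → (((+ 1 ℤ.* + D ℤ.+ (ℤ.- + 3) ℤ.* + 1) ℤ.* + k ℤ.+ + suc e ℤ.* + m) ℤ.* + n) ℤ.* + 1 ℤ.+ + 3 ℤ.* + k ℤ.* + n) (*-identityˡ D))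
    (trans (clear (+ D) (+ k) (+ suc e) (+ n) (+ 3))
      (sym (trans (ℤ.pos-+ (D * k * n) (suc e * D * n)) (cong₂ ℤ._+_ (pos-*³ D k n) (pos-*³ (suc e) D n)))))
    where
    clear : ∀ D k e n t → (((+ 1 ℤ.* D ℤ.+ (ℤ.- t) ℤ.* + 1) ℤ.* k ℤ.+ e ℤ.* D) ℤ.* n) ℤ.* + 1 ℤ.+ t ℤ.* k ℤ.* n ≡ D ℤ.* k ℤ.* n ℤ.+ e ℤ.* D ℤ.* n
    clear = ℤ.solve-∀
  right : + d ℤ.* + (1 * D * k * 1) ℤ.+ + 3 ℤ.* + k ℤ.* + n ≡ + (d * (D * k) + 3 * k * n)
  right = trans (cong (λ m → + d ℤ.* + m ℤ.+ + 3 ℤ.* + k ℤ.* + n) (trans (*-identityʳ (1 * D * k)) (cong (_* k) (*-identityˡ D))))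
    (sym (trans (ℤ.pos-+ (d * (D * k)) (3 * k * n)) (cong₂ ℤ._+_ (ℤ.pos-* d (D * k)) (pos-*³ 3 k n))))

positive-numerator : ∀ ε → 0ℚ ℚ.< ε → ∃ λ e → ℚ.↥ ε ≡ + suc e
positive-numerator (ℚ.mkℚ (+ suc e)     _ _) _                  = e , refl
positive-numerator (ℚ.mkℚ (+ zero)      _ _) (ℚ.*<* (ℤ.+<+ ()))
positive-numerator (ℚ.mkℚ (ℤ.-[1+ _ ]) _ _) (ℚ.*<* ())

-- The numerator of ε is rounded down to 1, so that 1 / (j k) ≤ ε with k the denominator. The free
-- factor j later lifts q = j k above 4D.
miss-inequality : ∀ {n} (G : Graph n) s ε e → ℚ.↥ ε ≡ + suc e → MinDegreeAbove G (suc s) ε → ∀ j → 1 ≤ j → ∀ v →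
  (2 + 3 * s) * (j * ℚ.↧ₙ ε * miss G v + n) ≤ 3 * (j * ℚ.↧ₙ ε) * n
miss-inequality {n} G s ε e ↥ε above j 1≤j v = certify
  (*-monoʳ-≤ j (<⇒≤ (degree-inequality G s ε e ↥ε above v)) ⊕ *-monoˡ-≤ (D * n) 1≤j ⊕ z≤n {j * (e * (D * n))})
  (arith D (ℚ.↧ₙ ε) j e (degree G v) (miss G v) n (degree+miss G v))
  where
  D = 2 + 3 * s
  arith : ∀ D k j e d m n → d + m ≡ n →
    D * (j * k * m + n) + (j * (d * (D * k) + 3 * k * n) + (j * (D * n) + j * (e * (D * n)))) ≡
    3 * (j * k) * n + (j * (D * k * n + suc e * D * n) + (1 * (D * n) + 0))
  arith D k j e d m _ refl = expand D k j e d m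
    where
    expand : ∀ D k j e d m →
      D * (j * k * m + (d + m)) + (j * (d * (D * k) + 3 * k * (d + m)) + (j * (D * (d + m)) + j * (e * (D * (d + m))))) ≡
      3 * (j * k) * (d + m) + (j * (D * k * (d + m) + suc e * D * (d + m)) + (1 * (D * (d + m)) + 0))
    expand = solve-∀

pos-≤-* : ∀ a c b → a ≤ c * b → (+ a) ℚ./ 1 ℚ.≤ ((+ c) ℚ./ 1) ℚ.* ((+ b) ℚ./ 1)
pos-≤-* a c b a≤cb = ℚ.toℚᵘ-cancel-≤ (ℚᵘ.≤-respˡ-≃ (ℚᵘ.≃-sym (toℚᵘ-/ (+ a) 0))
  (ℚᵘ.≤-respʳ-≃ (ℚᵘ.≃-sym (ℚᵘ.≃-trans (ℚ.toℚᵘ-homo-* ((+ c) ℚ./ 1) ((+ b) ℚ./ 1)) (ℚᵘ.*-cong (toℚᵘ-/ (+ c) 0) (toℚᵘ-/ (+ b) 0))))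
    (ℚᵘ.*≤* (subst₂ ℤ._≤_ (sym (ℤ.*-identityʳ (+ a))) (trans (ℤ.pos-* c b) (sym (ℤ.*-identityʳ (+ c ℤ.* + b)))) (ℤ.+≤+ a≤cb)))))

-- Counting deleted edges

≟-sym : ∀ {k} (i j : Fin k) → ⌊ i ≟ᶠ j ⌋ ≡ ⌊ j ≟ᶠ i ⌋
≟-sym i j with i ≟ᶠ j | j ≟ᶠ i
... | yes _   | yes _   = refl
... | no _    | no _    = refl
... | yes i≡j | no j≢i  = contradiction (sym i≡j) j≢i
... | no i≢j  | yes j≡i = contradiction (sym j≡i) i≢j

edgeCount-pos : ∀ {n} (G : Graph n) {u v} → adj G u v ≡ true → 1 ≤ edgeCount G
edgeCount-pos {n} G {u} {v} uv = by-order (<-cmp (toℕ u) (toℕ v))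
  where
  isEdge : Fin n × Fin n → Bool
  isEdge (x , y) = ⌊ toℕ x <? toℕ y ⌋ ∧ adj G x y
  ordered : ∀ {x y} → toℕ x < toℕ y → adj G x y ≡ true → 1 ≤ edgeCount G
  ordered {x} {y} x<y xy = ≤-trans (𝟙-true (∧-intro (decide (toℕ x <? toℕ y) x<y) xy))
    (≤-trans (f≤∑ (𝟙 ∘ isEdge) (∈-cartesianProduct⁺ (∈-allFin x) (∈-allFin y)))
      (≤-reflexive (sym (length-filter isEdge (cartesianProduct (allFin n) (allFin n))))))
  by-order : Tri (toℕ u < toℕ v) (toℕ u ≡ toℕ v) (toℕ v < toℕ u) → 1 ≤ edgeCount G
  by-order (tri< u<v _ _) = ordered u<v uv
  by-order (tri≈ _ u≡v _) = contradiction (toℕ-injective u≡v) (adj⇒≢ G uv)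
  by-order (tri> _ _ v<u) = ordered v<u (adj-sym′ G uv)

crossing : ∀ {n k} → Graph n → (Fin n → Fin k) → Graph n
crossing G p = record
  { adj    = λ u v → adj G u v ∧ not ⌊ p u ≟ᶠ p v ⌋
  ; sym    = λ u v → cong₂ _∧_ (adj-sym G u v) (cong not (≟-sym (p u) (p v)))
  ; irrefl = λ u → cong (_∧ not ⌊ p u ≟ᶠ p u ⌋) (adj-irrefl G u)
  }

crossing-partite : ∀ {n k} (G : Graph n) (p : Fin n → Fin k) → Partite k (crossing G p)
crossing-partite G p = p , λ u v uv eq → true≢false (decide (p u ≟ᶠ p v) eq) (not-elim (proj₂ (∧-elim {adj G u v} uv)))

edgeCount-crossing : ∀ {n k} (G R : Graph n) (A : VSet n) (p : Fin n → Fin k) →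
  (∀ u v → adj G u v ≡ true → p u ≡ p v → adj R u v ≡ true ⊎ (A u ≡ true × A v ≡ true)) →
  edgeCount G ≤ edgeCount (crossing G p) + (edgeCount R + # A * # A)
edgeCount-crossing {n} G R A p inside = begin
  edgeCount G                                                                ≡⟨ count G ⟩
  ∑ (edge G) all                                                             ≤⟨ ∑-mono all split ⟩
  ∑ (λ e → edge (crossing G p) e + (edge R e + both e)) all                  ≡⟨ trans (∑-+ (edge (crossing G p)) (λ e → edge R e + both e) all) (cong (λ m → ∑ (edge (crossing G p)) all + m) (∑-+ (edge R) both all)) ⟩
  ∑ (edge (crossing G p)) all + (∑ (edge R) all + ∑ both all)                ≡⟨ cong₂ _+_ (sym (count (crossing G p))) (cong₂ _+_ (sym (count R)) ∑both) ⟩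
  edgeCount (crossing G p) + (edgeCount R + # A * # A)                       ∎
  where
  open ≤-Reasoning
  all = cartesianProduct (allFin n) (allFin n)
  edge : Graph n → Fin n × Fin n → ℕ
  edge F (u , v) = 𝟙 (⌊ toℕ u <? toℕ v ⌋ ∧ adj F u v)
  both : Fin n × Fin n → ℕ
  both (u , v) = 𝟙 (A u) * 𝟙 (A v)
  count : ∀ F → edgeCount F ≡ ∑ (edge F) all
  count F = length-filter (λ (u , v) → ⌊ toℕ u <? toℕ v ⌋ ∧ adj F u v) all
  ∑both : ∑ both all ≡ # A * # A
  ∑both = trans (∑-product both (allFin n) (allFin n)) (trans (∑-cong (allFin n) λ u → ∑-*ˡ (𝟙 (A u)) (𝟙 ∘ A) (allFin n)) (∑-*ʳ (𝟙 ∘ A) (# A) (allFin n)))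
  cover : ∀ b g r a a′ e → (g ≡ true → e ≡ true → r ≡ true ⊎ (a ≡ true × a′ ≡ true)) →
    𝟙 (b ∧ g) ≤ 𝟙 (b ∧ (g ∧ not e)) + (𝟙 (b ∧ r) + 𝟙 a * 𝟙 a′)
  cover false _     _ _ _ _     _ = z≤n
  cover true  false _ _ _ _     _ = z≤n
  cover true  true  _ _ _ false _ = s≤s z≤n
  cover true  true  _ _ _ true  h with h refl refl
  ... | inj₁ refl          = s≤s z≤n
  ... | inj₂ (refl , refl) = m≤n+m 1 _
  split : ∀ e → edge G e ≤ edge (crossing G p) e + (edge R e + both e)
  split (u , v) = cover ⌊ toℕ u <? toℕ v ⌋ (adj G u v) (adj R u v) (A u) (A v) ⌊ p u ≟ᶠ p v ⌋
    λ uv eq → inside u v uv (witness (p u ≟ᶠ p v) eq)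

richGraph : ∀ {n} → Graph n → ℕ → Graph n
richGraph G s = record
  { adj    = λ u v → adj G u v ∧ rich u v
  ; sym    = λ u v → cong₂ _∧_ (adj-sym G u v) (rich-sym-≡ u v)
  ; irrefl = λ u → cong (_∧ rich u u) (adj-irrefl G u)
  }
  where open Rich G s

-- If some vertex is heavy then some edge is rich, so the boundedly many edges between heavy vertices are absorbed.
heavy-absorbed : ∀ {n} (G : Graph n) s q M → 1 ≤ n → # (Rich.heavy G s q) ≤ M →
  # (Rich.heavy G s q) * # (Rich.heavy G s q) ≤ M * M * edgeCount (richGraph G s)
heavy-absorbed {n} G s q M 1≤n ≤M with 1 ≤? # (Rich.heavy G s q)
... | no none = ≤-trans (*-mono-≤ (≮⇒≥ none) (≤-refl {# (Rich.heavy G s q)})) z≤n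
... | yes 1≤ with #-pos {A = Rich.heavy G s q} 1≤
...   | z , hz with #-pos {A = Rich.richNeighbours G s z} (positive (2 * q) (Rich.richDegree G s z) 1≤n (Rich.heavy⁻ G s hz))
...     | y , zy = ≤-trans (*-mono-≤ ≤M ≤M) (≤-trans (≤-reflexive (sym (*-identityʳ (M * M))))
                     (*-monoʳ-≤ (M * M) (edgeCount-pos (richGraph G s) {z} {y} zy)))

VertexBound : ∀ {h} → Graph h → ℕ → Set
VertexBound H s = ∀ q → Σ ℕ λ M → Σ ℕ λ N → ∀ {n} (G : Graph n) → N < n → ¬ Contains G H → # (Rich.heavy G s q) ≤ M

few-heavy-vertices : ∀ {h} (H : Graph h) s (c : Fin h → Fin (2 + s)) → ProperColouring H (2 + s) c → VertexBound H s
few-heavy-vertices H s c proper q = proj₁ few , proj₁ (proj₂ few) , λ G N<n H-free →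
  proj₂ (proj₂ few) G N<n H-free (Rich.heavy G s q) (Rich.heavy-cliques G s q)
  where few = few-rich-vertices H s c proper (2 * q * richness s)

few-deletions : ∀ {h} (H : Graph h) s → VertexBound H s → RichEdgeBound H s (richness s) →
    Σ ℚ λ C → (ε : ℚ) → 0ℚ ℚ.< ε → Σ ℕ λ n₀ →
    ∀ n → n₀ ≤ n → (G : Graph n) → MinDegreeAbove G (suc s) ε → ¬ Contains G H →
    (b : ℕ) → IsBiex n H (2 + s) b →
    Σ (Graph n) λ G' → SpanningSub G' G × Partite (suc s) G' ×
    ((+ (edgeCount G ∸ edgeCount G')) / 1 ℚ.≤ C ℚ.* ((+ b) / 1))
-- C₁ b bounds the rich edges, and M₀² C₁ b the edges between vertices heavy for `4D`. Both
-- constants are fixed before ε; only the threshold uses the bounds for q.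
few-deletions {h} H s vertexBound edgeBound = (+ (C₁ + M₀ * M₀ * C₁)) / 1 , λ ε 0<ε → threshold ε 0<ε , delete ε 0<ε
  where
  D 4D : ℕ
  D = 2 + 3 * s
  4D = 4 * D
  M₀ N₀ C₁ N₁ : ℕ
  M₀ = proj₁ (vertexBound 4D)
  N₀ = proj₁ (proj₂ (vertexBound 4D))
  C₁ = proj₁ edgeBound
  N₁ = proj₁ (proj₂ edgeBound)
  module _ (ε : ℚ) (0<ε : 0ℚ ℚ.< ε) where
    q Mq Nq threshold : ℕ
    q = 4D * ℚ.↧ₙ ε
    Mq = proj₁ (vertexBound q)
    Nq = proj₁ (proj₂ (vertexBound q))
    -- The summand `2 * q * Mq` turns the constant bound `Mq` on heavy vertices into the proportion
    -- 1 / 2q required by `Structure`.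
    threshold = suc (N₀ + N₁ + Nq + 2 * q * Mq)
    delete : ∀ n → threshold ≤ n → (G : Graph n) → MinDegreeAbove G (suc s) ε → ¬ Contains G H →
      (b : ℕ) → IsBiex n H (2 + s) b →
      Σ (Graph n) λ G' → SpanningSub G' G × Partite (suc s) G' ×
      ((+ (edgeCount G ∸ edgeCount G')) / 1 ℚ.≤ ((+ (C₁ + M₀ * M₀ * C₁)) / 1) ℚ.* ((+ b) / 1))
    delete n large G above H-free b (_ , extremal) =
      crossing G part , (λ u v uv → proj₁ (∧-elim {adj G u v} uv)) , crossing-partite G part , pos-≤-* (edgeCount G ∸ edgeCount (crossing G part)) (C₁ + M₀ * M₀ * C₁) b deleted
      where
      N₀<n : N₀ < n
      N₀<n = ≤-trans (s≤s (≤-trans (≤-trans (m≤m+n N₀ N₁) (m≤m+n (N₀ + N₁) Nq)) (m≤m+n (N₀ + N₁ + Nq) (2 * q * Mq)))) large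
      N₁<n : N₁ < n
      N₁<n = ≤-trans (s≤s (≤-trans (≤-trans (m≤n+m N₁ N₀) (m≤m+n (N₀ + N₁) Nq)) (m≤m+n (N₀ + N₁ + Nq) (2 * q * Mq)))) large
      Nq<n : Nq < n
      Nq<n = ≤-trans (s≤s (≤-trans (m≤n+m Nq (N₀ + N₁)) (m≤m+n (N₀ + N₁ + Nq) (2 * q * Mq)))) large
      1≤n : 1 ≤ n
      1≤n = ≤-trans (s≤s z≤n) large
      4D≤q : 4D ≤ q
      4D≤q = ≤-trans (≤-reflexive (sym (*-identityʳ 4D))) (*-monoʳ-≤ 4D (s≤s z≤n))
      numerator = positive-numerator ε 0<ε
      deg : ∀ v → D * (q * miss G v + n) ≤ 3 * q * n
      deg = miss-inequality G s ε (proj₁ numerator) (proj₂ numerator) above 4D (s≤s z≤n)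
      few-heavy : 2 * q * # (Rich.heavy G s q) ≤ n
      few-heavy = ≤-trans (*-monoʳ-≤ (2 * q) (proj₂ (proj₂ (vertexBound q)) G Nq<n H-free))
        (≤-trans (m≤n+m (2 * q * Mq) (N₀ + N₁ + Nq)) (<⇒≤ large))
      open Structure G s q 1≤n 4D≤q deg few-heavy
      R = richGraph G s
      R≤ : edgeCount R ≤ C₁ * b
      R≤ = proj₂ (proj₂ edgeBound) G N₁<n H-free miss-bound R
        (λ u v uv → proj₁ (∧-elim {adj G u v} uv)) (λ {u} {v} uv → Rich.rich⁻ G s (proj₂ (∧-elim {adj G u v} uv))) b extremal
      heavy² : # (Rich.heavy G s 4D) * # (Rich.heavy G s 4D) ≤ M₀ * M₀ * edgeCount R
      heavy² = heavy-absorbed G s 4D M₀ 1≤n (proj₂ (proj₂ (vertexBound 4D)) G N₀<n H-free)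
      inside : ∀ u v → adj G u v ≡ true → part u ≡ part v → adj R u v ≡ true ⊎ (Rich.heavy G s 4D u ≡ true × Rich.heavy G s 4D v ≡ true)
      inside u v uv eq = [ inj₁ ∘ ∧-intro uv , inj₂ ]′ (inside-edge u v uv eq)
      deleted : edgeCount G ∸ edgeCount (crossing G part) ≤ (C₁ + M₀ * M₀ * C₁) * b
      deleted = begin
        edgeCount G ∸ edgeCount (crossing G part)                                    ≤⟨ m≤n+o⇒m∸n≤o (edgeCount G) (edgeCount (crossing G part)) (edgeCount-crossing G R (Rich.heavy G s 4D) part inside) ⟩
        edgeCount R + # (Rich.heavy G s 4D) * # (Rich.heavy G s 4D)                  ≤⟨ R≤ ⊕ ≤-trans heavy² (*-monoʳ-≤ (M₀ * M₀) R≤) ⟩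
        C₁ * b + M₀ * M₀ * (C₁ * b)                                                  ≡⟨ collect C₁ (M₀ * M₀) b ⟩
        (C₁ + M₀ * M₀ * C₁) * b                                                      ∎
        where
        open ≤-Reasoning
        collect : ∀ c m b → c * b + m * (c * b) ≡ (c + m * c) * b
        collect = solve-∀

theorem6 : (r : ℕ) → 1 ≤ r → ∀ {h} (H : Graph h) → ChromaticNumber H (suc r) →
    Σ ℚ λ C → (ε : ℚ) → 0ℚ ℚ.< ε → Σ ℕ λ n₀ →
    ∀ n → n₀ ≤ n → (G : Graph n) → MinDegreeAbove G r ε → ¬ Contains G H →
    (b : ℕ) → IsBiex n H (suc r) b →
    Σ (Graph n) λ G' → SpanningSub G' G × Partite r G' ×
    ((+ (edgeCount G ∸ edgeCount G')) / 1 ℚ.≤ C ℚ.* ((+ b) / 1))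
theorem6 (suc s) _ H ((c , proper) , _) = few-deletions H s (few-heavy-vertices H s c proper) (few-rich-edges H s (richness s))
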